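{- For all integers $n\geq 0$, $a_3(7^2n+39)\equiv 0 \pmod{7^2}$.
   Context: For an integer $k\geq 1$ let $f_k:=\prod_{n\geq 1}(1-q^{kn})$. For an integer $c\geq 1$, the generalized cubic partition function $a_c(n)$ is defined by the generating function $\sum_{n\geq 0}a_c(n)q^n=\dfrac{1}{f_1f_2^{c-1}}$; in particular $\sum_{n\geq0}a_3(n)q^n=\dfrac{1}{f_1f_2^2}$. -}

module Defs where

open import Data.Bool.Base using (if_then_else_)
open import Data.Fin.Base using (Fin; zero; suc; toℕ)
open import Data.Integer.Base using (ℤ; 0ℤ; 1ℤ; _+_; _-_; _*_; -_)
open import Data.Integer.Properties
  using (+-0-commutativeMonoid; *-identityˡ; *-zeroˡ; +-identityʳ; +-inverseˡ)
open import Data.Nat.Base as ℕ using (ℕ; zero; suc; pred; NonZero; z≤n; s≤s; _≤′_; ≤′-refl; ≤′-step)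
import Data.Nat.Properties as ℕ
open import Data.Vec.Base using (Vec; []; _∷_; head; lookup)
open import Relation.Binary.PropositionalEquality
open import Relation.Nullary.Decidable using (does; dec-false)

open import Algebra.Properties.CommutativeMonoid.Sum +-0-commutativeMonoid
  using (sum; sum⁺-syntax; sum-cong-≗; sum-replicate-zero)

-- ℤ[[q]], a series being its sequence of coefficients; equality is _≗_.
PowerSeries : Set
PowerSeries = ℕ → ℤ

infixr 8 q^_
q^_ : ℕ → PowerSeries
(q^ k) m = if does (m ℕ.≟ k) then 1ℤ else 0ℤ

one : PowerSeries
one = q^ 0

infixl 6 _⊖_
_⊖_ : PowerSeries → PowerSeries → PowerSeries
(F ⊖ G) m = F m - G m

infixl 7 _⊛_
_⊛_ : PowerSeries → PowerSeries → PowerSeries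
(F ⊛ G) m = ∑[ i ≤ m ] (F (toℕ i) * G (m ℕ.∸ toℕ i))

infixr 8 _^^_
_^^_ : PowerSeries → ℕ → PowerSeries
F ^^ zero  = one
F ^^ suc e = F ⊛ F ^^ e

-- The coefficients of q^m, …, q^1, q^0 (in that order) of 1/F, for F with
-- constant coefficient 1, by solving F · (1/F) = 1 one coefficient at a time.
recipCoeffs : PowerSeries → (m : ℕ) → Vec ℤ (suc m)
recipCoeffs F zero    = 1ℤ ∷ []
recipCoeffs F (suc m) =
  (- ∑[ i ≤ m ] (F (suc (toℕ i)) * lookup (recipCoeffs F m) i)) ∷ recipCoeffs F m

-- Only meaningful when F 0 ≡ 1ℤ; see recip-inverse.
recip : PowerSeries → PowerSeries
recip F m = head (recipCoeffs F m)

-- ∏_{1 ≤ n ≤ N} (1 - q^{kn})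
fUpTo : ℕ → ℕ → PowerSeries
fUpTo k zero    = one
fUpTo k (suc N) = (one ⊖ q^ (k ℕ.* suc N)) ⊛ fUpTo k N

-- The infinite product ∏_{n ≥ 1} (1 - q^{kn}): since k ≥ 1, factors with n > m
-- do not affect the coefficient of q^m; see f-limit.
f : (k : ℕ) .{{_ : NonZero k}} → PowerSeries
f k m = fUpTo k m m

-- The generalized cubic partition function, with generating function
-- 1 / (f₁ f₂^{c-1}).
a : (c : ℕ) .{{_ : NonZero c}} → ℕ → ℤ
a c = recip (f 1 ⊛ f 2 ^^ pred c)

private
  q^-off : ∀ {k m} → m ℕ.< k → (q^ k) m ≡ 0ℤ
  q^-off {k} {m} m<k rewrite dec-false (m ℕ.≟ k) (ℕ.<⇒≢ m<k) = refl

  ⊛-identityˡ-upTo : ∀ F G m → F 0 ≡ 1ℤ → (∀ i → i ℕ.< m → F (suc i) ≡ 0ℤ) →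
                     (F ⊛ G) m ≡ G m
  ⊛-identityˡ-upTo F G m F₀ F₊ = begin
    F 0 * G m + sum tail            ≡⟨ cong₂ _+_ (cong (_* G m) F₀) tail≡0 ⟩
    1ℤ * G m + 0ℤ                   ≡⟨ +-identityʳ _ ⟩
    1ℤ * G m                        ≡⟨ *-identityˡ _ ⟩
    G m                             ∎
    where
    open ≡-Reasoning
    tail : Fin m → ℤ
    tail i = F (suc (toℕ i)) * G (m ℕ.∸ suc (toℕ i))
    tail≡0 : sum tail ≡ 0ℤ
    tail≡0 = trans
      (sum-cong-≗ (λ i → trans (cong (_* G (m ℕ.∸ suc (toℕ i))) (F₊ (toℕ i) (toℕ<n i)))
                               (*-zeroˡ (G (m ℕ.∸ suc (toℕ i))))))
      (sum-replicate-zero m)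
      where open import Data.Fin.Properties using (toℕ<n)

  fUpTo-suc : ∀ k .{{_ : NonZero k}} {m N} → m ℕ.≤ N → fUpTo k (suc N) m ≡ fUpTo k N m
  fUpTo-suc k {m} {N} m≤N = ⊛-identityˡ-upTo (one ⊖ q^ (k ℕ.* suc N)) (fUpTo k N) m
    (cong (λ x → 1ℤ - x) (q^-off {k ℕ.* suc N} {0} (ℕ.≤-<-trans z≤n m<kN)))
    (λ i i<m → cong (λ x → 0ℤ - x) (q^-off (ℕ.≤-<-trans i<m m<kN)))
    where
    m<kN : m ℕ.< k ℕ.* suc N
    m<kN = ℕ.≤-trans (s≤s m≤N) (ℕ.m≤n*m (suc N) k)

f-limit : ∀ k .{{_ : NonZero k}} {m N} → m ℕ.≤ N → fUpTo k N m ≡ f k m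
f-limit k m≤N = go (ℕ.≤⇒≤′ m≤N)
  where
  go : ∀ {m N} → m ≤′ N → fUpTo k N m ≡ f k m
  go ≤′-refl       = refl
  go (≤′-step m≤N) = trans (fUpTo-suc k (ℕ.≤′⇒≤ m≤N)) (go m≤N)

private
  lookup-recipCoeffs : ∀ F m (i : Fin (suc m)) →
                       lookup (recipCoeffs F m) i ≡ recip F (m ℕ.∸ toℕ i)
  lookup-recipCoeffs F zero    zero    = refl
  lookup-recipCoeffs F (suc m) zero    = refl
  lookup-recipCoeffs F (suc m) (suc i) = lookup-recipCoeffs F m i

  ⊛-constant : ∀ {F G} → F 0 ≡ 1ℤ → G 0 ≡ 1ℤ → (F ⊛ G) 0 ≡ 1ℤ
  ⊛-constant F₀ G₀ rewrite F₀ | G₀ = refl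

  ^^-constant : ∀ {F} e → F 0 ≡ 1ℤ → (F ^^ e) 0 ≡ 1ℤ
  ^^-constant     zero    F₀ = refl
  ^^-constant {F} (suc e) F₀ = ⊛-constant {F} {F ^^ e} F₀ (^^-constant {F} e F₀)

recip-inverse : ∀ {F} → F 0 ≡ 1ℤ → F ⊛ recip F ≗ one
recip-inverse {F} F₀ zero rewrite F₀ = refl
recip-inverse {F} F₀ (suc m) = begin
  F 0 * - s + s′    ≡⟨ cong₂ _+_ (cong (_* - s) F₀) (sum-cong-≗ eq) ⟩
  1ℤ * - s + s      ≡⟨ cong (_+ s) (*-identityˡ (- s)) ⟩
  - s + s           ≡⟨ +-inverseˡ s ⟩
  0ℤ                ∎
  where
  open ≡-Reasoning
  s s′ : ℤ
  s  = ∑[ i ≤ m ] (F (suc (toℕ i)) * lookup (recipCoeffs F m) i)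
  s′ = ∑[ i ≤ m ] (F (suc (toℕ i)) * recip F (m ℕ.∸ toℕ i))
  eq : ∀ i → F (suc (toℕ i)) * recip F (m ℕ.∸ toℕ i)
           ≡ F (suc (toℕ i)) * lookup (recipCoeffs F m) i
  eq i = cong (F (suc (toℕ i)) *_) (sym (lookup-recipCoeffs F m i))

a-generatingFunction : ∀ c .{{_ : NonZero c}} → (f 1 ⊛ f 2 ^^ pred c) ⊛ a c ≗ one
a-generatingFunction c = recip-inverse {f 1 ⊛ f 2 ^^ pred c}
  (⊛-constant {f 1} {f 2 ^^ pred c} refl (^^-constant {f 2} (pred c) refl))

{-# OPTIONS --safe #-}
-- Let θ = f₁⁵/f₂² = ∑ (6n+1) q^(n(3n+1)/2) and f₁ = ∑ (-1)ⁿ q^(n(3n+1)/2), so that a₃ f₁⁷ = f₁ θ. The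
-- coefficient of q^N in f₁ θ is a sum of ± x over 24N + 2 = x² + z²; for N = 7n + 4 this forces 7 ∣ x and
-- 7 ∣ z, since -1 is not a square modulo 7.  To replace f₁⁷ by a series in q⁷ modulo 49, write
-- f₁⁷ = f₇ (1 + 7u).  Then u ≡ κ - ∑ σ₅(n) qⁿ modulo 7, where the coefficients κₙ with 7 ∤ n vanish modulo 7,
-- and the third Rankin–Cohen bracket B of θ and f₁, a theta series whose coefficients are sums of ± p(x, z) with
-- p of degree 7, equals (98 X E₄ - 90 E₆) f₁ θ with X = 2 E₂(q²) - E₂(q), hence ≡ (8 - 14 ∑ σ₅(n) qⁿ) f₁ θ modulo 49.  So
-- 2 a₃ f₇ ≡ 10 f₁ θ - B - 14 κ f₁ θ modulo 49, whose coefficients at 7n + 4 vanish modulo 7, and modulo 49 unless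
-- 7 ∣ n.  Dividing the section a₃(7n + 4) by 7 and multiplying by f₁⁷ = f₁ (f₁³)², Jacobi's series for f₁³
-- and the same anisotropy give the second factor 7 at n ≡ 5 modulo 7.
--
-- The identity for B needs the differential equations of the Eisenstein series of levels 1 and 2.  They are read
-- off from the z-moments of the triple products ∑ (±1)ⁿ zⁿ q^(n(n-1)/2) at z = 1: the logarithmic derivative in z
-- expresses them through Lambert series, the heat equation through the derivation q d/dq.
module Submission where

open import Defs
open import Data.Nat.Base using (ℕ; _+_; _*_; _^_)
open import Data.Integer.Base using (+_)
open import Data.Integer.Divisibility using (_∣_)

open import Algebra.Bundles using (CommutativeRing)
open import Algebra.Solver.Ring.AlmostCommutativeRing using (fromCommutativeRing; _-Raw-AlmostCommutative⟶_)
open import Algebra.Structures using (IsCommutativeRing)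
open import Data.Bool.Base using (if_then_else_)
open import Data.Integer.Base as ℤ using (ℤ; 0ℤ; 1ℤ)
open import Data.Integer.Divisibility.Signed as Signed using () renaming (_∣_ to _∣ₛ_)
open import Data.Integer.Tactic.RingSolver using (solve-∀)
open import Data.Maybe.Base using (Maybe; just; nothing)
open import Data.Nat.Base using (zero; suc; pred; _∸_; _≤_; _<_; z≤n; s≤s; NonZero)
open import Data.Nat.DivMod using (_/_; _%_; m*n/n≡m; m≡m%n+[m/n]*n; m%n<n)
open import Data.Nat.Divisibility
  using (_∤_; divides; _∣?_; m∣m*n; ∣m⇒∣m*n; ∣m+n∣m⇒∣n; ∣m∣n⇒∣m+n; m%n≡0⇒n∣m; ∣⇒≤)
  renaming (_∣_ to _∣ℕ_)
open import Data.Nat.Primality using (prime?; euclidsLemma)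
open import Data.Product.Base using (Σ; _×_; _,_; proj₁; proj₂)
open import Data.Sum.Base using (_⊎_; inj₁; inj₂)
open import Function.Base using (_∘_)
open import Level using (0ℓ)
open import Relation.Binary.PropositionalEquality
open import Relation.Nullary.Decidable using (yes; no; does; dec-true; dec-false; from-yes; from-no)
open import Relation.Nullary.Negation using (contradiction)
import Algebra.Solver.Ring
import Data.Integer.Properties as ℤ
import Data.Integer.Solver
import Data.Nat.Properties as ℕ
import Data.Nat.Tactic.RingSolver as ℕ-ring
import Relation.Binary.Reasoning.Setoid

-- The obstacle is that f₁⁷ is a series in q⁷ only modulo 7. Logarithmic derivatives give n uₙ ≡ -
-- σ₁(n) modulo 7 for 7 ∤ n, so the error u is an antiderivative of a divisor sum. By Fermat, n
-- σ₅(n) ≡ σ₁(n), which points to E₆, whose constant 504 is divisible by 7. The product f₁ θ has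
-- weight 2 and the r-th bracket has weight 2 + 2r, so r = 3 is the order at which their quotient
-- has weight 6. If x² = 24k + 1 and z² = 24l + 1 for the exponents k and l of the two series, the
-- bracket replaces x = Re (x + z√-1) by Re (x + z√-1)⁷ = x⁷ - 21x⁵z² + 35x³z⁴ - 7xz⁶, which is
-- highly divisible by 7 once 7 divides x and z. Everything takes place in ℤ[[q]]. Where modular
-- forms would offer a dimension count, an identity between Eisenstein series is found by computing
-- one derivative in two ways. Product formulas come from equal logarithmic derivatives or, for θ,
-- from the quintuple product identity.

y : ℤ → ℤ
y n = + 2 ℤ.* n ℤ.- 1ℤ

-- The polynomials Pₖ satisfy Pₖ(1 + n) - Pₖ(n) = c y(1 + n)ᵏ and Pₖ(0) = 0, and the polynomials
-- Aₖ satisfy - Aₖ(1 + n) - Aₖ(n) = - 2 y(1 + n)ᵏ and Aₖ(0) = 0; this evaluates power sums.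
P₂ P₄ P₆ A₁ A₃ A₅ : ℤ → ℤ
P₂ n = + 1 ℤ.* y n ℤ.- + 1 ℤ.* y n ℤ.^ 3 ℤ.+ + 3 ℤ.* (n ℤ.* y n ℤ.^ 2)
P₄ n = ℤ.- (+ 6 ℤ.* y n ℤ.^ 5) ℤ.+ + 10 ℤ.* y n ℤ.^ 3 ℤ.- + 4 ℤ.* y n ℤ.+ + 15 ℤ.* (n ℤ.* y n ℤ.^ 4)
P₆ n = ℤ.- (+ 9 ℤ.* y n ℤ.^ 7) ℤ.+ + 21 ℤ.* y n ℤ.^ 5 ℤ.- + 28 ℤ.* y n ℤ.^ 3 ℤ.+ + 16 ℤ.* y n ℤ.+ + 21 ℤ.* (n ℤ.* y n ℤ.^ 6)
A₁ n = 1ℤ ℤ.- y n ℤ.^ 2 ℤ.+ + 2 ℤ.* (n ℤ.* y n)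
A₃ n = + 3 ℤ.* y n ℤ.^ 2 ℤ.- + 2 ℤ.- y n ℤ.^ 4 ℤ.+ + 2 ℤ.* (n ℤ.* y n ℤ.^ 3)
A₅ n = ℤ.- y n ℤ.^ 6 ℤ.+ + 5 ℤ.* y n ℤ.^ 4 ℤ.- + 20 ℤ.* y n ℤ.^ 2 ℤ.+ + 16 ℤ.+ + 2 ℤ.* (n ℤ.* y n ℤ.^ 5)

-- Polynomial identities for power sums, differences of powers and sixth powers

module PowerSums where
  module Z = Data.Integer.Solver.+-*-Solver
  open Z using (_:+_; _:*_; _:-_; :-_; con; _:=_; _:^_; Polynomial)

  Y : ∀ {k} → Polynomial k → Polynomial k
  Y n = con (+ 2) :* n :- con 1ℤ

  P₂-suc : ∀ n → P₂ n ℤ.+ + 3 ℤ.* y (1ℤ ℤ.+ n) ℤ.^ 2 ≡ P₂ (1ℤ ℤ.+ n)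
  P₂-suc = Z.solve 1 (λ n → p n :+ con (+ 3) :* Y (con 1ℤ :+ n) :^ 2 := p (con 1ℤ :+ n)) refl
    where
    p : Polynomial 1 → Polynomial 1
    p n = con (+ 1) :* Y n :- con (+ 1) :* Y n :^ 3 :+ con (+ 3) :* (n :* Y n :^ 2)

  P₄-suc : ∀ n → P₄ n ℤ.+ + 15 ℤ.* y (1ℤ ℤ.+ n) ℤ.^ 4 ≡ P₄ (1ℤ ℤ.+ n)
  P₄-suc = Z.solve 1 (λ n → p n :+ con (+ 15) :* Y (con 1ℤ :+ n) :^ 4 := p (con 1ℤ :+ n)) refl
    where
    p : Polynomial 1 → Polynomial 1
    p n = :- (con (+ 6) :* Y n :^ 5) :+ con (+ 10) :* Y n :^ 3 :- con (+ 4) :* Y n :+ con (+ 15) :* (n :* Y n :^ 4)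

  P₆-suc : ∀ n → P₆ n ℤ.+ + 21 ℤ.* y (1ℤ ℤ.+ n) ℤ.^ 6 ≡ P₆ (1ℤ ℤ.+ n)
  P₆-suc = Z.solve 1 (λ n → p n :+ con (+ 21) :* Y (con 1ℤ :+ n) :^ 6 := p (con 1ℤ :+ n)) refl
    where
    p : Polynomial 1 → Polynomial 1
    p n = :- (con (+ 9) :* Y n :^ 7) :+ con (+ 21) :* Y n :^ 5 :- con (+ 28) :* Y n :^ 3 :+ con (+ 16) :* Y n
          :+ con (+ 21) :* (n :* Y n :^ 6)

  A₁-suc : ∀ s n → s ℤ.* A₁ n ℤ.+ + 2 ℤ.* (ℤ.- s ℤ.* y (1ℤ ℤ.+ n)) ≡ ℤ.- s ℤ.* A₁ (1ℤ ℤ.+ n)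
  A₁-suc = Z.solve 2 (λ s n → s :* p n :+ con (+ 2) :* (:- s :* Y (con 1ℤ :+ n)) := :- s :* p (con 1ℤ :+ n)) refl
    where
    p : Polynomial 2 → Polynomial 2
    p n = con 1ℤ :- Y n :^ 2 :+ con (+ 2) :* (n :* Y n)

  A₃-suc : ∀ s n → s ℤ.* A₃ n ℤ.+ + 2 ℤ.* (ℤ.- s ℤ.* y (1ℤ ℤ.+ n) ℤ.^ 3) ≡ ℤ.- s ℤ.* A₃ (1ℤ ℤ.+ n)
  A₃-suc = Z.solve 2 (λ s n → s :* p n :+ con (+ 2) :* (:- s :* Y (con 1ℤ :+ n) :^ 3) := :- s :* p (con 1ℤ :+ n)) refl
    where
    p : Polynomial 2 → Polynomial 2
    p n = con (+ 3) :* Y n :^ 2 :- con (+ 2) :- Y n :^ 4 :+ con (+ 2) :* (n :* Y n :^ 3)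

  A₅-suc : ∀ s n → s ℤ.* A₅ n ℤ.+ + 2 ℤ.* (ℤ.- s ℤ.* y (1ℤ ℤ.+ n) ℤ.^ 5) ≡ ℤ.- s ℤ.* A₅ (1ℤ ℤ.+ n)
  A₅-suc = Z.solve 2 (λ s n → s :* p n :+ con (+ 2) :* (:- s :* Y (con 1ℤ :+ n) :^ 5) := :- s :* p (con 1ℤ :+ n)) refl
    where
    p : Polynomial 2 → Polynomial 2
    p n = :- Y n :^ 6 :+ con (+ 5) :* Y n :^ 4 :- con (+ 20) :* Y n :^ 2 :+ con (+ 16) :+ con (+ 2) :* (n :* Y n :^ 5)

  y²-difference : ∀ z m → y (z ℤ.+ m) ℤ.^ 2 ℤ.- y (z ℤ.- m) ℤ.^ 2 ≡ + 8 ℤ.* (y z ℤ.^ 1 ℤ.* m ℤ.^ 1)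
  y²-difference = Z.solve 2 (λ z m → Y (z :+ m) :^ 2 :- Y (z :- m) :^ 2 := con (+ 8) :* (Y z :^ 1 :* m :^ 1)) refl

  y⁴-difference : ∀ z m → y (z ℤ.+ m) ℤ.^ 4 ℤ.- y (z ℤ.- m) ℤ.^ 4 ≡
    + 16 ℤ.* (y z ℤ.^ 3 ℤ.* m ℤ.^ 1) ℤ.+ + 64 ℤ.* (y z ℤ.^ 1 ℤ.* m ℤ.^ 3)
  y⁴-difference = Z.solve 2 (λ z m → Y (z :+ m) :^ 4 :- Y (z :- m) :^ 4 :=
    con (+ 16) :* (Y z :^ 3 :* m :^ 1) :+ con (+ 64) :* (Y z :^ 1 :* m :^ 3)) refl

  y⁶-difference : ∀ z m → y (z ℤ.+ m) ℤ.^ 6 ℤ.- y (z ℤ.- m) ℤ.^ 6 ≡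
    + 24 ℤ.* (y z ℤ.^ 5 ℤ.* m ℤ.^ 1) ℤ.+ (+ 320 ℤ.* (y z ℤ.^ 3 ℤ.* m ℤ.^ 3) ℤ.+ + 384 ℤ.* (y z ℤ.^ 1 ℤ.* m ℤ.^ 5))
  y⁶-difference = Z.solve 2 (λ z m → Y (z :+ m) :^ 6 :- Y (z :- m) :^ 6 :=
    con (+ 24) :* (Y z :^ 5 :* m :^ 1) :+ (con (+ 320) :* (Y z :^ 3 :* m :^ 3) :+ con (+ 384) :* (Y z :^ 1 :* m :^ 5))) refl

  y-difference : ∀ s t z m → s ℤ.* t ℤ.* y (z ℤ.+ m) ℤ.- s ℤ.* t ℤ.* y (z ℤ.- m) ≡
    + 4 ℤ.* (s ℤ.* y z ℤ.^ 0 ℤ.* (t ℤ.* m ℤ.^ 1))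
  y-difference = Z.solve 4 (λ s t z m → s :* t :* Y (z :+ m) :- s :* t :* Y (z :- m) :=
    con (+ 4) :* (s :* Y z :^ 0 :* (t :* m :^ 1))) refl

  y³-difference : ∀ s t z m → s ℤ.* t ℤ.* y (z ℤ.+ m) ℤ.^ 3 ℤ.- s ℤ.* t ℤ.* y (z ℤ.- m) ℤ.^ 3 ≡
    + 12 ℤ.* (s ℤ.* y z ℤ.^ 2 ℤ.* (t ℤ.* m ℤ.^ 1)) ℤ.+ + 16 ℤ.* (s ℤ.* y z ℤ.^ 0 ℤ.* (t ℤ.* m ℤ.^ 3))
  y³-difference = Z.solve 4 (λ s t z m → s :* t :* Y (z :+ m) :^ 3 :- s :* t :* Y (z :- m) :^ 3 :=
    con (+ 12) :* (s :* Y z :^ 2 :* (t :* m :^ 1)) :+ con (+ 16) :* (s :* Y z :^ 0 :* (t :* m :^ 3))) refl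

  y⁵-difference : ∀ s t z m → s ℤ.* t ℤ.* y (z ℤ.+ m) ℤ.^ 5 ℤ.- s ℤ.* t ℤ.* y (z ℤ.- m) ℤ.^ 5 ≡
    + 20 ℤ.* (s ℤ.* y z ℤ.^ 4 ℤ.* (t ℤ.* m ℤ.^ 1)) ℤ.+ (+ 160 ℤ.* (s ℤ.* y z ℤ.^ 2 ℤ.* (t ℤ.* m ℤ.^ 3)) ℤ.+
    + 64 ℤ.* (s ℤ.* y z ℤ.^ 0 ℤ.* (t ℤ.* m ℤ.^ 5)))
  y⁵-difference = Z.solve 4 (λ s t z m → s :* t :* Y (z :+ m) :^ 5 :- s :* t :* Y (z :- m) :^ 5 :=
    con (+ 20) :* (s :* Y z :^ 4 :* (t :* m :^ 1)) :+ (con (+ 160) :* (s :* Y z :^ 2 :* (t :* m :^ 3)) :+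
    con (+ 64) :* (s :* Y z :^ 0 :* (t :* m :^ 5)))) refl

  sixth-power-difference : ∀ x z → x ℤ.^ 6 ℤ.- z ℤ.^ 6 ≡
    (x ℤ.- z) ℤ.* (x ℤ.^ 5 ℤ.+ x ℤ.^ 4 ℤ.* z ℤ.+ x ℤ.^ 3 ℤ.* z ℤ.^ 2 ℤ.+ x ℤ.^ 2 ℤ.* z ℤ.^ 3 ℤ.+ x ℤ.* z ℤ.^ 4 ℤ.+ z ℤ.^ 5)
  sixth-power-difference = Z.solve 2 (λ x z → x :^ 6 :- z :^ 6 :=
    (x :- z) :* (x :^ 5 :+ x :^ 4 :* z :+ x :^ 3 :* z :^ 2 :+ x :^ 2 :* z :^ 3 :+ x :* z :^ 4 :+ z :^ 5)) refl

  sixth-power-sum : ∀ x z → x ℤ.^ 6 ℤ.+ z ℤ.^ 6 ≡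
    (x ℤ.* x ℤ.+ z ℤ.* z) ℤ.* (x ℤ.^ 4 ℤ.- x ℤ.^ 2 ℤ.* z ℤ.^ 2 ℤ.+ z ℤ.^ 4)
  sixth-power-sum = Z.solve 2 (λ x z → x :^ 6 :+ z :^ 6 :=
    (x :* x :+ z :* z) :* (x :^ 4 :- x :^ 2 :* z :^ 2 :+ z :^ 4)) refl

open PowerSums using (P₂-suc; P₄-suc; P₆-suc; A₁-suc; A₃-suc; A₅-suc; y²-difference; y⁴-difference; y⁶-difference;
  y-difference; y³-difference; y⁵-difference; sixth-power-difference; sixth-power-sum)

-- The commutative ring of power series

infixl 6 _⊞_
infix 8 ⊝_
infixl 7 _⊠_
infixl 6 _⊟_
infixr 7 _·_

K : ℤ → PowerSeries
K c zero    = c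
K c (suc _) = 0ℤ

opaque
  _⊞_ : PowerSeries → PowerSeries → PowerSeries
  (F ⊞ G) n = F n ℤ.+ G n

  ⊝_ : PowerSeries → PowerSeries
  (⊝ F) n = ℤ.- F n

  _⊠_ : PowerSeries → PowerSeries → PowerSeries
  _⊠_ = _⊛_

  _·_ : ℤ → PowerSeries → PowerSeries
  (c · F) n = c ℤ.* F n

  -- Infinite sums and products inside a product are compared with their truncations through this
  -- fact.
  ⊠-local : ∀ {F F′ G G′} n → (∀ i → i ≤ n → F i ≡ F′ i) → (∀ i → i ≤ n → G i ≡ G′ i) →
            (F ⊠ G) n ≡ (F′ ⊠ G′) n
  ⊠-local zero    F≡ G≡ = cong₂ (λ x y → x ℤ.* y ℤ.+ 0ℤ) (F≡ 0 z≤n) (G≡ 0 z≤n)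
  ⊠-local {F} {F′} {G} {G′} (suc n) F≡ G≡ =
    cong₂ ℤ._+_ (cong₂ ℤ._*_ (F≡ 0 z≤n) (G≡ (suc n) ℕ.≤-refl))
      (⊠-local {F ∘ suc} {F′ ∘ suc} {G} {G′} n (λ i i≤n → F≡ (suc i) (s≤s i≤n))
               (λ i i≤n → G≡ i (ℕ.m≤n⇒m≤1+n i≤n)))

  ⊠-≗-cong : ∀ {F F′ G G′} → F ≗ F′ → G ≗ G′ → F ⊠ G ≗ F′ ⊠ G′
  ⊠-≗-cong {F} {F′} {G} {G′} p q n = ⊠-local {F} {F′} {G} {G′} n (λ i _ → p i) (λ i _ → q i)

  ⊠-distribʳ : ∀ H F G → (F ⊞ G) ⊠ H ≗ F ⊠ H ⊞ G ⊠ H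
  ⊠-distribʳ H F G zero = regroup (F 0) (G 0) (H 0)
    where
    regroup : ∀ f g h → (f ℤ.+ g) ℤ.* h ℤ.+ 0ℤ ≡ (f ℤ.* h ℤ.+ 0ℤ) ℤ.+ (g ℤ.* h ℤ.+ 0ℤ)
    regroup = solve-∀
  ⊠-distribʳ H F G (suc n) =
    trans (cong (ℤ._+_ ((F 0 ℤ.+ G 0) ℤ.* H (suc n))) (⊠-distribʳ H (F ∘ suc) (G ∘ suc) n))
      (regroup (F 0) (G 0) (H (suc n)) (((F ∘ suc) ⊠ H) n) (((G ∘ suc) ⊠ H) n))
    where
    regroup : ∀ f g h a b →
              (f ℤ.+ g) ℤ.* h ℤ.+ (a ℤ.+ b) ≡ (f ℤ.* h ℤ.+ a) ℤ.+ (g ℤ.* h ℤ.+ b)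
    regroup = solve-∀

  ·-⊠ : ∀ c F G → (c · F) ⊠ G ≗ c · (F ⊠ G)
  ·-⊠ c F G zero = regroup c (F 0) (G 0)
    where
    regroup : ∀ c f g → (c ℤ.* f) ℤ.* g ℤ.+ 0ℤ ≡ c ℤ.* (f ℤ.* g ℤ.+ 0ℤ)
    regroup = solve-∀
  ·-⊠ c F G (suc n) =
    trans (cong (ℤ._+_ ((c ℤ.* F 0) ℤ.* G (suc n))) (·-⊠ c (F ∘ suc) G n))
      (regroup c (F 0) (G (suc n)) (((F ∘ suc) ⊠ G) n))
    where
    regroup : ∀ c f g r → (c ℤ.* f) ℤ.* g ℤ.+ c ℤ.* r ≡ c ℤ.* (f ℤ.* g ℤ.+ r)
    regroup = solve-∀

  -- Convolution unfolds at the head of its left factor; commutativity also needs to take a term off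
  -- the other end.
  ⊠-last : ∀ F G n → (F ⊠ G) (suc n) ≡ (F ⊠ (G ∘ suc)) n ℤ.+ F (suc n) ℤ.* G 0
  ⊠-last F G zero = regroup (F 0) (G 1) (F 1) (G 0)
    where
    regroup : ∀ a b c d → a ℤ.* b ℤ.+ (c ℤ.* d ℤ.+ 0ℤ) ≡ (a ℤ.* b ℤ.+ 0ℤ) ℤ.+ c ℤ.* d
    regroup = solve-∀
  ⊠-last F G (suc n) =
    trans (cong (ℤ._+_ (F 0 ℤ.* G (suc (suc n)))) (⊠-last (F ∘ suc) G n))
      (sym (ℤ.+-assoc (F 0 ℤ.* G (suc (suc n))) (((F ∘ suc) ⊠ (G ∘ suc)) n) (F (suc (suc n)) ℤ.* G 0)))

  ⊠-comm : ∀ F G → F ⊠ G ≗ G ⊠ F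
  ⊠-comm F G zero = cong (ℤ._+ 0ℤ) (ℤ.*-comm (F 0) (G 0))
  ⊠-comm F G (suc n) =
    trans (cong₂ ℤ._+_ (ℤ.*-comm (F 0) (G (suc n))) (⊠-comm (F ∘ suc) G n))
      (trans (ℤ.+-comm (G (suc n) ℤ.* F 0) ((G ⊠ (F ∘ suc)) n)) (sym (⊠-last G F n)))

  ⊠-assoc : ∀ F G H → (F ⊠ G) ⊠ H ≗ F ⊠ (G ⊠ H)
  ⊠-assoc F G H zero = regroup (F 0) (G 0) (H 0)
    where
    regroup : ∀ f g h → (f ℤ.* g ℤ.+ 0ℤ) ℤ.* h ℤ.+ 0ℤ ≡ f ℤ.* (g ℤ.* h ℤ.+ 0ℤ) ℤ.+ 0ℤ
    regroup = solve-∀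
  ⊠-assoc F G H (suc n) = begin
    -- The shifted product `(F ⊠ G) ∘ suc` unfolds to `F 0 · (G ∘ suc) ⊞ (F ∘ suc) ⊠ G`, so
    -- distributivity and the induction hypothesis apply.
    (F ⊠ G) 0 ℤ.* H (suc n) ℤ.+ ((F 0 · (G ∘ suc) ⊞ (F ∘ suc) ⊠ G) ⊠ H) n
      ≡⟨ cong (ℤ._+_ ((F ⊠ G) 0 ℤ.* H (suc n)))
           (trans (⊠-distribʳ H (F 0 · (G ∘ suc)) ((F ∘ suc) ⊠ G) n)
                  (cong₂ ℤ._+_ (·-⊠ (F 0) (G ∘ suc) H n) (⊠-assoc (F ∘ suc) G H n))) ⟩
    (F ⊠ G) 0 ℤ.* H (suc n) ℤ.+ (F 0 ℤ.* ((G ∘ suc) ⊠ H) n ℤ.+ ((F ∘ suc) ⊠ (G ⊠ H)) n)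
      ≡⟨ regroup (F 0) (G 0) (H (suc n)) (((G ∘ suc) ⊠ H) n) (((F ∘ suc) ⊠ (G ⊠ H)) n) ⟩
    F 0 ℤ.* (G ⊠ H) (suc n) ℤ.+ ((F ∘ suc) ⊠ (G ⊠ H)) n ∎
    where
    open ≡-Reasoning
    regroup : ∀ f g h a b →
              (f ℤ.* g ℤ.+ 0ℤ) ℤ.* h ℤ.+ (f ℤ.* a ℤ.+ b) ≡ f ℤ.* (g ℤ.* h ℤ.+ a) ℤ.+ b
    regroup = solve-∀

  𝟘⊠ : ∀ G → (λ _ → 0ℤ) ⊠ G ≗ (λ _ → 0ℤ)
  𝟘⊠ G zero    = refl
  𝟘⊠ G (suc n) = trans (ℤ.+-identityˡ _) (𝟘⊠ G n)

  K-· : ∀ c F → K c ⊠ F ≗ c · F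
  K-· c F zero    = ℤ.+-identityʳ _
  K-· c F (suc n) = trans (cong (ℤ._+_ (c ℤ.* F (suc n))) (𝟘⊠ F n)) (ℤ.+-identityʳ _)

  one≗K : one ≗ K 1ℤ
  one≗K zero    = refl
  one≗K (suc n) = refl

  ⊠-identityˡ : ∀ F → one ⊠ F ≗ F
  ⊠-identityˡ F n = trans (⊠-≗-cong {one} {K 1ℤ} {F} one≗K (λ _ → refl) n)
                          (trans (K-· 1ℤ F n) (ℤ.*-identityˡ (F n)))

_⊟_ : PowerSeries → PowerSeries → PowerSeries
F ⊟ G = F ⊞ ⊝ G

𝟘 : PowerSeries
𝟘 _ = 0ℤ

infix 4 _≈_
-- A record instead of the function type `F ≗ G`, so that `F` and `G` can be inferred from an
-- equation.
record _≈_ (F G : PowerSeries) : Set where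
  constructor pw
  field at : F ≗ G
open _≈_ public

opaque
  unfolding _⊞_

  ⊞-at : ∀ F G n → (F ⊞ G) n ≡ F n ℤ.+ G n
  ⊞-at F G n = refl

  ⊝-at : ∀ F n → (⊝ F) n ≡ ℤ.- F n
  ⊝-at F n = refl

  ⊠-at : ∀ F G → F ⊠ G ≈ F ⊛ G
  ⊠-at F G = pw λ n → refl

  K-⊠ : ∀ c F n → (K c ⊠ F) n ≡ c ℤ.* F n
  K-⊠ = K-·

  isCommutativeRing : IsCommutativeRing _≈_ _⊞_ _⊠_ ⊝_ 𝟘 one
  isCommutativeRing = record
    { isRing = record
      { +-isAbelianGroup = record
        { isGroup = record
          { isMonoid = record
            { isSemigroup = record
              { isMagma = record
                { isEquivalence = record
                  { refl = pw λ _ → refl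
                  ; sym = λ p → pw λ n → sym (at p n)
                  ; trans = λ p q → pw λ n → trans (at p n) (at q n) }
                ; ∙-cong = λ p q → pw λ n → cong₂ ℤ._+_ (at p n) (at q n) }
              ; assoc = λ F G H → pw λ n → ℤ.+-assoc (F n) (G n) (H n) }
            ; identity = (λ F → pw λ n → ℤ.+-identityˡ (F n))
                       , (λ F → pw λ n → ℤ.+-identityʳ (F n)) }
          ; inverse = (λ F → pw λ n → ℤ.+-inverseˡ (F n))
                    , (λ F → pw λ n → ℤ.+-inverseʳ (F n))
          ; ⁻¹-cong = λ p → pw λ n → cong ℤ.-_ (at p n) }
        ; comm = λ F G → pw λ n → ℤ.+-comm (F n) (G n) }
      ; *-cong = λ {F} {F′} {G} {G′} p q → pw (⊠-≗-cong {F} {F′} {G} {G′} (at p) (at q))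
      ; *-assoc = λ F G H → pw (⊠-assoc F G H)
      ; *-identity = (λ F → pw (⊠-identityˡ F))
                   , λ F → pw λ n → trans (⊠-comm F one n) (⊠-identityˡ F n)
      ; distrib = (λ F G H → pw λ n → trans (⊠-comm F (G ⊞ H) n) (trans (⊠-distribʳ F G H n)
                     (cong₂ ℤ._+_ (⊠-comm G F n) (⊠-comm H F n))))
                , λ F G H → pw (⊠-distribʳ F G H) }
    ; *-comm = λ F G → pw (⊠-comm F G) }

  K-* : ∀ c d → K (c ℤ.* d) ≈ K c ⊠ K d
  K-* c d = pw λ { zero → sym (ℤ.+-identityʳ _) ; (suc n) → sym (trans (K-· c (K d) (suc n)) (ℤ.*-zeroʳ c)) }

  K-+ : ∀ c d → K (c ℤ.+ d) ≈ K c ⊞ K d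
  K-+ c d = pw λ { zero → refl ; (suc n) → refl }

  K-neg : ∀ c → K (ℤ.- c) ≈ ⊝ K c
  K-neg c = pw λ { zero → refl ; (suc n) → refl }

seriesRing : CommutativeRing 0ℓ 0ℓ
seriesRing = record { isCommutativeRing = isCommutativeRing }

module R = CommutativeRing seriesRing

K-homomorphism : ℤ.+-*-rawRing -Raw-AlmostCommutative⟶ fromCommutativeRing seriesRing
K-homomorphism = record
  { ⟦_⟧ = K ; +-homo = K-+ ; *-homo = K-* ; -‿homo = K-neg
  ; 0-homo = pw λ { zero → refl ; (suc n) → refl }
  ; 1-homo = pw λ { zero → refl ; (suc n) → refl } }

K-≟ : (c d : ℤ) → Maybe (K c ≈ K d)
K-≟ c d with c ℤ.≟ d
... | yes c≡d = just (pw λ n → cong (λ x → K x n) c≡d)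
... | no  _   = nothing

-- Integer constants enter the solver as constant series `K c`. The series `one` is a different term
-- and is handed over as a variable.
module S = Algebra.Solver.Ring ℤ.+-*-rawRing (fromCommutativeRing seriesRing) K-homomorphism K-≟
open S using (_:+_; _:*_; _:-_; :-_; con; _:=_)

# : ∀ {k} → ℕ → S.Polynomial k
# n = con (+ n)

module ≈-Reasoning = Relation.Binary.Reasoning.Setoid R.setoid

⊞-congˡ : ∀ {F G H} → F ≈ G → H ⊞ F ≈ H ⊞ G
⊞-congˡ = R.+-cong R.refl

⊞-congʳ : ∀ {F G H} → F ≈ G → F ⊞ H ≈ G ⊞ H
⊞-congʳ p = R.+-cong p R.refl

⊠-congˡ : ∀ {F G H} → F ≈ G → H ⊠ F ≈ H ⊠ G
⊠-congˡ = R.*-cong R.refl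

⊠-congʳ : ∀ {F G H} → F ≈ G → F ⊠ H ≈ G ⊠ H
⊠-congʳ p = R.*-cong p R.refl

-- Order of vanishing at q = 0

Ord : ℕ → PowerSeries → Set
Ord k F = ∀ n → n < k → F n ≡ 0ℤ

-- The slack in the bound admits families whose i-th member has order i - 1.
Bounded : (ℕ → PowerSeries) → Set
Bounded F = ∀ i → Ord (pred i) (F i)

opaque
  unfolding _⊞_

  Ord-≤ : ∀ {k l F} → k ≤ l → Ord l F → Ord k F
  Ord-≤ k≤l o n n<k = o n (ℕ.≤-trans n<k k≤l)

  Ord-≈ : ∀ {k F G} → F ≈ G → Ord k F → Ord k G
  Ord-≈ F≈G o n n<k = trans (sym (at F≈G n)) (o n n<k)

  Ord-0 : ∀ {F} → Ord 0 F
  Ord-0 _ ()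

  Ord-⊞ : ∀ {k F G} → Ord k F → Ord k G → Ord k (F ⊞ G)
  Ord-⊞ oF oG n n<k = cong₂ ℤ._+_ (oF n n<k) (oG n n<k)

  Ord-⊝ : ∀ {k F} → Ord k F → Ord k (⊝ F)
  Ord-⊝ oF n n<k = cong ℤ.-_ (oF n n<k)

  Ord-⊠ʳ : ∀ {k} F {G} → Ord k G → Ord k (F ⊠ G)
  Ord-⊠ʳ {k} F {G} oG n n<k =
    trans (⊠-local {F} {F} {G} {𝟘} n (λ _ _ → refl) (λ i i≤n → oG i (ℕ.≤-<-trans i≤n n<k)))
          (at (R.zeroʳ F) n)

  Ord-⊠ : ∀ {k l F G} → Ord k F → Ord l G → Ord (k + l) (F ⊠ G)
  Ord-⊠ {zero}  {l} {F} oF oG = Ord-⊠ʳ F oG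
  Ord-⊠ {suc k} {l} {F} {G} oF oG zero    _         =
    cong (λ x → x ℤ.* G 0 ℤ.+ 0ℤ) (oF 0 (s≤s z≤n))
  Ord-⊠ {suc k} {l} {F} {G} oF oG (suc n) (s≤s n<k) =
    cong₂ ℤ._+_ (cong (ℤ._* G (suc n)) (oF 0 (s≤s z≤n)))
      (Ord-⊠ {k} {l} {F ∘ suc} {G} (λ m m<k → oF (suc m) (s≤s m<k)) oG n n<k)

  q^-eq : ∀ k → (q^ k) k ≡ 1ℤ
  q^-eq k rewrite dec-true (k ℕ.≟ k) refl = refl

  q^-≢ : ∀ {k n} → n ≢ k → (q^ k) n ≡ 0ℤ
  q^-≢ {k} {n} n≢k rewrite dec-false (n ℕ.≟ k) n≢k = refl

  Ord-q^ : ∀ {k e} → k ≤ e → Ord k (q^ e)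
  Ord-q^ k≤e n n<k = q^-≢ (ℕ.<⇒≢ (ℕ.<-≤-trans n<k k≤e))

  q^-shift : ∀ a F n → (q^ a ⊠ F) (a + n) ≡ F n
  q^-shift zero    F n = at (R.*-identityˡ F) n
  q^-shift (suc a) F n = trans (ℤ.+-identityˡ _) (q^-shift a F n)

  q^-+ : ∀ a b → q^ a ⊠ q^ b ≈ q^ (a + b)
  q^-+ zero    b = R.*-identityˡ (q^ b)
  q^-+ (suc a) b = pw λ { zero → refl ; (suc n) → trans (ℤ.+-identityˡ _) (at (q^-+ a b) n) }

  q^-≡ : ∀ {a b} → a ≡ b → q^ a ≈ q^ b
  q^-≡ refl = R.refl

  K-≡ : ∀ {a b} → a ≡ b → K a ≈ K b
  K-≡ refl = R.refl

  K-cancel : ∀ c .{{_ : ℤ.NonZero c}} {F G} → K c ⊠ F ≈ K c ⊠ G → F ≈ G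
  K-cancel c {F} {G} p = pw λ n →
    ℤ.*-cancelˡ-≡ c (F n) (G n) (trans (sym (K-⊠ c F n)) (trans (at p n) (K-⊠ c G n)))

  -- Finite and infinite sums of series

  Σ< : ℕ → (ℕ → PowerSeries) → PowerSeries
  Σ< zero    F = 𝟘
  Σ< (suc n) F = Σ< n F ⊞ F n

  Σ<-≡ : ∀ {M N} F → M ≡ N → Σ< M F ≈ Σ< N F
  Σ<-≡ F refl = R.refl

  Σ<-cong : ∀ M {F G} → (∀ i → i < M → F i ≈ G i) → Σ< M F ≈ Σ< M G
  Σ<-cong zero    F≈G = R.refl
  Σ<-cong (suc M) F≈G =
    R.+-cong (Σ<-cong M (λ i i<M → F≈G i (ℕ.m<n⇒m<1+n i<M))) (F≈G M ℕ.≤-refl)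

  Σ<-local : ∀ n M (F G : ℕ → PowerSeries) → (∀ i → F i n ≡ G i n) → Σ< M F n ≡ Σ< M G n
  Σ<-local n zero    F G p = refl
  Σ<-local n (suc M) F G p = cong₂ ℤ._+_ (Σ<-local n M F G p) (p M)

  Σ<-⊞ : ∀ M F G → Σ< M (λ i → F i ⊞ G i) ≈ Σ< M F ⊞ Σ< M G
  Σ<-⊞ zero    F G = R.sym (R.+-identityˡ 𝟘)
  Σ<-⊞ (suc M) F G = R.trans (⊞-congʳ (Σ<-⊞ M F G))
    (S.solve 4 (λ a b c d → (a :+ b) :+ (c :+ d) := (a :+ c) :+ (b :+ d)) R.refl
       (Σ< M F) (Σ< M G) (F M) (G M))

  Σ<-⊠ : ∀ M H F → H ⊠ Σ< M F ≈ Σ< M (λ i → H ⊠ F i)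
  Σ<-⊠ zero    H F = R.zeroʳ H
  Σ<-⊠ (suc M) H F =
    R.trans (R.distribˡ H (Σ< M F) (F M)) (⊞-congʳ (Σ<-⊠ M H F))

  Σ<-𝟘 : ∀ M → Σ< M (λ _ → 𝟘) ≈ 𝟘
  Σ<-𝟘 zero    = R.refl
  Σ<-𝟘 (suc M) = R.trans (⊞-congʳ (Σ<-𝟘 M)) (R.+-identityˡ 𝟘)

  Σ<-swap : ∀ M N (F : ℕ → ℕ → PowerSeries) →
            Σ< M (λ i → Σ< N (F i)) ≈ Σ< N (λ j → Σ< M (λ i → F i j))
  Σ<-swap zero    N F = R.sym (Σ<-𝟘 N)
  Σ<-swap (suc M) N F =
    R.trans (⊞-congʳ (Σ<-swap M N F)) (R.sym (Σ<-⊞ N (λ j → Σ< M (λ i → F i j)) (F M)))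

  Σ<-+ : ∀ M k F → Σ< (M + k) F ≈ Σ< M F ⊞ Σ< k (λ i → F (M + i))
  Σ<-+ M zero F =
    R.trans (Σ<-≡ F (ℕ.+-identityʳ M)) (R.sym (R.+-identityʳ (Σ< M F)))
  Σ<-+ M (suc k) F =
    R.trans (Σ<-≡ F (ℕ.+-suc M k))
      (R.trans (⊞-congʳ (Σ<-+ M k F)) (R.+-assoc (Σ< M F) (Σ< k (λ i → F (M + i))) (F (M + k))))

  Σ<-suc : ∀ M F → Σ< (suc M) F ≈ F 0 ⊞ Σ< M (F ∘ suc)
  Σ<-suc M F = R.trans (Σ<-+ 1 M F) (⊞-congʳ (R.+-identityˡ (F 0)))

  Σ<-reverse : ∀ M F → Σ< M F ≈ Σ< M (λ i → F (M ∸ suc i))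
  Σ<-reverse zero    F = R.refl
  Σ<-reverse (suc M) F =
    R.trans (R.+-comm (Σ< M F) (F M))
      (R.trans (⊞-congˡ {H = F M} (Σ<-reverse M F)) (R.sym (Σ<-suc M (λ i → F (M ∸ i)))))

  Σ<-blocks : ∀ c M F → Σ< (c * M) F ≈ Σ< M (λ k → Σ< c (λ j → F (c * k + j)))
  Σ<-blocks c zero    F = Σ<-≡ F (ℕ.*-zeroʳ c)
  Σ<-blocks c (suc M) F =
    R.trans (Σ<-≡ F (trans (ℕ.*-suc c M) (ℕ.+-comm c (c * M))))
      (R.trans (Σ<-+ (c * M) c F) (⊞-congʳ (Σ<-blocks c M F)))

  -- In a `Bounded` family the terms of index n + 2 and above have no coefficient at q^n, so the cut
  -- at `2 + n` loses nothing.
  Σ∞ : (ℕ → PowerSeries) → PowerSeries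
  Σ∞ F n = Σ< (2 + n) F n

  Σ<-stable : ∀ {F} → Bounded F → ∀ k n → Σ< (k + (2 + n)) F n ≡ Σ∞ F n
  Σ<-stable bd zero    n = refl
  Σ<-stable {F} bd (suc k) n =
    trans (cong₂ ℤ._+_ (Σ<-stable bd k n)
            (bd (k + (2 + n)) n (subst (λ m → n < pred m) (sym (ℕ.+-suc k (suc n))) (ℕ.m≤n+m (suc n) k))))
          (ℤ.+-identityʳ _)

  Σ<-zero : ∀ F → Σ< 0 F ≈ 𝟘
  Σ<-zero F = R.refl

  Σ<-last : ∀ M F → Σ< (suc M) F ≈ Σ< M F ⊞ F M
  Σ<-last M F = R.refl

  Σ∞-at : ∀ F n → Σ∞ F n ≡ Σ< (2 + n) F n
  Σ∞-at F n = refl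

  Σ∞-stable : ∀ {F} → Bounded F → ∀ {M} n → 2 + n ≤ M → Σ< M F n ≡ Σ∞ F n
  Σ∞-stable {F} bd {M} n le =
    trans (cong (λ N → Σ< N F n) (sym (ℕ.m∸n+n≡m le))) (Σ<-stable bd (M ∸ (2 + n)) n)

  Σ∞-cong : ∀ {F G} → (∀ i → F i ≈ G i) → Σ∞ F ≈ Σ∞ G
  Σ∞-cong F≈G = pw λ n → at (Σ<-cong (2 + n) (λ i _ → F≈G i)) n

  Σ∞-⊞ : ∀ F G → Σ∞ (λ i → F i ⊞ G i) ≈ Σ∞ F ⊞ Σ∞ G
  Σ∞-⊞ F G = pw λ n → at (Σ<-⊞ (2 + n) F G) n

  Σ∞-K : ∀ c F → Σ∞ (λ i → K c ⊠ F i) ≈ K c ⊠ Σ∞ F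
  Σ∞-K c F = pw λ n → trans (sym (at (Σ<-⊠ (2 + n) (K c) F) n))
    (trans (K-⊠ c (Σ< (2 + n) F) n) (sym (K-⊠ c (Σ∞ F) n)))

  Σ∞-⊝ : ∀ F → Σ∞ (λ i → ⊝ F i) ≈ ⊝ Σ∞ F
  Σ∞-⊝ F = R.trans (Σ∞-cong (λ i → neg (F i))) (R.trans (Σ∞-K (ℤ.- 1ℤ) F) (R.sym (neg (Σ∞ F))))
    where
    neg : ∀ G → ⊝ G ≈ K (ℤ.- 1ℤ) ⊠ G
    neg G = S.solve 1 (λ G → :- G := con (ℤ.- 1ℤ) :* G) R.refl G

  Σ∞-⊠ : ∀ H {F} → Bounded F → H ⊠ Σ∞ F ≈ Σ∞ (λ i → H ⊠ F i)
  Σ∞-⊠ H {F} bd = pw λ n →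
    trans (⊠-local {H} {H} {Σ∞ F} {Σ< (2 + n) F} n (λ _ _ → refl)
            (λ i i≤n → sym (Σ∞-stable bd i (s≤s (s≤s i≤n)))))
          (at (Σ<-⊠ (2 + n) H F) n)

  -- At q^n both indices are cut at `2 + n` on either side, so this is an interchange over one
  -- finite square.
  Σ∞-swap : ∀ (F : ℕ → ℕ → PowerSeries) → Σ∞ (λ i → Σ∞ (F i)) ≈ Σ∞ (λ j → Σ∞ (λ i → F i j))
  Σ∞-swap F = pw λ n →
    trans (Σ<-local n (2 + n) (λ i → Σ∞ (F i)) (λ i → Σ< (2 + n) (F i)) (λ _ → refl))
      (trans (at (Σ<-swap (2 + n) (2 + n) F) n)
        (sym (Σ<-local n (2 + n) (λ j → Σ∞ (λ i → F i j)) (λ j → Σ< (2 + n) (λ i → F i j))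
                (λ _ → refl))))

  Σ∞-drop : ∀ k {F} → Bounded F → Σ∞ F ≈ Σ< k F ⊞ Σ∞ (λ i → F (k + i))
  Σ∞-drop k {F} bd = pw λ n →
    trans (sym (Σ<-stable bd k n)) (at (Σ<-+ k (2 + n) F) n)

  Σ∞-suc : ∀ {F} → Bounded F → Σ∞ F ≈ F 0 ⊞ Σ∞ (F ∘ suc)
  Σ∞-suc {F} bd = R.trans (Σ∞-drop 1 bd) (⊞-congʳ (R.+-identityˡ (F 0)))

  Σ∞-blocks : ∀ c .{{_ : NonZero c}} {F} → Bounded F →
              Σ∞ F ≈ Σ∞ (λ k → Σ< c (λ j → F (c * k + j)))
  Σ∞-blocks c {F} bd = pw λ n →
    trans (sym (Σ∞-stable bd n (ℕ.m≤n*m (2 + n) c))) (at (Σ<-blocks c (2 + n) F) n)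

  Ord-Σ∞ : ∀ {k F} → (∀ i → Ord k (F i)) → Ord k (Σ∞ F)
  Ord-Σ∞ {k} {F} o n n<k = go (2 + n)
    where
    go : ∀ M → Σ< M F n ≡ 0ℤ
    go zero    = refl
    go (suc M) = cong₂ ℤ._+_ (go M) (o M n n<k)

  -- Reduces statements that are linear in a series to monomials.
  expand : ∀ F → F ≈ Σ∞ (λ i → K (F i) ⊠ q^ i)
  expand F = pw λ n → sym (begin
    (Σ< n term n ℤ.+ term n n) ℤ.+ term (suc n) n
      ≡⟨ cong₂ (λ x y → (x ℤ.+ y) ℤ.+ term (suc n) n) (below n n ℕ.≤-refl) (diagonal n) ⟩
    (0ℤ ℤ.+ F n) ℤ.+ term (suc n) n
      ≡⟨ cong₂ ℤ._+_ (ℤ.+-identityˡ (F n)) (Ord-⊠ʳ (K (F (suc n))) (Ord-q^ {suc n} ℕ.≤-refl) n ℕ.≤-refl) ⟩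
    F n ℤ.+ 0ℤ
      ≡⟨ ℤ.+-identityʳ (F n) ⟩
    F n ∎)
    where
    open ≡-Reasoning
    term : ℕ → PowerSeries
    term i = K (F i) ⊠ q^ i
    diagonal : ∀ n → term n n ≡ F n
    diagonal n = trans (K-⊠ (F n) (q^ n) n) (trans (cong (F n ℤ.*_) (q^-eq n)) (ℤ.*-identityʳ (F n)))
    below : ∀ n M → M ≤ n → Σ< M term n ≡ 0ℤ
    below n zero    _   = refl
    below n (suc M) M<n = cong₂ ℤ._+_ (below n M (ℕ.<⇒≤ M<n))
      (trans (K-⊠ (F M) (q^ M) n)
        (trans (cong (F M ℤ.*_) (q^-≢ (≢-sym (ℕ.<⇒≢ M<n)))) (ℤ.*-zeroʳ (F M))))

-- The derivation q d/dq

opaque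
  unfolding _⊞_ Σ∞

  D : PowerSeries → PowerSeries
  D F n = + n ℤ.* F n

  D-at : ∀ F n → D F n ≡ + n ℤ.* F n
  D-at F n = refl

  D-cong : ∀ {F G} → F ≈ G → D F ≈ D G
  D-cong p = pw λ n → cong (+ n ℤ.*_) (at p n)

  D-⊞ : ∀ F G → D (F ⊞ G) ≈ D F ⊞ D G
  D-⊞ F G = pw λ n → ℤ.*-distribˡ-+ (+ n) (F n) (G n)

  D-⊝ : ∀ F → D (⊝ F) ≈ ⊝ D F
  D-⊝ F = pw λ n → sym (ℤ.neg-distribʳ-* (+ n) (F n))

  D-K : ∀ c → D (K c) ≈ 𝟘
  D-K c = pw λ { zero → refl ; (suc n) → ℤ.*-zeroʳ (+ suc n) }

  D-q^ : ∀ e → D (q^ e) ≈ K (+ e) ⊠ q^ e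
  D-q^ e = pw go
    where
    go : ∀ n → D (q^ e) n ≡ (K (+ e) ⊠ q^ e) n
    go n with n ℕ.≟ e
    ... | yes refl = sym (K-⊠ (+ e) (q^ e) e)
    ... | no  n≢e  = trans (trans (cong (+ n ℤ.*_) (q^-≢ n≢e)) (ℤ.*-zeroʳ (+ n)))
      (sym (trans (K-⊠ (+ e) (q^ e) n) (trans (cong (+ e ℤ.*_) (q^-≢ n≢e)) (ℤ.*-zeroʳ (+ e)))))

  D-⊠-≗ : ∀ F G → D (F ⊠ G) ≗ D F ⊠ G ⊞ F ⊠ D G
  D-⊠-≗ F G zero = regroup (F 0) (G 0)
    where
    regroup : ∀ f g → 0ℤ ℤ.* (f ℤ.* g ℤ.+ 0ℤ) ≡ (0ℤ ℤ.* f ℤ.* g ℤ.+ 0ℤ) ℤ.+ (f ℤ.* (0ℤ ℤ.* g) ℤ.+ 0ℤ)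
    regroup = solve-∀
  D-⊠-≗ F G (suc n) = begin
    + suc n ℤ.* (F 0 ℤ.* G (suc n) ℤ.+ (F′ ⊠ G) n)
      ≡⟨ split (+ n) (F 0) (G (suc n)) ((F′ ⊠ G) n) ⟩
    (F 0 ℤ.* (+ suc n ℤ.* G (suc n)) ℤ.+ (F′ ⊠ G) n) ℤ.+ D (F′ ⊠ G) n
      ≡⟨ cong (ℤ._+_ (F 0 ℤ.* (+ suc n ℤ.* G (suc n)) ℤ.+ (F′ ⊠ G) n)) (D-⊠-≗ F′ G n) ⟩
    (F 0 ℤ.* (+ suc n ℤ.* G (suc n)) ℤ.+ (F′ ⊠ G) n) ℤ.+ ((D F′ ⊠ G) n ℤ.+ (F′ ⊠ D G) n)
      ≡⟨ regroup (F 0) (+ suc n ℤ.* G (suc n)) ((F′ ⊠ G) n) ((D F′ ⊠ G) n) ((F′ ⊠ D G) n) (G (suc n)) ⟩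
    (D F 0 ℤ.* G (suc n) ℤ.+ ((F′ ⊠ G) n ℤ.+ (D F′ ⊠ G) n)) ℤ.+
      (F 0 ℤ.* (+ suc n ℤ.* G (suc n)) ℤ.+ (F′ ⊠ D G) n)
      ≡⟨ cong (λ x → (D F 0 ℤ.* G (suc n) ℤ.+ x) ℤ.+ (F ⊠ D G) (suc n))
           (trans (sym (⊠-distribʳ G F′ (D F′) n))
                  (⊠-≗-cong {F′ ⊞ D F′} {D F ∘ suc} {G} (λ m → D-suc (+ m) (F′ m)) (λ _ → refl) n)) ⟩
    (D F ⊠ G) (suc n) ℤ.+ (F ⊠ D G) (suc n) ∎
    where
    open ≡-Reasoning
    F′ : PowerSeries
    F′ = F ∘ suc
    D-suc : ∀ m x → x ℤ.+ m ℤ.* x ≡ (1ℤ ℤ.+ m) ℤ.* x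
    D-suc = solve-∀
    split : ∀ n f g r → (1ℤ ℤ.+ n) ℤ.* (f ℤ.* g ℤ.+ r) ≡ (f ℤ.* ((1ℤ ℤ.+ n) ℤ.* g) ℤ.+ r) ℤ.+ n ℤ.* r
    split = solve-∀
    regroup : ∀ f g a b c h → (f ℤ.* g ℤ.+ a) ℤ.+ (b ℤ.+ c) ≡ (0ℤ ℤ.* f ℤ.* h ℤ.+ (a ℤ.+ b)) ℤ.+ (f ℤ.* g ℤ.+ c)
    regroup = solve-∀

  D-⊠ : ∀ F G → D (F ⊠ G) ≈ D F ⊠ G ⊞ F ⊠ D G
  D-⊠ F G = pw (D-⊠-≗ F G)

  D-Σ< : ∀ M F → D (Σ< M F) ≈ Σ< M (D ∘ F)
  D-Σ< zero    F = pw λ n → ℤ.*-zeroʳ (+ n)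
  D-Σ< (suc M) F = R.trans (D-⊞ (Σ< M F) (F M)) (⊞-congʳ (D-Σ< M F))

  D-Σ∞ : ∀ F → D (Σ∞ F) ≈ Σ∞ (D ∘ F)
  D-Σ∞ F = pw λ n → at (D-Σ< (2 + n) F) n

  D-K⊠ : ∀ c F → D (K c ⊠ F) ≈ K c ⊠ D F
  D-K⊠ c F = R.trans (D-⊠ (K c) F)
    (R.trans (⊞-congʳ (R.trans (⊠-congʳ {H = F} (D-K c)) (R.zeroˡ F))) (R.+-identityˡ (K c ⊠ D F)))

fUpTo-⊠ : ∀ k N → fUpTo k (suc N) ≈ (one ⊟ q^ (k * suc N)) ⊠ fUpTo k N
fUpTo-⊠ k N = R.trans
  (pw (⊛-cong-≗ (λ n → sym (trans (⊞-at one (⊝ q^ (k * suc N)) n) (cong (ℤ._+_ (one n)) (⊝-at (q^ (k * suc N)) n))))))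
  (R.sym (⊠-at (one ⊟ q^ (k * suc N)) (fUpTo k N)))
  where
  ⊛-cong-≗ : ∀ {F G H} → F ≗ G → F ⊛ H ≗ G ⊛ H
  ⊛-cong-≗ {F} {G} {H} p n = trans (sym (at (⊠-at F H) n)) (trans (at (⊠-congʳ {F} {G} {H} (pw p)) n) (at (⊠-at G H) n))

-- Jacobi's triple product series and its logarithmic derivative in z

sgn : ℕ → ℤ
sgn zero    = 1ℤ
sgn (suc n) = ℤ.- sgn n

tri : ℕ → ℕ
tri zero    = 0
tri (suc n) = n + tri n

-- τ n is the n-th term (-1)ⁿ q^(n(n-1)/2) of Jacobi's triple product series, and τ⁻ s m is
-- its (s - m)-th term; the reflection n ↦ 1 - n, which changes the sign, extends τ to ℤ.
τ : ℕ → PowerSeries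
τ n = K (sgn n) ⊠ q^ tri n

τ⁻ : ℕ → ℕ → PowerSeries
τ⁻ s       zero    = τ s
τ⁻ zero    (suc m) = ⊝ τ (2 + m)
τ⁻ (suc s) (suc m) = τ⁻ s m

τ-suc : ∀ n → τ (suc n) ≈ ⊝ (q^ n ⊠ τ n)
τ-suc n = begin
  K (ℤ.- sgn n) ⊠ q^ (n + tri n)         ≈⟨ R.*-cong (K-neg (sgn n)) (R.sym (q^-+ n (tri n))) ⟩
  ⊝ K (sgn n) ⊠ (q^ n ⊠ q^ tri n)
    ≈⟨ S.solve 3 (λ k x y → (:- k) :* (x :* y) := :- (x :* (k :* y))) R.refl (K (sgn n)) (q^ n) (q^ tri n) ⟩
  ⊝ (q^ n ⊠ (K (sgn n) ⊠ q^ tri n))      ∎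
  where open ≈-Reasoning

Ord-τ : ∀ n → Ord (pred n) (τ n)
Ord-τ zero    = Ord-0
Ord-τ (suc n) = Ord-⊠ʳ (K (sgn (suc n))) (Ord-q^ (ℕ.m≤m+n n (tri n)))

τ⁻-zeroˡ : ∀ m → τ⁻ 0 m ≈ ⊝ τ (suc m)
τ⁻-zeroˡ zero    = S.solve 1 (λ x → # 1 :* x := :- (con (ℤ.- 1ℤ) :* x)) R.refl (q^ 0)
τ⁻-zeroˡ (suc m) = R.refl

-- The rule τₙ₊₁ = - qⁿ τₙ at n = s - m, multiplied by q^m to keep all exponents nonnegative.
τ⁻-suc : ∀ s m → q^ m ⊠ τ⁻ (suc s) m ≈ ⊝ (q^ s ⊠ τ⁻ s m)
τ⁻-suc s zero = R.trans (R.*-identityˡ (τ (suc s))) (τ-suc s)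
τ⁻-suc zero (suc m) = begin
  q^ suc m ⊠ τ⁻ 0 m               ≈⟨ ⊠-congˡ (τ⁻-zeroˡ m) ⟩
  q^ suc m ⊠ ⊝ τ (suc m)
    ≈⟨ S.solve 2 (λ x y → x :* (:- y) := :- (# 1 :* (x :* y))) R.refl (q^ suc m) (τ (suc m)) ⟩
  ⊝ (K 1ℤ ⊠ (q^ suc m ⊠ τ (suc m)))
    ≈⟨ S.solve 1 (λ x → :- (# 1 :* x) := :- x) R.refl (q^ suc m ⊠ τ (suc m)) ⟩
  ⊝ (q^ suc m ⊠ τ (suc m))        ≈⟨ R.sym (τ-suc (suc m)) ⟩
  τ (2 + m)
    ≈⟨ S.solve 1 (λ x → x := :- (:- x)) R.refl (τ (2 + m)) ⟩
  ⊝ ⊝ τ (2 + m)                   ≈⟨ R.-‿cong (R.sym (R.*-identityˡ (⊝ τ (2 + m)))) ⟩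
  ⊝ (q^ 0 ⊠ ⊝ τ (2 + m))          ∎
  where open ≈-Reasoning
τ⁻-suc (suc s) (suc m) = begin
  q^ suc m ⊠ τ⁻ (suc s) m         ≈⟨ ⊠-congʳ (R.sym (q^-+ 1 m)) ⟩
  (q^ 1 ⊠ q^ m) ⊠ τ⁻ (suc s) m    ≈⟨ R.*-assoc (q^ 1) (q^ m) (τ⁻ (suc s) m) ⟩
  q^ 1 ⊠ (q^ m ⊠ τ⁻ (suc s) m)    ≈⟨ ⊠-congˡ (τ⁻-suc s m) ⟩
  q^ 1 ⊠ ⊝ (q^ s ⊠ τ⁻ s m)
    ≈⟨ S.solve 3 (λ x y z → x :* (:- (y :* z)) := :- ((x :* y) :* z)) R.refl (q^ 1) (q^ s) (τ⁻ s m) ⟩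
  ⊝ ((q^ 1 ⊠ q^ s) ⊠ τ⁻ s m)      ≈⟨ R.-‿cong (⊠-congʳ (q^-+ 1 s)) ⟩
  ⊝ (q^ suc s ⊠ τ⁻ s m)           ∎
  where open ≈-Reasoning

τ⁻-cancel : ∀ s m → τ⁻ (m + s) m ≈ τ s
τ⁻-cancel s zero    = R.refl
τ⁻-cancel s (suc m) = τ⁻-cancel s m

τ⁻-reflect : ∀ i k → i < k → τ⁻ (suc i) k ≈ ⊝ τ (k ∸ i)
τ⁻-reflect zero    (suc k) _         = τ⁻-zeroˡ k
τ⁻-reflect (suc i) (suc k) (s≤s i<k) = τ⁻-reflect i k i<k

Ord-τ⁻ : ∀ i k → Ord (i ∸ k) (τ⁻ (suc i) k)
Ord-τ⁻ i       zero    = Ord-τ (suc i)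
Ord-τ⁻ zero    (suc k) = Ord-0
Ord-τ⁻ (suc i) (suc k) = Ord-τ⁻ i k

-- `τ⁻ (suc i) k` is only known to vanish to order i - k; the factor `H` supplies the missing k - 1.
Ord-τ⁻-⊠ : ∀ {k H} → Ord (pred k) H → ∀ i → Ord (pred i) (H ⊠ τ⁻ (suc i) k)
Ord-τ⁻-⊠ {zero}  {H} o i = Ord-⊠ʳ H (Ord-≤ ℕ.pred[n]≤n (Ord-τ⁻ i 0))
Ord-τ⁻-⊠ {suc k} {H} o zero = Ord-0
Ord-τ⁻-⊠ {suc k} {H} o (suc i) = Ord-≤ (ℕ.m≤n+m∸n i k) (Ord-⊠ o (Ord-τ⁻ i k))

-- Summation by parts: shifting the index of τ against a weight g.
reflection : ∀ k {H} → Ord (pred k) H → (ε : ℤ) (g : ℤ → ℤ) → (∀ z → g (1ℤ ℤ.- z) ≡ ε ℤ.* g z) →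
  Σ∞ (λ i → K (g (+ suc i)) ⊠ (H ⊠ (τ⁻ (suc i) k ⊟ K ε ⊠ τ (k + suc i)))) ≈
  Σ∞ (λ i → H ⊠ (K (g (+ suc i ℤ.+ + k) ℤ.- ε ℤ.* g (+ suc i ℤ.- + k)) ⊠ τ (suc i)))
reflection k {H} oH ε g g-sym = begin
  Σ∞ (λ i → K (g (+ suc i)) ⊠ (H ⊠ (τ⁻ (suc i) k ⊟ K ε ⊠ τ (k + suc i))))
    ≈⟨ Σ∞-cong (λ i → S.solve 5 (λ c h a e b → c :* (h :* (a :- e :* b)) := c :* (h :* a) :- e :* (c :* (h :* b)))
         R.refl (K (g (+ suc i))) H (τ⁻ (suc i) k) (K ε) (τ (k + suc i))) ⟩
  Σ∞ (λ i → A i ⊟ K ε ⊠ B i)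
    ≈⟨ R.trans (Σ∞-⊞ A (λ i → ⊝ (K ε ⊠ B i))) (⊞-congˡ (R.trans (Σ∞-⊝ (λ i → K ε ⊠ B i)) (R.-‿cong (Σ∞-K ε B)))) ⟩
  Σ∞ A ⊟ K ε ⊠ Σ∞ B
    -- The first k terms of `A` carry indices at most 0. Reflected by n ↦ 1 - n, they become the
    -- first k terms of `E`, exactly those that `B` lacks.
    ≈⟨ ⊞-congʳ (R.trans (Σ∞-drop k bdA) (R.+-cong boundary (Σ∞-cong shiftA))) ⟩
  ⊝ (K ε ⊠ Σ< k E) ⊞ Σ∞ C ⊟ K ε ⊠ Σ∞ B
    ≈⟨ S.solve 4 (λ e s c b → :- (e :* s) :+ c :- e :* b := c :- e :* (s :+ b)) R.refl (K ε) (Σ< k E) (Σ∞ C) (Σ∞ B) ⟩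
  Σ∞ C ⊟ K ε ⊠ (Σ< k E ⊞ Σ∞ B)
    ≈⟨ ⊞-congˡ (R.-‿cong (⊠-congˡ (R.sym (R.trans (Σ∞-drop k bdE) (⊞-congˡ (Σ∞-cong shiftE)))))) ⟩
  Σ∞ C ⊟ K ε ⊠ Σ∞ E
    ≈⟨ R.sym (R.trans (Σ∞-⊞ C (λ i → ⊝ (K ε ⊠ E i))) (⊞-congˡ (R.trans (Σ∞-⊝ (λ i → K ε ⊠ E i)) (R.-‿cong (Σ∞-K ε E))))) ⟩
  Σ∞ (λ i → C i ⊟ K ε ⊠ E i)
    ≈⟨ Σ∞-cong (λ i → combine (g (+ suc i ℤ.+ + k)) (g (+ suc i ℤ.- + k)) (τ (suc i))) ⟩
  Σ∞ (λ i → H ⊠ (K (g (+ suc i ℤ.+ + k) ℤ.- ε ℤ.* g (+ suc i ℤ.- + k)) ⊠ τ (suc i))) ∎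
  where
  open ≈-Reasoning
  A B C E : ℕ → PowerSeries
  A i = K (g (+ suc i)) ⊠ (H ⊠ τ⁻ (suc i) k)
  B i = K (g (+ suc i)) ⊠ (H ⊠ τ (k + suc i))
  C i = K (g (+ suc i ℤ.+ + k)) ⊠ (H ⊠ τ (suc i))
  E i = K (g (+ suc i ℤ.- + k)) ⊠ (H ⊠ τ (suc i))
  combine : ∀ a b t → K a ⊠ (H ⊠ t) ⊟ K ε ⊠ (K b ⊠ (H ⊠ t)) ≈ H ⊠ (K (a ℤ.- ε ℤ.* b) ⊠ t)
  combine a b t = R.trans
    (S.solve 5 (λ x e y h t → x :* (h :* t) :- e :* (y :* (h :* t)) := h :* ((x :- e :* y) :* t)) R.refl (K a) (K ε) (K b) H t)
    (⊠-congˡ (⊠-congʳ (R.sym (R.trans (K-+ a (ℤ.- (ε ℤ.* b))) (⊞-congˡ (R.trans (K-neg (ε ℤ.* b)) (R.-‿cong (K-* ε b))))))))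
  bdA : Bounded A
  bdA i = Ord-⊠ʳ (K (g (+ suc i))) (Ord-τ⁻-⊠ {k} oH i)
  bdE : Bounded E
  bdE i = Ord-⊠ʳ (K (g (+ suc i ℤ.- + k))) (Ord-⊠ʳ H (Ord-≤ ℕ.pred[n]≤n (Ord-τ (suc i))))
  shiftA : ∀ i → A (k + i) ≈ C i
  shiftA i = R.*-cong (K-≡ (cong g (cong (λ j → + suc j) (ℕ.+-comm k i))))
    (⊠-congˡ (R.trans (R.reflexive (cong (λ s → τ⁻ s k) (sym (ℕ.+-suc k i)))) (τ⁻-cancel (suc i) k)))
  shiftE : ∀ i → E (k + i) ≈ B i
  shiftE i = R.*-cong (K-≡ (cong g (trans (cong (ℤ._- + k) (cong +_ (sym (ℕ.+-suc k i)))) (cancel (+ k) (+ suc i)))))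
    (⊠-congˡ (R.reflexive (cong τ (sym (ℕ.+-suc k i)))))
    where
    cancel : ∀ x y → (x ℤ.+ y) ℤ.- x ≡ y
    cancel = solve-∀
  boundary : Σ< k A ≈ ⊝ (K ε ⊠ Σ< k E)
  boundary = R.trans (Σ<-reverse k A) (R.trans (Σ<-cong k term)
    (R.trans (R.sym (Σ<-⊠ k (⊝ K ε) E))
      (S.solve 2 (λ e x → (:- e) :* x := :- (e :* x)) R.refl (K ε) (Σ< k E))))
    where
    term : ∀ i → i < k → A (k ∸ suc i) ≈ ⊝ K ε ⊠ E i
    term i i<k = begin
      K (g (+ suc j)) ⊠ (H ⊠ τ⁻ (suc j) k)
        ≈⟨ R.*-cong (K-≡ (trans (cong g index) (g-sym (+ suc i ℤ.- + k))))
             (⊠-congˡ (R.trans (τ⁻-reflect j k j<k) (R.-‿cong (R.reflexive (cong τ (ℕ.m∸[m∸n]≡n i<k)))))) ⟩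
      K (ε ℤ.* e) ⊠ (H ⊠ ⊝ τ (suc i))
        ≈⟨ ⊠-congʳ (K-* ε e) ⟩
      (K ε ⊠ K e) ⊠ (H ⊠ ⊝ τ (suc i))
        ≈⟨ S.solve 4 (λ x y h t → (x :* y) :* (h :* (:- t)) := (:- x) :* (y :* (h :* t))) R.refl (K ε) (K e) H (τ (suc i)) ⟩
      ⊝ K ε ⊠ E i ∎
      where
      j : ℕ
      j = k ∸ suc i
      e : ℤ
      e = g (+ suc i ℤ.- + k)
      j<k : j < k
      j<k = ℕ.∸-monoʳ-< {k} {suc i} {0} (s≤s z≤n) i<k
      index : + suc j ≡ 1ℤ ℤ.- (+ suc i ℤ.- + k)
      index = trans (cong (ℤ._+_ 1ℤ) (trans (sym (ℤ.⊖-≥ i<k)) (sym (ℤ.m-n≡m⊖n k (suc i))))) (flip (+ k) (+ suc i))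
        where
        flip : ∀ x y → 1ℤ ℤ.+ (x ℤ.- y) ≡ 1ℤ ℤ.- (y ℤ.- x)
        flip = solve-∀

-- The Lambert series term q^m / (1 - q^m), for m + 1 in place of m.
Λ : ℕ → PowerSeries
Λ m = Σ∞ (λ d → q^ (suc m * suc d))

Λ-bounded : ∀ m → Bounded (λ d → q^ (suc m * suc d))
Λ-bounded m d = Ord-q^ (ℕ.≤-trans ℕ.pred[n]≤n (ℕ.≤-trans (ℕ.n≤1+n d) (ℕ.m≤n*m (suc d) (suc m))))

Λ-rec : ∀ m → Λ m ≈ q^ suc m ⊞ q^ suc m ⊠ Λ m
Λ-rec m = R.trans (Σ∞-suc (Λ-bounded m)) (R.+-cong (q^-≡ (ℕ.*-identityʳ (suc m)))
  (R.trans (Σ∞-cong (λ d → R.trans (q^-≡ (ℕ.*-suc (suc m) (suc d))) (R.sym (q^-+ (suc m) (suc m * suc d)))))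
           (R.sym (Σ∞-⊠ (q^ suc m) (Λ-bounded m)))))

Ord-Λ : ∀ m → Ord (suc m) (Λ m)
Ord-Λ m = Ord-Σ∞ (λ d → Ord-q^ (ℕ.m≤m*n (suc m) (suc d)))

-- Under reflection the terms τₙ over all of ℤ cancel in pairs, so - `W s` is also the sum over the
-- indices below s.
W : ℕ → PowerSeries
W s = Σ∞ (λ i → τ (s + i))

W-bounded : ∀ s → Bounded (λ i → τ (s + i))
W-bounded s i = Ord-≤ (ℕ.pred-mono-≤ (ℕ.m≤n+m i s)) (Ord-τ (s + i))

W-rec : ∀ s → W s ≈ τ s ⊞ W (suc s)
W-rec s = R.trans (Σ∞-suc (W-bounded s)) (R.+-cong (R.reflexive (cong τ (ℕ.+-identityʳ s)))
  (Σ∞-cong (λ i → R.reflexive (cong τ (ℕ.+-suc s i)))))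

Ord-W : ∀ s → Ord (pred s) (W s)
Ord-W s = Ord-Σ∞ (λ i → Ord-≤ (ℕ.pred-mono-≤ (ℕ.m≤m+n s i)) (Ord-τ (s + i)))

Ord-q^τ⁻ : ∀ s m → Ord m (q^ s ⊠ τ⁻ s m)
Ord-q^τ⁻ s m = Ord-≈ (R.trans (R.-‿cong (τ⁻-suc s m)) (S.solve 1 (λ x → :- (:- x) := x) R.refl (q^ s ⊠ τ⁻ s m)))
  (Ord-⊝ (Ord-≤ (ℕ.m≤m+n m 0) (Ord-⊠ {l = 0} (Ord-q^ ℕ.≤-refl) Ord-0)))

-- The factor q^s is there for the order bound: without it the family is not `Bounded`, as the
-- exponents of `τ⁻` drop to 0 for m near s.
τ⁻-row : ∀ s → Σ∞ (λ m → q^ s ⊠ τ⁻ s (suc m)) ≈ ⊝ (q^ s ⊠ W s)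
τ⁻-row zero = begin
  Σ∞ (λ m → q^ 0 ⊠ ⊝ τ (2 + m))   ≈⟨ Σ∞-cong (λ m → R.*-identityˡ (⊝ τ (2 + m))) ⟩
  Σ∞ (λ m → ⊝ τ (2 + m))          ≈⟨ Σ∞-⊝ (λ m → τ (2 + m)) ⟩
  ⊝ W 2
    ≈⟨ S.solve 2 (λ w t → :- w := :- ((:- t) :+ (t :+ w))) R.refl (W 2) (τ 1) ⟩
  ⊝ (⊝ τ 1 ⊞ (τ 1 ⊞ W 2))         ≈⟨ R.-‿cong (R.+-cong (R.sym (τ⁻-zeroˡ 0)) (R.sym (W-rec 1))) ⟩
  ⊝ (τ 0 ⊞ W 1)                   ≈⟨ R.-‿cong (R.sym (R.trans (R.*-identityˡ (W 0)) (W-rec 0))) ⟩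
  ⊝ (q^ 0 ⊠ W 0)                  ∎
  where open ≈-Reasoning
τ⁻-row (suc s) = begin
  Σ∞ (λ m → q^ suc s ⊠ τ⁻ s m)
    ≈⟨ Σ∞-cong shift ⟩
  Σ∞ (λ m → q^ 1 ⊠ (q^ s ⊠ τ⁻ s m))
    ≈⟨ Σ∞-suc (λ m → Ord-⊠ʳ (q^ 1) (Ord-≤ ℕ.pred[n]≤n (Ord-q^τ⁻ s m))) ⟩
  q^ 1 ⊠ (q^ s ⊠ τ s) ⊞ Σ∞ (λ m → q^ 1 ⊠ (q^ s ⊠ τ⁻ s (suc m)))
    ≈⟨ ⊞-congˡ (R.trans (R.sym (Σ∞-⊠ (q^ 1) (λ m → Ord-≤ (ℕ.≤-trans ℕ.pred[n]≤n (ℕ.n≤1+n m)) (Ord-q^τ⁻ s (suc m)))))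
                        (⊠-congˡ (τ⁻-row s))) ⟩
  q^ 1 ⊠ (q^ s ⊠ τ s) ⊞ q^ 1 ⊠ ⊝ (q^ s ⊠ W s)
    ≈⟨ ⊞-congˡ (⊠-congˡ (R.-‿cong (⊠-congˡ (W-rec s)))) ⟩
  q^ 1 ⊠ (q^ s ⊠ τ s) ⊞ q^ 1 ⊠ ⊝ (q^ s ⊠ (τ s ⊞ W (suc s)))
    ≈⟨ S.solve 4 (λ q r t w → q :* (r :* t) :+ q :* (:- (r :* (t :+ w))) := :- ((q :* r) :* w)) R.refl
         (q^ 1) (q^ s) (τ s) (W (suc s)) ⟩
  ⊝ ((q^ 1 ⊠ q^ s) ⊠ W (suc s))
    ≈⟨ R.-‿cong (⊠-congʳ (q^-+ 1 s)) ⟩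
  ⊝ (q^ suc s ⊠ W (suc s)) ∎
  where
  open ≈-Reasoning
  shift : ∀ m → q^ suc s ⊠ τ⁻ s m ≈ q^ 1 ⊠ (q^ s ⊠ τ⁻ s m)
  shift m = R.trans (⊠-congʳ (R.sym (q^-+ 1 s))) (R.*-assoc (q^ 1) (q^ s) (τ⁻ s m))

-- The coefficient of z^s in the triple product series times the Lambert part of its logarithmic derivative in z.
C : ℕ → PowerSeries
C s = Σ∞ (λ m → Λ m ⊠ (τ⁻ s (suc m) ⊟ τ (suc m + s)))

Λ⊠-bounded : (F : ℕ → PowerSeries) → Bounded (λ m → Λ m ⊠ F m)
Λ⊠-bounded F m = Ord-≤ (ℕ.≤-trans ℕ.pred[n]≤n (ℕ.≤-trans (ℕ.n≤1+n m) (ℕ.m≤m+n (suc m) 0)))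
  (Ord-⊠ {l = 0} (Ord-Λ m) Ord-0)

private
  C⁻ C⁺ : ℕ → PowerSeries
  C⁻ s = Σ∞ (λ m → Λ m ⊠ τ⁻ s (suc m))
  C⁺ s = Σ∞ (λ m → Λ m ⊠ τ (suc m + s))

C-split : ∀ s → C s ≈ C⁻ s ⊟ C⁺ s
C-split s = begin
  C s
    ≈⟨ Σ∞-cong (λ m → S.solve 3 (λ l x y → l :* (x :- y) := l :* x :- l :* y) R.refl
                        (Λ m) (τ⁻ s (suc m)) (τ (suc m + s))) ⟩
  Σ∞ (λ m → Λ m ⊠ τ⁻ s (suc m) ⊟ Λ m ⊠ τ (suc m + s))
    ≈⟨ Σ∞-⊞ (λ m → Λ m ⊠ τ⁻ s (suc m)) (λ m → ⊝ (Λ m ⊠ τ (suc m + s))) ⟩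
  C⁻ s ⊞ Σ∞ (λ m → ⊝ (Λ m ⊠ τ (suc m + s)))
    ≈⟨ ⊞-congˡ (Σ∞-⊝ (λ m → Λ m ⊠ τ (suc m + s))) ⟩
  C⁻ s ⊟ C⁺ s ∎
  where open ≈-Reasoning

module _ (s : ℕ) where
  C⁻-suc : C⁻ (suc s) ≈ q^ s ⊠ W s ⊟ q^ s ⊠ C⁻ s
  C⁻-suc = begin
    Σ∞ (λ m → Λ m ⊠ τ⁻ s m)
      ≈⟨ Σ∞-cong term ⟩
    Σ∞ (λ m → ⊝ (q^ s ⊠ τ⁻ s (suc m)) ⊟ q^ s ⊠ (Λ m ⊠ τ⁻ s (suc m)))
      ≈⟨ Σ∞-⊞ (λ m → ⊝ (q^ s ⊠ τ⁻ s (suc m))) (λ m → ⊝ (q^ s ⊠ (Λ m ⊠ τ⁻ s (suc m)))) ⟩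
    Σ∞ (λ m → ⊝ (q^ s ⊠ τ⁻ s (suc m))) ⊞ Σ∞ (λ m → ⊝ (q^ s ⊠ (Λ m ⊠ τ⁻ s (suc m))))
      ≈⟨ R.+-cong (R.trans (Σ∞-⊝ (λ m → q^ s ⊠ τ⁻ s (suc m))) (R.-‿cong (τ⁻-row s)))
           (R.trans (Σ∞-⊝ (λ m → q^ s ⊠ (Λ m ⊠ τ⁻ s (suc m))))
             (R.-‿cong (R.sym (Σ∞-⊠ (q^ s) (Λ⊠-bounded (λ m → τ⁻ s (suc m))))))) ⟩
    ⊝ ⊝ (q^ s ⊠ W s) ⊟ q^ s ⊠ C⁻ s
      ≈⟨ S.solve 2 (λ x y → (:- (:- x)) :- y := x :- y) R.refl (q^ s ⊠ W s) (q^ s ⊠ C⁻ s) ⟩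
    q^ s ⊠ W s ⊟ q^ s ⊠ C⁻ s ∎
    where
    open ≈-Reasoning
    term : ∀ m → Λ m ⊠ τ⁻ s m ≈ ⊝ (q^ s ⊠ τ⁻ s (suc m)) ⊟ q^ s ⊠ (Λ m ⊠ τ⁻ s (suc m))
    term m = begin
      Λ m ⊠ τ⁻ s m
        ≈⟨ ⊠-congʳ (Λ-rec m) ⟩
      (q^ suc m ⊞ q^ suc m ⊠ Λ m) ⊠ τ⁻ s m
        ≈⟨ S.solve 3 (λ x l t → (x :+ x :* l) :* t := x :* t :+ l :* (x :* t)) R.refl (q^ suc m) (Λ m) (τ⁻ s m) ⟩
      q^ suc m ⊠ τ⁻ s m ⊞ Λ m ⊠ (q^ suc m ⊠ τ⁻ s m)
        ≈⟨ R.+-cong (τ⁻-suc s (suc m)) (⊠-congˡ (τ⁻-suc s (suc m))) ⟩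
      ⊝ (q^ s ⊠ τ⁻ s (suc m)) ⊞ Λ m ⊠ ⊝ (q^ s ⊠ τ⁻ s (suc m))
        ≈⟨ S.solve 3 (λ x l t → :- (x :* t) :+ l :* (:- (x :* t)) := :- (x :* t) :- x :* (l :* t)) R.refl
             (q^ s) (Λ m) (τ⁻ s (suc m)) ⟩
      ⊝ (q^ s ⊠ τ⁻ s (suc m)) ⊟ q^ s ⊠ (Λ m ⊠ τ⁻ s (suc m)) ∎

  C⁺-suc : q^ s ⊠ C⁺ s ≈ ⊝ W (2 + s) ⊟ C⁺ (suc s)
  C⁺-suc = begin
    q^ s ⊠ C⁺ s
      ≈⟨ Σ∞-⊠ (q^ s) (Λ⊠-bounded (λ m → τ (suc m + s))) ⟩
    Σ∞ (λ m → q^ s ⊠ (Λ m ⊠ τ (suc m + s)))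
      ≈⟨ Σ∞-cong term ⟩
    Σ∞ (λ m → ⊝ τ (2 + s + m) ⊟ Λ m ⊠ τ (suc m + suc s))
      ≈⟨ Σ∞-⊞ (λ m → ⊝ τ (2 + s + m)) (λ m → ⊝ (Λ m ⊠ τ (suc m + suc s))) ⟩
    Σ∞ (λ m → ⊝ τ (2 + s + m)) ⊞ Σ∞ (λ m → ⊝ (Λ m ⊠ τ (suc m + suc s)))
      ≈⟨ R.+-cong (Σ∞-⊝ (λ m → τ (2 + s + m))) (Σ∞-⊝ (λ m → Λ m ⊠ τ (suc m + suc s))) ⟩
    ⊝ W (2 + s) ⊟ C⁺ (suc s) ∎
    where
    open ≈-Reasoning
    next : ∀ m → q^ s ⊠ (q^ suc m ⊠ τ (suc m + s)) ≈ ⊝ τ (2 + m + s)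
    next m = begin
      q^ s ⊠ (q^ suc m ⊠ τ (suc m + s))
        ≈⟨ S.solve 3 (λ x y z → x :* (y :* z) := (y :* x) :* z) R.refl (q^ s) (q^ suc m) (τ (suc m + s)) ⟩
      (q^ suc m ⊠ q^ s) ⊠ τ (suc m + s)
        ≈⟨ ⊠-congʳ (q^-+ (suc m) s) ⟩
      q^ (suc m + s) ⊠ τ (suc m + s)
        ≈⟨ S.solve 1 (λ x → x := :- (:- x)) R.refl (q^ (suc m + s) ⊠ τ (suc m + s)) ⟩
      ⊝ ⊝ (q^ (suc m + s) ⊠ τ (suc m + s))
        ≈⟨ R.-‿cong (R.sym (τ-suc (suc m + s))) ⟩
      ⊝ τ (2 + m + s) ∎
    term : ∀ m → q^ s ⊠ (Λ m ⊠ τ (suc m + s)) ≈ ⊝ τ (2 + s + m) ⊟ Λ m ⊠ τ (suc m + suc s)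
    term m = begin
      q^ s ⊠ (Λ m ⊠ τ (suc m + s))
        ≈⟨ ⊠-congˡ (⊠-congʳ (Λ-rec m)) ⟩
      q^ s ⊠ ((q^ suc m ⊞ q^ suc m ⊠ Λ m) ⊠ τ (suc m + s))
        ≈⟨ S.solve 4 (λ y x l t → y :* ((x :+ x :* l) :* t) := y :* (x :* t) :+ l :* (y :* (x :* t))) R.refl
             (q^ s) (q^ suc m) (Λ m) (τ (suc m + s)) ⟩
      q^ s ⊠ (q^ suc m ⊠ τ (suc m + s)) ⊞ Λ m ⊠ (q^ s ⊠ (q^ suc m ⊠ τ (suc m + s)))
        ≈⟨ R.+-cong (next m) (⊠-congˡ (next m)) ⟩
      ⊝ τ (2 + m + s) ⊞ Λ m ⊠ ⊝ τ (2 + m + s)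
        ≈⟨ ⊞-congˡ (S.solve 2 (λ l t → l :* (:- t) := :- (l :* t)) R.refl (Λ m) (τ (2 + m + s))) ⟩
      ⊝ τ (2 + m + s) ⊟ Λ m ⊠ τ (2 + m + s)
        ≈⟨ R.+-cong (R.-‿cong (R.reflexive (cong (λ j → τ (2 + j)) (ℕ.+-comm m s))))
             (R.-‿cong (⊠-congˡ (R.reflexive (cong τ (sym (ℕ.+-suc (suc m) s)))))) ⟩
      ⊝ τ (2 + s + m) ⊟ Λ m ⊠ τ (suc m + suc s) ∎

  -- Coefficient form of z ↦ qz, which turns the triple product T(z) into - T(z)/z: `Λ-rec` absorbs
  -- the factor q^(m+1), and the leftover terms without `Λ` sum to tails `W`.
  C-suc : C (suc s) ≈ q^ s ⊠ W s ⊟ q^ s ⊠ C s ⊞ W (2 + s)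
  C-suc = begin
    C (suc s)
      ≈⟨ C-split (suc s) ⟩
    C⁻ (suc s) ⊟ C⁺ (suc s)
      ≈⟨ S.solve 3 (λ a b w → a :- b := (a :+ (:- w :- b)) :+ w) R.refl (C⁻ (suc s)) (C⁺ (suc s)) (W (2 + s)) ⟩
    (C⁻ (suc s) ⊞ (⊝ W (2 + s) ⊟ C⁺ (suc s))) ⊞ W (2 + s)
      ≈⟨ ⊞-congʳ (R.+-cong C⁻-suc (R.sym C⁺-suc)) ⟩
    ((q^ s ⊠ W s ⊟ q^ s ⊠ C⁻ s) ⊞ q^ s ⊠ C⁺ s) ⊞ W (2 + s)
      ≈⟨ S.solve 5 (λ q w a b v → ((q :* w :- q :* a) :+ q :* b) :+ v := (q :* w :- q :* (a :- b)) :+ v) R.refl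
           (q^ s) (W s) (C⁻ s) (C⁺ s) (W (2 + s)) ⟩
    q^ s ⊠ W s ⊟ q^ s ⊠ (C⁻ s ⊟ C⁺ s) ⊞ W (2 + s)
      ≈⟨ ⊞-congʳ (⊞-congˡ (R.-‿cong (⊠-congˡ (R.sym (C-split s))))) ⟩
    q^ s ⊠ W s ⊟ q^ s ⊠ C s ⊞ W (2 + s) ∎
    where open ≈-Reasoning

-- For T = ∏ (1 - zqᵐ)(1 - qᵐ⁺¹/z)(1 - qᵐ⁺¹) over m ≥ 0, this compares the coefficients of z^s in z
-- T′ = T · z (log T)′: the factor 1 - z contributes `W s`, the other factors - `C s`. The induction
-- on s runs through the functional equation of T.
C-closed : ∀ s → C s ≈ W s ⊟ K (+ s) ⊠ τ s
C-closed zero = begin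
  C 0
    -- At s = 0 each single term of the sum already reduces to `τ (2 + m)`.
    ≈⟨ Σ∞-cong (λ m → R.trans (⊠-congˡ (⊞-congˡ (R.-‿cong (R.reflexive (cong τ (ℕ.+-identityʳ (suc m)))))))
         (R.trans (R.trans (S.solve 3 (λ l x y → l :* (:- x :- y) := :- (l :* x) :- l :* y) R.refl (Λ m) (τ (2 + m)) (τ (suc m)))
           (⊞-congˡ (R.-‿cong (⊠-congʳ (Λ-rec m)))))
         (R.trans (S.solve 4 (λ l x y z → :- (l :* z) :- (x :+ x :* l) :* y := :- (l :* z) :+ (:- (x :* y) :+ l :* (:- (x :* y))))
            R.refl (Λ m) (q^ suc m) (τ (suc m)) (τ (2 + m)))
         (R.trans (⊞-congˡ (R.+-cong (R.sym (τ-suc (suc m))) (⊠-congˡ (R.sym (τ-suc (suc m))))))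
           (S.solve 2 (λ l z → :- (l :* z) :+ (z :+ l :* z) := z) R.refl (Λ m) (τ (2 + m))))))) ⟩
  W 2
    ≈⟨ S.solve 2 (λ t w → w := :- t :+ (t :+ w)) R.refl (τ 1) (W 2) ⟩
  ⊝ τ 1 ⊞ (τ 1 ⊞ W 2)
    ≈⟨ R.+-cong (R.sym (τ⁻-zeroˡ 0)) (R.sym (W-rec 1)) ⟩
  τ 0 ⊞ W 1
    ≈⟨ R.sym (W-rec 0) ⟩
  W 0
    ≈⟨ S.solve 2 (λ w t → w := w :- # 0 :* t) R.refl (W 0) (τ 0) ⟩
  W 0 ⊟ K (+ 0) ⊠ τ 0 ∎
  where open ≈-Reasoning
C-closed (suc s) = begin
  C (suc s)
    ≈⟨ C-suc s ⟩
  q^ s ⊠ W s ⊟ q^ s ⊠ C s ⊞ W (2 + s)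
    ≈⟨ ⊞-congʳ (⊞-congˡ (R.-‿cong (⊠-congˡ (C-closed s)))) ⟩
  q^ s ⊠ W s ⊟ q^ s ⊠ (W s ⊟ K (+ s) ⊠ τ s) ⊞ W (2 + s)
    ≈⟨ S.solve 5 (λ q w k t v → q :* w :- q :* (w :- k :* t) :+ v := (:- (q :* t) :+ v) :- (# 1 :+ k) :* (:- (q :* t))) R.refl
         (q^ s) (W s) (K (+ s)) (τ s) (W (2 + s)) ⟩
  (⊝ (q^ s ⊠ τ s) ⊞ W (2 + s)) ⊟ (K 1ℤ ⊞ K (+ s)) ⊠ ⊝ (q^ s ⊠ τ s)
    ≈⟨ R.+-cong (R.trans (⊞-congʳ (R.sym (τ-suc s))) (R.sym (W-rec (suc s))))
         (R.-‿cong (R.*-cong (R.sym (K-+ 1ℤ (+ s))) (R.sym (τ-suc s)))) ⟩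
  W (suc s) ⊟ K (+ suc s) ⊠ τ (suc s) ∎
  where open ≈-Reasoning

-- Weighted theta series

Θ : (ℕ → ℤ) → PowerSeries
Θ w = Σ∞ (λ i → K (w i) ⊠ τ (suc i))

Θ-bounded : (w : ℕ → ℤ) → Bounded (λ i → K (w i) ⊠ τ (suc i))
Θ-bounded w i = Ord-⊠ʳ (K (w i)) (Ord-≤ ℕ.pred[n]≤n (Ord-τ (suc i)))

Θ-cong : ∀ {v w} → (∀ i → v i ≡ w i) → Θ v ≈ Θ w
Θ-cong v≡w = Σ∞-cong (λ i → ⊠-congʳ (K-≡ (v≡w i)))

Θ-+ : ∀ v w → Θ (λ i → v i ℤ.+ w i) ≈ Θ v ⊞ Θ w
Θ-+ v w = R.trans
  (Σ∞-cong (λ i → R.trans (⊠-congʳ (K-+ (v i) (w i))) (R.distribʳ (τ (suc i)) (K (v i)) (K (w i)))))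
  (Σ∞-⊞ (λ i → K (v i) ⊠ τ (suc i)) (λ i → K (w i) ⊠ τ (suc i)))

Θ-* : ∀ c w → Θ (λ i → c ℤ.* w i) ≈ K c ⊠ Θ w
Θ-* c w = R.trans
  (Σ∞-cong (λ i → R.trans (⊠-congʳ (K-* c (w i))) (R.*-assoc (K c) (K (w i)) (τ (suc i)))))
  (Σ∞-K c (λ i → K (w i) ⊠ τ (suc i)))

prefix : (ℤ → ℤ) → ℕ → ℤ
prefix g zero    = 0ℤ
prefix g (suc n) = prefix g n ℤ.+ g (+ suc n)

-- Abel summation: `τ n` occurs in the tails `W 1`, ..., `W n`, hence with total weight
-- `prefix g n`.
Σ-gW : ∀ g → Σ∞ (λ i → K (g (+ suc i)) ⊠ W (suc i)) ≈ Θ (prefix g ∘ suc)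
Σ-gW g = begin
  Σ∞ X
    ≈⟨ S.solve 2 (λ x y → x := (y :+ x) :- y) R.refl (Σ∞ X) (Σ∞ Y) ⟩
  (Σ∞ Y ⊞ Σ∞ X) ⊟ Σ∞ Y
    ≈⟨ R.+-cong (R.trans (R.sym (Σ∞-⊞ Y X)) (R.trans (Σ∞-cong join) (Σ∞-⊞ (λ i → K (prefix g (suc i)) ⊠ τ (suc i)) (Y ∘ suc))))
         (R.-‿cong (Σ∞-suc bdY)) ⟩
  (Θ (prefix g ∘ suc) ⊞ Σ∞ (Y ∘ suc)) ⊟ (K 0ℤ ⊠ W 1 ⊞ Σ∞ (Y ∘ suc))
    ≈⟨ S.solve 3 (λ t y w → (t :+ y) :- (# 0 :* w :+ y) := t) R.refl (Θ (prefix g ∘ suc)) (Σ∞ (Y ∘ suc)) (W 1) ⟩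
  Θ (prefix g ∘ suc) ∎
  where
  open ≈-Reasoning
  X Y : ℕ → PowerSeries
  X i = K (g (+ suc i)) ⊠ W (suc i)
  Y i = K (prefix g i) ⊠ W (suc i)
  bdY : Bounded Y
  bdY i = Ord-⊠ʳ (K (prefix g i)) (Ord-≤ ℕ.pred[n]≤n (Ord-W (suc i)))
  join : ∀ i → Y i ⊞ X i ≈ K (prefix g (suc i)) ⊠ τ (suc i) ⊞ Y (suc i)
  join i = begin
    Y i ⊞ X i
      ≈⟨ R.sym (R.distribʳ (W (suc i)) (K (prefix g i)) (K (g (+ suc i)))) ⟩
    (K (prefix g i) ⊞ K (g (+ suc i))) ⊠ W (suc i)
      ≈⟨ R.*-cong (R.sym (K-+ (prefix g i) (g (+ suc i)))) (W-rec (suc i)) ⟩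
    K (prefix g (suc i)) ⊠ (τ (suc i) ⊞ W (2 + i))
      ≈⟨ R.distribˡ (K (prefix g (suc i))) (τ (suc i)) (W (2 + i)) ⟩
    K (prefix g (suc i)) ⊠ τ (suc i) ⊞ Y (suc i) ∎

-- Pairing the logarithmic derivative of the triple product in z with a weight g on the exponents of z.
logarithmic-derivative : ∀ g → (∀ z → g (1ℤ ℤ.- z) ≡ g z) →
  Σ∞ (λ m → Λ m ⊠ Θ (λ i → g (+ suc i ℤ.+ + suc m) ℤ.- g (+ suc i ℤ.- + suc m))) ≈
  Θ (λ i → prefix g (suc i) ℤ.- + suc i ℤ.* g (+ suc i))
logarithmic-derivative g g-sym = begin
  Σ∞ (λ m → Λ m ⊠ Θ (λ i → g (+ suc i ℤ.+ + suc m) ℤ.- g (+ suc i ℤ.- + suc m)))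
    ≈⟨ Σ∞-cong (λ m → R.trans (⊠-congˡ (Θ-cong (λ i → cong (λ x → g (+ suc i ℤ.+ + suc m) ℤ.- x) (sym (ℤ.*-identityˡ _)))))
         (Σ∞-⊠ (Λ m) (Θ-bounded (weight m)))) ⟩
  Σ∞ (λ m → Σ∞ (λ i → Λ m ⊠ (K (weight m i) ⊠ τ (suc i))))
    ≈⟨ Σ∞-cong (λ m → R.sym (reflection (suc m) (Ord-≤ (ℕ.n≤1+n m) (Ord-Λ m)) 1ℤ g
         (λ z → trans (g-sym z) (sym (ℤ.*-identityˡ (g z)))))) ⟩
  Σ∞ (λ m → Σ∞ (λ i → K (g (+ suc i)) ⊠ (Λ m ⊠ (τ⁻ (suc i) (suc m) ⊟ K 1ℤ ⊠ τ (suc m + suc i)))))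
    ≈⟨ Σ∞-swap (λ m i → K (g (+ suc i)) ⊠ (Λ m ⊠ (τ⁻ (suc i) (suc m) ⊟ K 1ℤ ⊠ τ (suc m + suc i)))) ⟩
  Σ∞ (λ i → Σ∞ (λ m → K (g (+ suc i)) ⊠ (Λ m ⊠ (τ⁻ (suc i) (suc m) ⊟ K 1ℤ ⊠ τ (suc m + suc i)))))
    ≈⟨ Σ∞-cong (λ i → R.trans (Σ∞-K (g (+ suc i)) (λ m → Λ m ⊠ (τ⁻ (suc i) (suc m) ⊟ K 1ℤ ⊠ τ (suc m + suc i))))
         (⊠-congˡ (R.trans (Σ∞-cong (λ m → S.solve 3 (λ l x y → l :* (x :- # 1 :* y) := l :* (x :- y)) R.refl
            (Λ m) (τ⁻ (suc i) (suc m)) (τ (suc m + suc i)))) (C-closed (suc i))))) ⟩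
  Σ∞ (λ i → K (g (+ suc i)) ⊠ (W (suc i) ⊟ K (+ suc i) ⊠ τ (suc i)))
    ≈⟨ Σ∞-cong (λ i → R.trans (S.solve 4 (λ g w k t → g :* (w :- k :* t) := g :* w :+ (:- (k :* g)) :* t) R.refl
         (K (g (+ suc i))) (W (suc i)) (K (+ suc i)) (τ (suc i)))
         (⊞-congˡ (⊠-congʳ (R.sym (R.trans (K-neg (+ suc i ℤ.* g (+ suc i))) (R.-‿cong (K-* (+ suc i) (g (+ suc i))))))))) ⟩
  Σ∞ (λ i → K (g (+ suc i)) ⊠ W (suc i) ⊞ K (ℤ.- (+ suc i ℤ.* g (+ suc i))) ⊠ τ (suc i))
    ≈⟨ Σ∞-⊞ (λ i → K (g (+ suc i)) ⊠ W (suc i)) (λ i → K (ℤ.- (+ suc i ℤ.* g (+ suc i))) ⊠ τ (suc i)) ⟩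
  Σ∞ (λ i → K (g (+ suc i)) ⊠ W (suc i)) ⊞ Θ (λ i → ℤ.- (+ suc i ℤ.* g (+ suc i)))
    ≈⟨ ⊞-congʳ (Σ-gW g) ⟩
  Θ (prefix g ∘ suc) ⊞ Θ (λ i → ℤ.- (+ suc i ℤ.* g (+ suc i)))
    ≈⟨ R.sym (Θ-+ (prefix g ∘ suc) (λ i → ℤ.- (+ suc i ℤ.* g (+ suc i)))) ⟩
  Θ (λ i → prefix g (suc i) ℤ.- + suc i ℤ.* g (+ suc i)) ∎
  where
  open ≈-Reasoning
  weight : ℕ → ℕ → ℤ
  weight m i = g (+ suc i ℤ.+ + suc m) ℤ.- 1ℤ ℤ.* g (+ suc i ℤ.- + suc m)

-- The substitution q ↦ q^k and sections modulo k

Σ<-transfer : ∀ {m n} M {F G : ℕ → PowerSeries} → (∀ i → F i m ≡ G i n) → Σ< M F m ≡ Σ< M G n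
Σ<-transfer {m} {n} zero    {F} {G} p = trans (at (Σ<-zero F) m) (sym (at (Σ<-zero G) n))
Σ<-transfer {m} {n} (suc M) {F} {G} p = trans
  (trans (at (Σ<-last M F) m) (⊞-at (Σ< M F) (F M) m))
  (trans (cong₂ ℤ._+_ (Σ<-transfer M p) (p M)) (sym (trans (at (Σ<-last M G) n) (⊞-at (Σ< M G) (G M) n))))

module _ (k : ℕ) .{{k≢0 : NonZero k}} where

  opaque
    sub : PowerSeries → PowerSeries
    sub F n = if does (k ∣? n) then F (n / k) else 0ℤ

    sub-multiple : ∀ F m → sub F (k * m) ≡ F m
    sub-multiple F m rewrite dec-true (k ∣? (k * m)) (m∣m*n m) =
      cong F (trans (cong (_/ k) (ℕ.*-comm k m)) (m*n/n≡m m k))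

    sub-nonmultiple : ∀ F {n} → k ∤ n → sub F n ≡ 0ℤ
    sub-nonmultiple F {n} k∤n rewrite dec-false (k ∣? n) k∤n = refl

  multiple-ext : ∀ {F G} → (∀ m → F (k * m) ≡ G (k * m)) → (∀ n → k ∤ n → F n ≡ G n) → F ≈ G
  multiple-ext {F} {G} p r = pw go
    where
    go : F ≗ G
    go n with k ∣? n
    ... | no k∤n = r n k∤n
    ... | yes (divides m n≡m*k) = subst (λ j → F j ≡ G j) (trans (ℕ.*-comm k m) (sym n≡m*k)) (p m)

  sub-ext : ∀ {F G} → (∀ m → F m ≡ G (k * m)) → (∀ n → k ∤ n → G n ≡ 0ℤ) → sub F ≈ G
  sub-ext {F} p r = multiple-ext (λ m → trans (sub-multiple F m) (p m))
    (λ n k∤n → trans (sub-nonmultiple F k∤n) (sym (r n k∤n)))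

  sub-cong : ∀ {F G} → F ≈ G → sub F ≈ sub G
  sub-cong {F} {G} p = sub-ext (λ m → trans (at p m) (sym (sub-multiple G m))) (λ n → sub-nonmultiple G)

  sub-⊞ : ∀ F G → sub (F ⊞ G) ≈ sub F ⊞ sub G
  sub-⊞ F G = sub-ext
    (λ m → trans (⊞-at F G m) (sym (trans (⊞-at (sub F) (sub G) (k * m)) (cong₂ ℤ._+_ (sub-multiple F m) (sub-multiple G m)))))
    (λ n k∤n → trans (⊞-at (sub F) (sub G) n) (cong₂ ℤ._+_ (sub-nonmultiple F k∤n) (sub-nonmultiple G k∤n)))

  sub-K⊠ : ∀ c F → sub (K c ⊠ F) ≈ K c ⊠ sub F
  sub-K⊠ c F = sub-ext
    (λ m → trans (K-⊠ c F m) (sym (trans (K-⊠ c (sub F) (k * m)) (cong (c ℤ.*_) (sub-multiple F m)))))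
    (λ n k∤n → trans (K-⊠ c (sub F) n) (trans (cong (c ℤ.*_) (sub-nonmultiple F k∤n)) (ℤ.*-zeroʳ c)))

  sub-q^ : ∀ e → sub (q^ e) ≈ q^ (k * e)
  sub-q^ e = sub-ext agree
    (λ n k∤n → q^-≢ (λ n≡k*e → k∤n (subst (k ∣ℕ_) (sym n≡k*e) (m∣m*n e))))
    where
    agree : ∀ m → (q^ e) m ≡ (q^ (k * e)) (k * m)
    agree m with m ℕ.≟ e
    ... | yes refl = trans (q^-eq e) (sym (q^-eq (k * e)))
    ... | no  m≢e  = trans (q^-≢ m≢e) (sym (q^-≢ (λ p → m≢e (ℕ.*-cancelˡ-≡ m e k p))))

  sub-q^⊠ : ∀ e F → sub (q^ e ⊠ F) ≈ q^ (k * e) ⊠ sub F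
  sub-q^⊠ e F = sub-ext multiples nonmultiples
    where
    low : ∀ e F → Ord e (q^ e ⊠ F)
    low e F = Ord-≤ (ℕ.m≤m+n e 0) (Ord-⊠ {l = 0} (Ord-q^ ℕ.≤-refl) Ord-0)
    multiples : ∀ m → (q^ e ⊠ F) m ≡ (q^ (k * e) ⊠ sub F) (k * m)
    multiples m with e ℕ.≤? m
    ... | no  e≰m = trans (low e F m (ℕ.≰⇒> e≰m))
                      (sym (low (k * e) (sub F) (k * m) (ℕ.*-monoʳ-< k (ℕ.≰⇒> e≰m))))
    ... | yes e≤m = begin
      (q^ e ⊠ F) m                                ≡⟨ cong (q^ e ⊠ F) (sym (ℕ.m+[n∸m]≡n e≤m)) ⟩
      (q^ e ⊠ F) (e + (m ∸ e))                    ≡⟨ q^-shift e F (m ∸ e) ⟩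
      F (m ∸ e)                                   ≡⟨ sym (sub-multiple F (m ∸ e)) ⟩
      sub F (k * (m ∸ e))                         ≡⟨ sym (q^-shift (k * e) (sub F) (k * (m ∸ e))) ⟩
      (q^ (k * e) ⊠ sub F) (k * e + k * (m ∸ e))  ≡⟨ cong (q^ (k * e) ⊠ sub F)
        (trans (sym (ℕ.*-distribˡ-+ k e (m ∸ e))) (cong (k *_) (ℕ.m+[n∸m]≡n e≤m))) ⟩
      (q^ (k * e) ⊠ sub F) (k * m)                ∎
      where open ≡-Reasoning
    nonmultiples : ∀ n → k ∤ n → (q^ (k * e) ⊠ sub F) n ≡ 0ℤ
    nonmultiples n k∤n with (k * e) ℕ.≤? n
    ... | no  ≰ = low (k * e) (sub F) n (ℕ.≰⇒> ≰)
    ... | yes ≤ = trans (cong (q^ (k * e) ⊠ sub F) (sym (ℕ.m+[n∸m]≡n ≤)))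
      (trans (q^-shift (k * e) (sub F) (n ∸ k * e))
        (sub-nonmultiple F (λ k∣n′ → k∤n (subst (k ∣ℕ_) (ℕ.m+[n∸m]≡n ≤) (∣m∣n⇒∣m+n (m∣m*n e) k∣n′)))))

  sub-Σ∞ : ∀ {F} → Bounded F → sub (Σ∞ F) ≈ Σ∞ (λ i → sub (F i))
  sub-Σ∞ {F} bd = sub-ext
    (λ m → trans (sym (Σ∞-stable bd m (s≤s (s≤s (ℕ.m≤n*m m k)))))
      (trans (Σ<-transfer (2 + k * m) (λ i → sym (sub-multiple (F i) m))) (sym (Σ∞-at (λ i → sub (F i)) (k * m)))))
    (λ n k∤n → trans (Σ∞-at (λ i → sub (F i)) n)
      (trans (Σ<-local n (2 + n) (λ i → sub (F i)) (λ _ → 𝟘) (λ i → sub-nonmultiple (F i) k∤n)) (at (Σ<-𝟘 (2 + n)) n)))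

  sub-expand : ∀ F → sub F ≈ Σ∞ (λ i → K (F i) ⊠ q^ (k * i))
  sub-expand F = R.trans (R.trans (sub-cong (expand F)) (sub-Σ∞ (λ i → Ord-⊠ʳ (K (F i)) (Ord-q^ ℕ.pred[n]≤n))))
    (Σ∞-cong (λ i → R.trans (sub-K⊠ (F i) (q^ i)) (⊠-congˡ (sub-q^ i))))

  Σ∞-distribʳ : ∀ (F : PowerSeries) (V : ℕ → PowerSeries) → Bounded (λ i → K (F i) ⊠ V i) → ∀ H →
               Σ∞ (λ i → K (F i) ⊠ V i) ⊠ H ≈ Σ∞ (λ i → K (F i) ⊠ (V i ⊠ H))
  Σ∞-distribʳ F V bd H = R.trans (R.*-comm (Σ∞ (λ i → K (F i) ⊠ V i)) H)
    (R.trans (Σ∞-⊠ H bd)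
      (Σ∞-cong (λ i → S.solve 3 (λ h k x → h :* (k :* x) := k :* (x :* h)) R.refl H (K (F i)) (V i))))

  expand-bounded : (F : PowerSeries) → Bounded (λ i → K (F i) ⊠ q^ i)
  expand-bounded F i = Ord-⊠ʳ (K (F i)) (Ord-q^ ℕ.pred[n]≤n)

  sub-expand-bounded : (F : PowerSeries) → Bounded (λ i → K (F i) ⊠ q^ (k * i))
  sub-expand-bounded F i = Ord-⊠ʳ (K (F i)) (Ord-q^ (ℕ.≤-trans ℕ.pred[n]≤n (ℕ.m≤n*m i k)))

  -- Both sides are linear in `F`, and for a monomial `F` the claim is a shift of exponents.
  sub-⊠ : ∀ F G → sub (F ⊠ G) ≈ sub F ⊠ sub G
  sub-⊠ F G = begin
    sub (F ⊠ G)
      ≈⟨ sub-cong (R.trans (⊠-congʳ (expand F)) (Σ∞-distribʳ F q^_ (expand-bounded F) G)) ⟩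
    sub (Σ∞ (λ i → K (F i) ⊠ (q^ i ⊠ G)))
      ≈⟨ sub-Σ∞ (λ i → Ord-⊠ʳ (K (F i)) (Ord-≈ (R.*-comm G (q^ i)) (Ord-⊠ʳ G (Ord-q^ ℕ.pred[n]≤n)))) ⟩
    Σ∞ (λ i → sub (K (F i) ⊠ (q^ i ⊠ G)))
      ≈⟨ Σ∞-cong (λ i → R.trans (sub-K⊠ (F i) (q^ i ⊠ G)) (⊠-congˡ (sub-q^⊠ i G))) ⟩
    Σ∞ (λ i → K (F i) ⊠ (q^ (k * i) ⊠ sub G))
      ≈⟨ R.sym (Σ∞-distribʳ F (λ i → q^ (k * i)) (sub-expand-bounded F) (sub G)) ⟩
    Σ∞ (λ i → K (F i) ⊠ q^ (k * i)) ⊠ sub G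
      ≈⟨ ⊠-congʳ (R.sym (sub-expand F)) ⟩
    sub F ⊠ sub G ∎
    where open ≈-Reasoning

  -- A series in q^k moves exponents by multiples of k, so it passes through the extraction of a
  -- residue class; again it suffices to treat monomials.
  sub-section : ∀ F G r → r < k → ∀ n → (sub F ⊠ G) (k * n + r) ≡ (F ⊠ (λ m → G (k * m + r))) n
  sub-section F G r r<k n = begin
    (sub F ⊠ G) (k * n + r)
      ≡⟨ at (R.trans (⊠-congʳ (sub-expand F)) (Σ∞-distribʳ F (λ i → q^ (k * i)) (sub-expand-bounded F) G)) (k * n + r) ⟩
    Σ∞ (λ i → K (F i) ⊠ (q^ (k * i) ⊠ G)) (k * n + r)
      ≡⟨ Σ∞-at (λ i → K (F i) ⊠ (q^ (k * i) ⊠ G)) (k * n + r) ⟩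
    Σ< (2 + (k * n + r)) (λ i → K (F i) ⊠ (q^ (k * i) ⊠ G)) (k * n + r)
      ≡⟨ Σ<-transfer (2 + (k * n + r)) term ⟩
    Σ< (2 + (k * n + r)) (λ i → K (F i) ⊠ (q^ i ⊠ G′)) n
      ≡⟨ Σ∞-stable bd n (s≤s (s≤s (ℕ.≤-trans (ℕ.m≤n*m n k) (ℕ.m≤m+n (k * n) r)))) ⟩
    Σ∞ (λ i → K (F i) ⊠ (q^ i ⊠ G′)) n
      ≡⟨ sym (at (R.trans (⊠-congʳ (expand F)) (Σ∞-distribʳ F q^_ (expand-bounded F) G′)) n) ⟩
    (F ⊠ G′) n ∎
    where
    open ≡-Reasoning
    G′ : PowerSeries
    G′ m = G (k * m + r)
    bd : Bounded (λ i → K (F i) ⊠ (q^ i ⊠ G′))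
    bd i = Ord-⊠ʳ (K (F i)) (Ord-≈ (R.*-comm G′ (q^ i)) (Ord-⊠ʳ G′ (Ord-q^ ℕ.pred[n]≤n)))
    low : ∀ e H n → n < e → (q^ e ⊠ H) n ≡ 0ℤ
    low e H n = Ord-≤ (ℕ.m≤m+n e 0) (Ord-⊠ {l = 0} (Ord-q^ {e} ℕ.≤-refl) (Ord-0 {H})) n
    shifted : ∀ i → (q^ (k * i) ⊠ G) (k * n + r) ≡ (q^ i ⊠ G′) n
    shifted i with i ℕ.≤? n
    ... | no  i≰n = trans (low (k * i) G (k * n + r) (ℕ.<-≤-trans (ℕ.+-monoʳ-< (k * n) r<k)
            (ℕ.≤-trans (ℕ.≤-reflexive (trans (ℕ.+-comm (k * n) k) (sym (ℕ.*-suc k n)))) (ℕ.*-monoʳ-≤ k (ℕ.≰⇒> i≰n)))))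
          (sym (low i G′ n (ℕ.≰⇒> i≰n)))
    ... | yes i≤n = begin
      (q^ (k * i) ⊠ G) (k * n + r)                      ≡⟨ cong (q^ (k * i) ⊠ G) index ⟩
      (q^ (k * i) ⊠ G) (k * i + (k * (n ∸ i) + r))      ≡⟨ q^-shift (k * i) G (k * (n ∸ i) + r) ⟩
      G′ (n ∸ i)                                        ≡⟨ sym (q^-shift i G′ (n ∸ i)) ⟩
      (q^ i ⊠ G′) (i + (n ∸ i))                         ≡⟨ cong (q^ i ⊠ G′) (ℕ.m+[n∸m]≡n i≤n) ⟩
      (q^ i ⊠ G′) n                                     ∎
      where
      index : k * n + r ≡ k * i + (k * (n ∸ i) + r)
      index = trans (cong (_+ r) (trans (cong (k *_) (sym (ℕ.m+[n∸m]≡n i≤n))) (ℕ.*-distribˡ-+ k i (n ∸ i))))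
        (ℕ.+-assoc (k * i) (k * (n ∸ i)) r)
    term : ∀ i → (K (F i) ⊠ (q^ (k * i) ⊠ G)) (k * n + r) ≡ (K (F i) ⊠ (q^ i ⊠ G′)) n
    term i = trans (K-⊠ (F i) (q^ (k * i) ⊠ G) (k * n + r))
      (trans (cong (F i ℤ.*_) (shifted i)) (sym (K-⊠ (F i) (q^ i ⊠ G′) n)))

  D-sub : ∀ F → D (sub F) ≈ K (+ k) ⊠ sub (D F)
  D-sub F = multiple-ext
    (λ m → trans (D-at (sub F) (k * m)) (trans (cong₂ ℤ._*_ (ℤ.pos-* k m) (sub-multiple F m))
      (trans (ℤ.*-assoc (+ k) (+ m) (F m)) (sym (trans (K-⊠ (+ k) (sub (D F)) (k * m))
        (cong (+ k ℤ.*_) (trans (sub-multiple (D F) m) (D-at F m))))))))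
    (λ n k∤n → trans (D-at (sub F) n) (trans (trans (cong (+ n ℤ.*_) (sub-nonmultiple F k∤n)) (ℤ.*-zeroʳ (+ n)))
      (sym (trans (K-⊠ (+ k) (sub (D F)) n) (trans (cong (+ k ℤ.*_) (sub-nonmultiple (D F) k∤n)) (ℤ.*-zeroʳ (+ k)))))))

  sub-fUpTo : ∀ N → sub (fUpTo 1 N) ≈ fUpTo k N
  sub-fUpTo zero    = R.trans (sub-q^ 0) (q^-≡ (ℕ.*-zeroʳ k))
  sub-fUpTo (suc N) = begin
    sub (fUpTo 1 (suc N))
      ≈⟨ sub-cong (fUpTo-⊠ 1 N) ⟩
    sub ((one ⊟ q^ (1 * suc N)) ⊠ fUpTo 1 N)
      ≈⟨ sub-⊠ (one ⊟ q^ (1 * suc N)) (fUpTo 1 N) ⟩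
    sub (one ⊟ q^ (1 * suc N)) ⊠ sub (fUpTo 1 N)
      ≈⟨ R.*-cong factor (sub-fUpTo N) ⟩
    (one ⊟ q^ (k * suc N)) ⊠ fUpTo k N
      ≈⟨ R.sym (fUpTo-⊠ k N) ⟩
    fUpTo k (suc N) ∎
    where
    open ≈-Reasoning
    minus : ∀ X Y → X ⊟ Y ≈ X ⊞ K (ℤ.- 1ℤ) ⊠ Y
    minus X Y = S.solve 2 (λ x y → x :- y := x :+ con (ℤ.- 1ℤ) :* y) R.refl X Y
    factor : sub (one ⊟ q^ (1 * suc N)) ≈ one ⊟ q^ (k * suc N)
    factor = R.trans (sub-cong (minus one (q^ (1 * suc N))))
      (R.trans (sub-⊞ one (K (ℤ.- 1ℤ) ⊠ q^ (1 * suc N)))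
        (R.trans (R.+-cong (R.trans (sub-q^ 0) (q^-≡ (ℕ.*-zeroʳ k)))
            (R.trans (sub-K⊠ (ℤ.- 1ℤ) (q^ (1 * suc N)))
              (⊠-congˡ (R.trans (sub-q^ (1 * suc N)) (q^-≡ (cong (k *_) (ℕ.*-identityˡ (suc N))))))))
          (R.sym (minus one (q^ (k * suc N))))))

  sub-f : sub (f 1) ≈ f k
  sub-f = multiple-ext
    (λ m → trans (sub-multiple (f 1) m) (trans (sym (f-limit 1 (ℕ.m≤n*m m k)))
      (trans (sym (sub-multiple (fUpTo 1 (k * m)) m)) (at (sub-fUpTo (k * m)) (k * m)))))
    (λ n k∤n → trans (sub-nonmultiple (f 1) k∤n)
      (trans (sym (sub-nonmultiple (fUpTo 1 n) k∤n)) (at (sub-fUpTo n) n)))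

-- Lambert series as logarithmic derivatives

Lam : (ℕ → ℤ) → PowerSeries
Lam μ = Σ∞ (λ m → K (μ m) ⊠ Λ m)

Lam-bounded : (μ : ℕ → ℤ) → Bounded (λ m → K (μ m) ⊠ Λ m)
Lam-bounded μ m = Ord-⊠ʳ (K (μ m)) (Ord-≤ (ℕ.≤-trans ℕ.pred[n]≤n (ℕ.n≤1+n m)) (Ord-Λ m))

Lam-0 : ∀ μ → Lam μ 0 ≡ 0ℤ
Lam-0 μ = Ord-Σ∞ (λ m → Ord-⊠ʳ (K (μ m)) (Ord-≤ (s≤s z≤n) (Ord-Λ m))) 0 (s≤s z≤n)

-- Each factor 1 - q^n has the logarithmic derivative - n q^n / (1 - q^n), which is a term of the
-- Lambert series.
D-fUpTo : ∀ N → D (fUpTo 1 N) ≈ ⊝ (Σ< N (λ m → K (+ suc m) ⊠ Λ m) ⊠ fUpTo 1 N)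
D-fUpTo zero = begin
  D one                   ≈⟨ R.trans (D-cong (pw one≗K)) (D-K 1ℤ) ⟩
  𝟘                       ≈⟨ R.sym (R.trans (R.-‿cong (R.zeroˡ one)) (pw λ n → ⊝-at 𝟘 n)) ⟩
  ⊝ (𝟘 ⊠ one)             ≈⟨ R.-‿cong (⊠-congʳ (R.sym (Σ<-zero (λ m → K (+ suc m) ⊠ Λ m)))) ⟩
  ⊝ (Σ< 0 (λ m → K (+ suc m) ⊠ Λ m) ⊠ one) ∎
  where open ≈-Reasoning
D-fUpTo (suc N) = begin
  D (fUpTo 1 (suc N))
    ≈⟨ R.trans (D-cong product) (D-⊠ (one ⊟ q^ suc N) P) ⟩
  D (one ⊟ q^ suc N) ⊠ P ⊞ (one ⊟ q^ suc N) ⊠ D P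
    ≈⟨ R.+-cong (⊠-congʳ factor) (⊠-congˡ (D-fUpTo N)) ⟩
  ⊝ ((one ⊟ q^ suc N) ⊠ (K (+ suc N) ⊠ Λ N)) ⊠ P ⊞ (one ⊟ q^ suc N) ⊠ ⊝ (L ⊠ P)
    ≈⟨ S.solve 4 (λ x k l p → (:- (x :* k)) :* p :+ x :* (:- (l :* p)) := :- ((l :+ k) :* (x :* p))) R.refl
         (one ⊟ q^ suc N) (K (+ suc N) ⊠ Λ N) L P ⟩
  ⊝ ((L ⊞ K (+ suc N) ⊠ Λ N) ⊠ ((one ⊟ q^ suc N) ⊠ P))
    ≈⟨ R.-‿cong (R.*-cong (R.sym (Σ<-last N (λ m → K (+ suc m) ⊠ Λ m))) (R.sym product)) ⟩
  ⊝ (Σ< (suc N) (λ m → K (+ suc m) ⊠ Λ m) ⊠ fUpTo 1 (suc N)) ∎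
  where
  open ≈-Reasoning
  P L : PowerSeries
  P = fUpTo 1 N
  L = Σ< N (λ m → K (+ suc m) ⊠ Λ m)
  product : fUpTo 1 (suc N) ≈ (one ⊟ q^ suc N) ⊠ P
  product = R.trans (fUpTo-⊠ 1 N) (⊠-congʳ (⊞-congˡ (R.-‿cong (q^-≡ (ℕ.*-identityˡ (suc N))))))
  factor : D (one ⊟ q^ suc N) ≈ ⊝ ((one ⊟ q^ suc N) ⊠ (K (+ suc N) ⊠ Λ N))
  factor = begin
    D (one ⊟ q^ suc N)
      ≈⟨ R.trans (D-⊞ one (⊝ q^ suc N)) (R.+-cong (R.trans (D-cong (pw one≗K)) (D-K 1ℤ))
           (R.trans (D-⊝ (q^ suc N)) (R.-‿cong (D-q^ (suc N))))) ⟩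
    𝟘 ⊞ ⊝ (K (+ suc N) ⊠ q^ suc N)
      ≈⟨ R.+-identityˡ (⊝ (K (+ suc N) ⊠ q^ suc N)) ⟩
    ⊝ (K (+ suc N) ⊠ q^ suc N)
      ≈⟨ S.solve 3 (λ k x l → :- (k :* x) := :- (k :* ((x :+ x :* l) :- x :* l))) R.refl (K (+ suc N)) (q^ suc N) (Λ N) ⟩
    ⊝ (K (+ suc N) ⊠ ((q^ suc N ⊞ q^ suc N ⊠ Λ N) ⊟ q^ suc N ⊠ Λ N))
      ≈⟨ R.-‿cong (⊠-congˡ (⊞-congʳ (R.trans (R.sym (Λ-rec N)) (R.sym (R.*-identityˡ (Λ N)))))) ⟩
    ⊝ (K (+ suc N) ⊠ (one ⊠ Λ N ⊟ q^ suc N ⊠ Λ N))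
      ≈⟨ S.solve 4 (λ k x l o → :- (k :* (o :* l :- x :* l)) := :- ((o :- x) :* (k :* l))) R.refl
           (K (+ suc N)) (q^ suc N) (Λ N) one ⟩
    ⊝ ((one ⊟ q^ suc N) ⊠ (K (+ suc N) ⊠ Λ N)) ∎

D-f : D (f 1) ≈ ⊝ (Lam (λ m → + suc m) ⊠ f 1)
D-f = pw λ n → begin
  D (f 1) n
    ≡⟨ trans (D-at (f 1) n) (trans (cong (+ n ℤ.*_) (sym (f-limit 1 (ℕ.m≤n+m n 2)))) (sym (D-at (fUpTo 1 (2 + n)) n))) ⟩
  D (fUpTo 1 (2 + n)) n
    ≡⟨ trans (at (D-fUpTo (2 + n)) n) (⊝-at (Σ< (2 + n) (λ m → K (+ suc m) ⊠ Λ m) ⊠ fUpTo 1 (2 + n)) n) ⟩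
  ℤ.- (Σ< (2 + n) (λ m → K (+ suc m) ⊠ Λ m) ⊠ fUpTo 1 (2 + n)) n
    ≡⟨ cong ℤ.-_ (⊠-local n (λ i i≤n → Σ∞-stable (Lam-bounded (λ m → + suc m)) i (s≤s (s≤s i≤n)))
         (λ i i≤n → f-limit 1 (ℕ.≤-trans i≤n (ℕ.m≤n+m n 2)))) ⟩
  ℤ.- (Lam (λ m → + suc m) ⊠ f 1) n
    ≡⟨ sym (⊝-at (Lam (λ m → + suc m) ⊠ f 1) n) ⟩
  (⊝ (Lam (λ m → + suc m) ⊠ f 1)) n ∎
  where open ≡-Reasoning

-- As `V 0` vanishes, the equation determines (n + 1) times the coefficient at n + 1 from the lower
-- ones. This identifies products with theta series that have the same logarithmic derivative.
D-unique : ∀ {V X Y} → V 0 ≡ 0ℤ → D X ≈ V ⊠ X → D Y ≈ V ⊠ Y → X 0 ≡ Y 0 → X ≈ Y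
D-unique {V} {X} {Y} V₀ DX DY X₀ = pw λ n → upTo n n ℕ.≤-refl
  where
  coefficient : ∀ Z → D Z ≈ V ⊠ Z → ∀ n → + suc n ℤ.* Z (suc n) ≡ ((V ∘ suc) ⊠ Z) n
  coefficient Z DZ n = begin
    + suc n ℤ.* Z (suc n)                       ≡⟨ sym (D-at Z (suc n)) ⟩
    D Z (suc n)                                 ≡⟨ trans (at DZ (suc n)) (at (⊠-at V Z) (suc n)) ⟩
    V 0 ℤ.* Z (suc n) ℤ.+ ((V ∘ suc) ⊛ Z) n     ≡⟨ cong₂ (λ v r → v ℤ.* Z (suc n) ℤ.+ r) V₀ (sym (at (⊠-at (V ∘ suc) Z) n)) ⟩
    0ℤ ℤ.* Z (suc n) ℤ.+ ((V ∘ suc) ⊠ Z) n      ≡⟨ ℤ.+-identityˡ _ ⟩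
    ((V ∘ suc) ⊠ Z) n                           ∎
    where open ≡-Reasoning
  upTo : ∀ n i → i ≤ n → X i ≡ Y i
  upTo n       zero    _         = X₀
  upTo (suc n) (suc i) (s≤s i≤n) = ℤ.*-cancelˡ-≡ (+ suc i) (X (suc i)) (Y (suc i))
    (trans (coefficient X DX i) (trans
      (⊠-local i (λ _ _ → refl) (λ j j≤i → upTo n j (ℕ.≤-trans j≤i i≤n)))
      (sym (coefficient Y DY i))))

-- `S₍ b ₎` is ∑ σ_b(n) qⁿ. `J₍ b ₎` for odd b and `Ψ₍ b ₎` for even b are halves of sums over all
-- of ℤ; for the other parity the full sums cancel under n ↦ 1 - n. The extra sign in `Ψ₍ b ₎`
-- removes that of `τ`, so `Ψ₍ 0 ₎` is Gauss's series ∑ q^(n(n+1)/2).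
S₍_₎ N₍_₎ J₍_₎ Ψ₍_₎ : ℕ → PowerSeries
S₍ b ₎ = Lam (λ m → (+ suc m) ℤ.^ b)
N₍ b ₎ = Lam (λ m → sgn (suc m) ℤ.* (+ suc m) ℤ.^ b)
J₍ b ₎ = Θ (λ i → y (+ suc i) ℤ.^ b)
Ψ₍ b ₎ = Θ (λ i → sgn (suc i) ℤ.* y (+ suc i) ℤ.^ b)

-- Moment relations between theta series and Lambert series

Pair : (ℕ → ℕ → ℤ) → PowerSeries
Pair h = Σ∞ (λ m → Λ m ⊠ Θ (h m))

Pair-cong : ∀ {h h′} → (∀ m i → h m i ≡ h′ m i) → Pair h ≈ Pair h′
Pair-cong p = Σ∞-cong (λ m → ⊠-congˡ (Θ-cong (p m)))

Pair-+ : ∀ (h h′ : ℕ → ℕ → ℤ) → Pair (λ m i → h m i ℤ.+ h′ m i) ≈ Pair h ⊞ Pair h′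
Pair-+ h h′ = R.trans
  (Σ∞-cong (λ m → R.trans (⊠-congˡ (Θ-+ (h m) (h′ m))) (R.distribˡ (Λ m) (Θ (h m)) (Θ (h′ m)))))
  (Σ∞-⊞ (λ m → Λ m ⊠ Θ (h m)) (λ m → Λ m ⊠ Θ (h′ m)))

Pair-* : ∀ c (v μ : ℕ → ℤ) → Pair (λ m i → c ℤ.* (v i ℤ.* μ m)) ≈ K c ⊠ (Θ v ⊠ Lam μ)
Pair-* c v μ = begin
  Pair (λ m i → c ℤ.* (v i ℤ.* μ m))
    ≈⟨ Σ∞-cong term ⟩
  Σ∞ (λ m → K c ⊠ (Θ v ⊠ (K (μ m) ⊠ Λ m)))
    ≈⟨ Σ∞-K c (λ m → Θ v ⊠ (K (μ m) ⊠ Λ m)) ⟩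
  K c ⊠ Σ∞ (λ m → Θ v ⊠ (K (μ m) ⊠ Λ m))
    ≈⟨ ⊠-congˡ (R.sym (Σ∞-⊠ (Θ v) (Lam-bounded μ))) ⟩
  K c ⊠ (Θ v ⊠ Lam μ) ∎
  where
  open ≈-Reasoning
  reorder : ∀ c v m → c ℤ.* (v ℤ.* m) ≡ c ℤ.* m ℤ.* v
  reorder = solve-∀
  term : ∀ m → Λ m ⊠ Θ (λ i → c ℤ.* (v i ℤ.* μ m)) ≈ K c ⊠ (Θ v ⊠ (K (μ m) ⊠ Λ m))
  term m = R.trans
    (⊠-congˡ (R.trans (Θ-cong (λ i → reorder c (v i) (μ m))) (R.trans (Θ-* (c ℤ.* μ m) v) (⊠-congʳ (K-* c (μ m))))))
    (S.solve 4 (λ l k m t → l :* (k :* m :* t) := k :* (t :* (m :* l))) R.refl (Λ m) (K c) (K (μ m)) (Θ v))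

Pair-derivative : ∀ c (g : ℤ → ℤ) (X : ℕ → ℤ) h → (∀ z → g (1ℤ ℤ.- z) ≡ g z) →
  (∀ i m → g (+ suc i ℤ.+ + suc m) ℤ.- g (+ suc i ℤ.- + suc m) ≡ h m i) →
  (∀ n → c ℤ.* prefix g n ≡ X n ℤ.+ c ℤ.* (+ n ℤ.* g (+ n))) →
  K c ⊠ Pair h ≈ Θ (X ∘ suc)
Pair-derivative c g X h g-sym difference sum = begin
  K c ⊠ Pair h
    ≈⟨ ⊠-congˡ (R.trans (Pair-cong (λ m i → sym (difference i m))) (logarithmic-derivative g g-sym)) ⟩
  K c ⊠ Θ (λ i → prefix g (suc i) ℤ.- + suc i ℤ.* g (+ suc i))
    ≈⟨ R.sym (Θ-* c (λ i → prefix g (suc i) ℤ.- + suc i ℤ.* g (+ suc i))) ⟩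
  Θ (λ i → c ℤ.* (prefix g (suc i) ℤ.- + suc i ℤ.* g (+ suc i)))
    ≈⟨ Θ-cong (λ i → trans (distribute c (prefix g (suc i)) (+ suc i ℤ.* g (+ suc i)))
         (trans (cong (ℤ._- c ℤ.* (+ suc i ℤ.* g (+ suc i))) (sum (suc i))) (cancel (X (suc i)) _))) ⟩
  Θ (X ∘ suc) ∎
  where
  open ≈-Reasoning
  distribute : ∀ c p x → c ℤ.* (p ℤ.- x) ≡ c ℤ.* p ℤ.- c ℤ.* x
  distribute = solve-∀
  cancel : ∀ x y → (x ℤ.+ y) ℤ.- y ≡ x
  cancel = solve-∀

prefix-sum : ∀ c g (P : ℤ → ℤ) → P 0ℤ ≡ 0ℤ → (∀ n → P (+ n) ℤ.+ c ℤ.* g (+ suc n) ≡ P (+ suc n)) →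
             ∀ n → c ℤ.* prefix g n ≡ P (+ n)
prefix-sum c g P P₀ step zero    = trans (ℤ.*-zeroʳ c) (sym P₀)
prefix-sum c g P P₀ step (suc n) = trans (ℤ.*-distribˡ-+ c (prefix g n) (g (+ suc n)))
  (trans (cong (ℤ._+ c ℤ.* g (+ suc n)) (prefix-sum c g P P₀ step n)) (step n))

y-reflect : ∀ z → y (1ℤ ℤ.- z) ≡ ℤ.- y z
y-reflect = reflect
  where
  reflect : ∀ z → + 2 ℤ.* (1ℤ ℤ.- z) ℤ.- 1ℤ ≡ ℤ.- (+ 2 ℤ.* z ℤ.- 1ℤ)
  reflect = solve-∀

neg-^-even : ∀ z b → (ℤ.- z) ℤ.^ (2 * b) ≡ z ℤ.^ (2 * b)
neg-^-even z b = trans (sym (ℤ.^-*-assoc (ℤ.- z) 2 b)) (trans (cong (ℤ._^ b) (square z)) (ℤ.^-*-assoc z 2 b))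
  where
  square : ∀ z → (ℤ.- z) ℤ.^ 2 ≡ z ℤ.^ 2
  square z = sq z
    where
    sq : ∀ z → (ℤ.- z) ℤ.* ((ℤ.- z) ℤ.* 1ℤ) ≡ z ℤ.* (z ℤ.* 1ℤ)
    sq = solve-∀

y^-even-reflect : ∀ b z → y (1ℤ ℤ.- z) ℤ.^ (2 * b) ≡ y z ℤ.^ (2 * b)
y^-even-reflect b z = trans (cong (ℤ._^ (2 * b)) (y-reflect z)) (neg-^-even (y z) b)

-- The weights y², y⁴, y⁶ yield the three relations of this kind. The difference of g at z + m and z
-- - m is odd in m and in y(z), so only odd moments and odd Lambert weights appear.
J-relation₁ : K (+ 3) ⊠ (K (+ 8) ⊠ (J₍ 1 ₎ ⊠ S₍ 1 ₎)) ≈ J₍ 1 ₎ ⊟ J₍ 3 ₎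
J-relation₁ = R.trans (⊠-congˡ (R.sym (Pair-* (+ 8) _ _)))
  (R.trans (Pair-derivative (+ 3) (λ z → y z ℤ.^ 2) (λ n → + 1 ℤ.* y (+ n) ℤ.- + 1 ℤ.* y (+ n) ℤ.^ 3) _
    (y^-even-reflect 1) (λ i m → y²-difference (+ suc i) (+ suc m))
    (prefix-sum (+ 3) (λ z → y z ℤ.^ 2) P₂ refl (λ n → P₂-suc (+ n))))
  (R.trans (Θ-cong (λ i → terms (y (+ suc i)) (y (+ suc i) ℤ.^ 3)))
  (R.trans (Θ-+ _ _) (R.trans (⊞-congˡ (Θ-* (ℤ.- 1ℤ) _))
    (S.solve 2 (λ a b → a :+ con (ℤ.- 1ℤ) :* b := a :- b) R.refl J₍ 1 ₎ J₍ 3 ₎)))))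
  where
  terms : ∀ a b → + 1 ℤ.* a ℤ.- + 1 ℤ.* b ≡ a ℤ.* 1ℤ ℤ.+ ℤ.- 1ℤ ℤ.* b
  terms = solve-∀

J-relation₃ : K (+ 15) ⊠ (K (+ 16) ⊠ (J₍ 3 ₎ ⊠ S₍ 1 ₎) ⊞ K (+ 64) ⊠ (J₍ 1 ₎ ⊠ S₍ 3 ₎)) ≈
  K (ℤ.- + 6) ⊠ J₍ 5 ₎ ⊞ (K (+ 10) ⊠ J₍ 3 ₎ ⊞ K (ℤ.- + 4) ⊠ J₍ 1 ₎)
J-relation₃ = R.trans (⊠-congˡ (R.sym (R.trans (Pair-+ _ _) (R.+-cong (Pair-* (+ 16) _ _) (Pair-* (+ 64) _ _)))))
  (R.trans (Pair-derivative (+ 15) (λ z → y z ℤ.^ 4)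
    (λ n → ℤ.- (+ 6 ℤ.* y (+ n) ℤ.^ 5) ℤ.+ + 10 ℤ.* y (+ n) ℤ.^ 3 ℤ.- + 4 ℤ.* y (+ n)) _
    (y^-even-reflect 2) (λ i m → y⁴-difference (+ suc i) (+ suc m))
    (prefix-sum (+ 15) (λ z → y z ℤ.^ 4) P₄ refl (λ n → P₄-suc (+ n))))
  (R.trans (Θ-cong (λ i → terms (y (+ suc i) ℤ.^ 5) (y (+ suc i) ℤ.^ 3) (y (+ suc i))))
  (R.trans (Θ-+ _ _) (R.+-cong (Θ-* (ℤ.- + 6) _) (R.trans (Θ-+ _ _) (R.+-cong (Θ-* (+ 10) _) (Θ-* (ℤ.- + 4) _)))))))
  where
  terms : ∀ a b c → ℤ.- (+ 6 ℤ.* a) ℤ.+ + 10 ℤ.* b ℤ.- + 4 ℤ.* c ≡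
    ℤ.- + 6 ℤ.* a ℤ.+ (+ 10 ℤ.* b ℤ.+ ℤ.- + 4 ℤ.* (c ℤ.* 1ℤ))
  terms = solve-∀

J-relation₅ : K (+ 21) ⊠ (K (+ 24) ⊠ (J₍ 5 ₎ ⊠ S₍ 1 ₎) ⊞ (K (+ 320) ⊠ (J₍ 3 ₎ ⊠ S₍ 3 ₎) ⊞ K (+ 384) ⊠ (J₍ 1 ₎ ⊠ S₍ 5 ₎))) ≈
  K (ℤ.- + 9) ⊠ J₍ 7 ₎ ⊞ (K (+ 21) ⊠ J₍ 5 ₎ ⊞ (K (ℤ.- + 28) ⊠ J₍ 3 ₎ ⊞ K (+ 16) ⊠ J₍ 1 ₎))
J-relation₅ = R.trans (⊠-congˡ (R.sym (R.trans (Pair-+ _ _) (R.+-cong (Pair-* (+ 24) _ _)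
    (R.trans (Pair-+ _ _) (R.+-cong (Pair-* (+ 320) _ _) (Pair-* (+ 384) _ _)))))))
  (R.trans (Pair-derivative (+ 21) (λ z → y z ℤ.^ 6)
    (λ n → ℤ.- (+ 9 ℤ.* y (+ n) ℤ.^ 7) ℤ.+ + 21 ℤ.* y (+ n) ℤ.^ 5 ℤ.- + 28 ℤ.* y (+ n) ℤ.^ 3 ℤ.+ + 16 ℤ.* y (+ n)) _
    (y^-even-reflect 3) (λ i m → y⁶-difference (+ suc i) (+ suc m))
    (prefix-sum (+ 21) (λ z → y z ℤ.^ 6) P₆ refl (λ n → P₆-suc (+ n))))
  (R.trans (Θ-cong (λ i → terms (y (+ suc i) ℤ.^ 7) (y (+ suc i) ℤ.^ 5) (y (+ suc i) ℤ.^ 3) (y (+ suc i))))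
  (R.trans (Θ-+ _ _) (R.+-cong (Θ-* (ℤ.- + 9) _) (R.trans (Θ-+ _ _) (R.+-cong (Θ-* (+ 21) _)
    (R.trans (Θ-+ _ _) (R.+-cong (Θ-* (ℤ.- + 28) _) (Θ-* (+ 16) _)))))))))
  where
  terms : ∀ a b c d → ℤ.- (+ 9 ℤ.* a) ℤ.+ + 21 ℤ.* b ℤ.- + 28 ℤ.* c ℤ.+ + 16 ℤ.* d ≡
    ℤ.- + 9 ℤ.* a ℤ.+ (+ 21 ℤ.* b ℤ.+ (ℤ.- + 28 ℤ.* c ℤ.+ + 16 ℤ.* (d ℤ.* 1ℤ)))
  terms = solve-∀

-- The alternating weights turn the triple product in z into the one in - z.

sgnℤ : ℤ → ℤ
sgnℤ z = sgn ℤ.∣ z ∣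

sgnℤ-suc : ∀ z → sgnℤ (1ℤ ℤ.+ z) ≡ ℤ.- sgnℤ z
sgnℤ-suc (+ n)            = refl
sgnℤ-suc ℤ.-[1+ zero ]    = refl
sgnℤ-suc ℤ.-[1+ suc n ]   = sym (ℤ.neg-involutive _)

sgnℤ-+ : ∀ z m → sgnℤ (z ℤ.+ + m) ≡ sgnℤ z ℤ.* sgn m
sgnℤ-+ z zero    = trans (cong sgnℤ (ℤ.+-identityʳ z)) (sym (ℤ.*-identityʳ (sgnℤ z)))
sgnℤ-+ z (suc m) = begin
  sgnℤ (z ℤ.+ (1ℤ ℤ.+ + m))  ≡⟨ cong sgnℤ (reorder z (+ m)) ⟩
  sgnℤ (1ℤ ℤ.+ (z ℤ.+ + m))  ≡⟨ sgnℤ-suc (z ℤ.+ + m) ⟩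
  ℤ.- sgnℤ (z ℤ.+ + m)       ≡⟨ cong ℤ.-_ (sgnℤ-+ z m) ⟩
  ℤ.- (sgnℤ z ℤ.* sgn m)     ≡⟨ ℤ.neg-distribʳ-* (sgnℤ z) (sgn m) ⟩
  sgnℤ z ℤ.* sgn (suc m)     ∎
  where
  open ≡-Reasoning
  reorder : ∀ z m → z ℤ.+ (1ℤ ℤ.+ m) ≡ 1ℤ ℤ.+ (z ℤ.+ m)
  reorder = solve-∀

sgnℤ-neg : ∀ z → sgnℤ (ℤ.- z) ≡ sgnℤ z
sgnℤ-neg z = cong sgn (ℤ.∣-i∣≡∣i∣ z)

sgnℤ-∸ : ∀ z m → sgnℤ (z ℤ.- + m) ≡ sgnℤ z ℤ.* sgn m
sgnℤ-∸ z m = begin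
  sgnℤ (z ℤ.- + m)            ≡⟨ cong sgnℤ (reorder z (+ m)) ⟩
  sgnℤ (ℤ.- (ℤ.- z ℤ.+ + m))  ≡⟨ sgnℤ-neg (ℤ.- z ℤ.+ + m) ⟩
  sgnℤ (ℤ.- z ℤ.+ + m)        ≡⟨ sgnℤ-+ (ℤ.- z) m ⟩
  sgnℤ (ℤ.- z) ℤ.* sgn m      ≡⟨ cong (ℤ._* sgn m) (sgnℤ-neg z) ⟩
  sgnℤ z ℤ.* sgn m            ∎
  where
  open ≡-Reasoning
  reorder : ∀ z m → z ℤ.- m ≡ ℤ.- (ℤ.- z ℤ.+ m)
  reorder = solve-∀

sgnℤ-reflect : ∀ z → sgnℤ (1ℤ ℤ.- z) ≡ ℤ.- sgnℤ z
sgnℤ-reflect z = trans (sgnℤ-suc (ℤ.- z)) (cong ℤ.-_ (sgnℤ-neg z))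

-- The power is odd because `sgnℤ` and `y` both change sign under z ↦ 1 - z, and the weight must be
-- invariant.
alternating : ℕ → ℤ → ℤ
alternating b z = sgnℤ z ℤ.* y z ℤ.^ suc (2 * b)

alternating-reflect : ∀ b z → alternating b (1ℤ ℤ.- z) ≡ alternating b z
alternating-reflect b z = begin
  sgnℤ (1ℤ ℤ.- z) ℤ.* (y (1ℤ ℤ.- z) ℤ.* y (1ℤ ℤ.- z) ℤ.^ (2 * b))
    ≡⟨ cong₂ ℤ._*_ (sgnℤ-reflect z) (cong₂ ℤ._*_ (y-reflect z) (y^-even-reflect b z)) ⟩
  ℤ.- sgnℤ z ℤ.* (ℤ.- y z ℤ.* y z ℤ.^ (2 * b))
    ≡⟨ negate-twice (sgnℤ z) (y z) (y z ℤ.^ (2 * b)) ⟩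
  alternating b z ∎
  where
  open ≡-Reasoning
  negate-twice : ∀ s y e → ℤ.- s ℤ.* (ℤ.- y ℤ.* e) ≡ s ℤ.* (y ℤ.* e)
  negate-twice = solve-∀

alternating-difference : ∀ b i m → alternating b (+ suc i ℤ.+ + suc m) ℤ.- alternating b (+ suc i ℤ.- + suc m) ≡
  sgn (suc i) ℤ.* sgn (suc m) ℤ.* y (+ suc i ℤ.+ + suc m) ℤ.^ suc (2 * b) ℤ.-
  sgn (suc i) ℤ.* sgn (suc m) ℤ.* y (+ suc i ℤ.- + suc m) ℤ.^ suc (2 * b)
alternating-difference b i m = cong₂ ℤ._-_
  (cong (ℤ._* y (+ suc i ℤ.+ + suc m) ℤ.^ suc (2 * b)) (sgnℤ-+ (+ suc i) (suc m)))
  (cong (ℤ._* y (+ suc i ℤ.- + suc m) ℤ.^ suc (2 * b)) (sgnℤ-∸ (+ suc i) (suc m)))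

Ψ-relation₁ : K (+ 2) ⊠ (K (+ 4) ⊠ (Ψ₍ 0 ₎ ⊠ N₍ 1 ₎)) ≈ Ψ₍ 0 ₎ ⊟ Ψ₍ 2 ₎
Ψ-relation₁ = R.trans (⊠-congˡ (R.sym (Pair-* (+ 4) _ _)))
  (R.trans (Pair-derivative (+ 2) (alternating 0) (λ n → sgn n ℤ.* (1ℤ ℤ.- y (+ n) ℤ.^ 2)) _
    (alternating-reflect 0)
    (λ i m → trans (alternating-difference 0 i m)
      (trans (cong₂ ℤ._-_ (cong (sgn (suc i) ℤ.* sgn (suc m) ℤ.*_) (ℤ.*-identityʳ _)) (cong (sgn (suc i) ℤ.* sgn (suc m) ℤ.*_) (ℤ.*-identityʳ _)))
        (y-difference (sgn (suc i)) (sgn (suc m)) (+ suc i) (+ suc m))))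
    (λ n → trans (prefix-sum (+ 2) (alternating 0) (λ z → sgnℤ z ℤ.* A₁ z) refl
        (λ n → trans (cong (λ v → sgn n ℤ.* A₁ (+ n) ℤ.+ + 2 ℤ.* (ℤ.- sgn n ℤ.* v)) (ℤ.*-identityʳ _)) (A₁-suc (sgn n) (+ n))) n)
      (sum (sgn n) (+ n) (y (+ n) ℤ.^ 2) (y (+ n)))))
  (R.trans (Θ-cong (λ i → terms (sgn (suc i)) (y (+ suc i) ℤ.^ 2)))
  (R.trans (Θ-+ _ _) (R.trans (⊞-congˡ (Θ-* (ℤ.- 1ℤ) _))
    (S.solve 2 (λ a b → a :+ con (ℤ.- 1ℤ) :* b := a :- b) R.refl Ψ₍ 0 ₎ Ψ₍ 2 ₎)))))
  where
  sum : ∀ s n e y → s ℤ.* (1ℤ ℤ.- e ℤ.+ + 2 ℤ.* (n ℤ.* y)) ≡ s ℤ.* (1ℤ ℤ.- e) ℤ.+ + 2 ℤ.* (n ℤ.* (s ℤ.* (y ℤ.* 1ℤ)))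
  sum = solve-∀
  terms : ∀ s e → s ℤ.* (1ℤ ℤ.- e) ≡ s ℤ.* 1ℤ ℤ.+ ℤ.- 1ℤ ℤ.* (s ℤ.* e)
  terms = solve-∀

Ψ-relation₃ : K (+ 2) ⊠ (K (+ 12) ⊠ (Ψ₍ 2 ₎ ⊠ N₍ 1 ₎) ⊞ K (+ 16) ⊠ (Ψ₍ 0 ₎ ⊠ N₍ 3 ₎)) ≈
  K (+ 3) ⊠ Ψ₍ 2 ₎ ⊞ (K (ℤ.- + 2) ⊠ Ψ₍ 0 ₎ ⊞ K (ℤ.- 1ℤ) ⊠ Ψ₍ 4 ₎)
Ψ-relation₃ = R.trans (⊠-congˡ (R.sym (R.trans (Pair-+ _ _) (R.+-cong (Pair-* (+ 12) _ _) (Pair-* (+ 16) _ _)))))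
  (R.trans (Pair-derivative (+ 2) (alternating 1)
    (λ n → sgn n ℤ.* (+ 3 ℤ.* y (+ n) ℤ.^ 2 ℤ.- + 2 ℤ.- y (+ n) ℤ.^ 4)) _
    (alternating-reflect 1)
    (λ i m → trans (alternating-difference 1 i m) (y³-difference (sgn (suc i)) (sgn (suc m)) (+ suc i) (+ suc m)))
    (λ n → trans (prefix-sum (+ 2) (alternating 1) (λ z → sgnℤ z ℤ.* A₃ z) refl (λ n → A₃-suc (sgn n) (+ n)) n)
      (sum (sgn n) (+ n) (+ 3 ℤ.* y (+ n) ℤ.^ 2 ℤ.- + 2 ℤ.- y (+ n) ℤ.^ 4) (y (+ n) ℤ.^ 3))))
  (R.trans (Θ-cong (λ i → terms (sgn (suc i)) (y (+ suc i) ℤ.^ 2) (y (+ suc i) ℤ.^ 4)))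
  (R.trans (Θ-+ _ _) (R.+-cong (Θ-* (+ 3) _) (R.trans (Θ-+ _ _) (R.+-cong (Θ-* (ℤ.- + 2) _) (Θ-* (ℤ.- 1ℤ) _)))))))
  where
  sum : ∀ s n e y → s ℤ.* (e ℤ.+ + 2 ℤ.* (n ℤ.* y)) ≡ s ℤ.* e ℤ.+ + 2 ℤ.* (n ℤ.* (s ℤ.* y))
  sum = solve-∀
  terms : ∀ s a b → s ℤ.* (+ 3 ℤ.* a ℤ.- + 2 ℤ.- b) ≡
    + 3 ℤ.* (s ℤ.* a) ℤ.+ (ℤ.- + 2 ℤ.* (s ℤ.* 1ℤ) ℤ.+ ℤ.- 1ℤ ℤ.* (s ℤ.* b))
  terms = solve-∀

Ψ-relation₅ : K (+ 2) ⊠ (K (+ 20) ⊠ (Ψ₍ 4 ₎ ⊠ N₍ 1 ₎) ⊞ (K (+ 160) ⊠ (Ψ₍ 2 ₎ ⊠ N₍ 3 ₎) ⊞ K (+ 64) ⊠ (Ψ₍ 0 ₎ ⊠ N₍ 5 ₎))) ≈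
  K (ℤ.- 1ℤ) ⊠ Ψ₍ 6 ₎ ⊞ (K (+ 5) ⊠ Ψ₍ 4 ₎ ⊞ (K (ℤ.- + 20) ⊠ Ψ₍ 2 ₎ ⊞ K (+ 16) ⊠ Ψ₍ 0 ₎))
Ψ-relation₅ = R.trans (⊠-congˡ (R.sym (R.trans (Pair-+ _ _) (R.+-cong (Pair-* (+ 20) _ _)
    (R.trans (Pair-+ _ _) (R.+-cong (Pair-* (+ 160) _ _) (Pair-* (+ 64) _ _)))))))
  (R.trans (Pair-derivative (+ 2) (alternating 2)
    (λ n → sgn n ℤ.* (ℤ.- y (+ n) ℤ.^ 6 ℤ.+ + 5 ℤ.* y (+ n) ℤ.^ 4 ℤ.- + 20 ℤ.* y (+ n) ℤ.^ 2 ℤ.+ + 16)) _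
    (alternating-reflect 2)
    (λ i m → trans (alternating-difference 2 i m) (y⁵-difference (sgn (suc i)) (sgn (suc m)) (+ suc i) (+ suc m)))
    (λ n → trans (prefix-sum (+ 2) (alternating 2) (λ z → sgnℤ z ℤ.* A₅ z) refl (λ n → A₅-suc (sgn n) (+ n)) n)
      (sum (sgn n) (+ n) (ℤ.- y (+ n) ℤ.^ 6 ℤ.+ + 5 ℤ.* y (+ n) ℤ.^ 4 ℤ.- + 20 ℤ.* y (+ n) ℤ.^ 2 ℤ.+ + 16) (y (+ n) ℤ.^ 5))))
  (R.trans (Θ-cong (λ i → terms (sgn (suc i)) (y (+ suc i) ℤ.^ 6) (y (+ suc i) ℤ.^ 4) (y (+ suc i) ℤ.^ 2)))
  (R.trans (Θ-+ _ _) (R.+-cong (Θ-* (ℤ.- 1ℤ) _) (R.trans (Θ-+ _ _) (R.+-cong (Θ-* (+ 5) _)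
    (R.trans (Θ-+ _ _) (R.+-cong (Θ-* (ℤ.- + 20) _) (Θ-* (+ 16) _)))))))))
  where
  sum : ∀ s n e y → s ℤ.* (e ℤ.+ + 2 ℤ.* (n ℤ.* y)) ≡ s ℤ.* e ℤ.+ + 2 ℤ.* (n ℤ.* (s ℤ.* y))
  sum = solve-∀
  terms : ∀ s a b c → s ℤ.* (ℤ.- a ℤ.+ + 5 ℤ.* b ℤ.- + 20 ℤ.* c ℤ.+ + 16) ≡
    ℤ.- 1ℤ ℤ.* (s ℤ.* a) ℤ.+ (+ 5 ℤ.* (s ℤ.* b) ℤ.+ (ℤ.- + 20 ℤ.* (s ℤ.* c) ℤ.+ + 16 ℤ.* (s ℤ.* 1ℤ)))
  terms = solve-∀

-- The heat equation

heat-weight : ∀ i → + 8 ℤ.* + tri (suc i) ℤ.+ 1ℤ ≡ y (+ suc i) ℤ.* y (+ suc i)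
heat-weight zero    = refl
heat-weight (suc i) = begin
  + 8 ℤ.* (1ℤ ℤ.+ + i ℤ.+ + tri (suc i)) ℤ.+ 1ℤ            ≡⟨ split (+ i) (+ tri (suc i)) ⟩
  + 8 ℤ.* (1ℤ ℤ.+ + i) ℤ.+ (+ 8 ℤ.* + tri (suc i) ℤ.+ 1ℤ)  ≡⟨ cong (ℤ._+_ (+ 8 ℤ.* (1ℤ ℤ.+ + i))) (heat-weight i) ⟩
  + 8 ℤ.* (1ℤ ℤ.+ + i) ℤ.+ y (+ suc i) ℤ.* y (+ suc i)    ≡⟨ join (+ i) ⟩
  y (+ suc (suc i)) ℤ.* y (+ suc (suc i))                   ∎
  where
  open ≡-Reasoning
  split : ∀ i t → + 8 ℤ.* (1ℤ ℤ.+ i ℤ.+ t) ℤ.+ 1ℤ ≡ + 8 ℤ.* (1ℤ ℤ.+ i) ℤ.+ (+ 8 ℤ.* t ℤ.+ 1ℤ)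
  split = solve-∀
  join : ∀ i → + 8 ℤ.* (1ℤ ℤ.+ i) ℤ.+ (+ 2 ℤ.* (1ℤ ℤ.+ i) ℤ.- 1ℤ) ℤ.* (+ 2 ℤ.* (1ℤ ℤ.+ i) ℤ.- 1ℤ) ≡
    (+ 2 ℤ.* (1ℤ ℤ.+ (1ℤ ℤ.+ i)) ℤ.- 1ℤ) ℤ.* (+ 2 ℤ.* (1ℤ ℤ.+ (1ℤ ℤ.+ i)) ℤ.- 1ℤ)
  join = solve-∀

D-monomial : ∀ c e → D (K c ⊠ q^ e) ≈ K (+ e) ⊠ (K c ⊠ q^ e)
D-monomial c e = R.trans (D-K⊠ c (q^ e)) (R.trans (⊠-congˡ (D-q^ e))
  (S.solve 3 (λ c e x → c :* (e :* x) := e :* (c :* x)) R.refl (K c) (K (+ e)) (q^ e)))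

D-Θ : ∀ w → D (Θ w) ≈ Θ (λ i → + tri (suc i) ℤ.* w i)
D-Θ w = R.trans (D-Σ∞ (λ i → K (w i) ⊠ τ (suc i))) (Σ∞-cong (λ i → R.trans (D-K⊠ (w i) (τ (suc i)))
  (R.trans (⊠-congˡ (D-monomial (sgn (suc i)) (tri (suc i))))
    (R.trans (S.solve 3 (λ w t x → w :* (t :* x) := (t :* w) :* x) R.refl (K (w i)) (K (+ tri (suc i))) (τ (suc i)))
      (⊠-congʳ (R.sym (K-* (+ tri (suc i)) (w i))))))))

-- The exponent n(n-1)/2 of τₙ is (y² - 1)/8 with y = 2n - 1, so 8 q d/dq + 1 raises the moment by
-- two.
heat : ∀ w → K (+ 8) ⊠ D (Θ w) ⊞ Θ w ≈ Θ (λ i → y (+ suc i) ℤ.* (y (+ suc i) ℤ.* w i))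
heat w = R.trans (⊞-congʳ (R.trans (⊠-congˡ (D-Θ w)) (R.sym (Θ-* (+ 8) (λ i → + tri (suc i) ℤ.* w i)))))
  (R.trans (R.sym (Θ-+ (λ i → + 8 ℤ.* (+ tri (suc i) ℤ.* w i)) w))
    (Θ-cong (λ i → trans (factor (+ tri (suc i)) (w i)) (trans (cong (ℤ._* w i) (heat-weight i)) (ℤ.*-assoc (y (+ suc i)) (y (+ suc i)) (w i))))))
  where
  factor : ∀ t w → + 8 ℤ.* (t ℤ.* w) ℤ.+ w ≡ (+ 8 ℤ.* t ℤ.+ 1ℤ) ℤ.* w
  factor = solve-∀

heat-J : ∀ b → K (+ 8) ⊠ D J₍ b ₎ ⊞ J₍ b ₎ ≈ J₍ 2 + b ₎
heat-J b = heat (λ i → y (+ suc i) ℤ.^ b)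

heat-Ψ : ∀ b → K (+ 8) ⊠ D Ψ₍ b ₎ ⊞ Ψ₍ b ₎ ≈ Ψ₍ 2 + b ₎
heat-Ψ b = R.trans (heat (λ i → sgn (suc i) ℤ.* y (+ suc i) ℤ.^ b))
  (Θ-cong (λ i → reorder (sgn (suc i)) (y (+ suc i)) (y (+ suc i) ℤ.^ b)))
  where
  reorder : ∀ s y e → y ℤ.* (y ℤ.* (s ℤ.* e)) ≡ s ℤ.* (y ℤ.* (y ℤ.* e))
  reorder = solve-∀

-- The values of n(3n + 1)/2 at n = k and at n = - k - 1, given by their increments.
pent pent′ : ℕ → ℕ
pent zero    = 0
pent (suc k) = pent k + (3 * k + 2)
pent′ k = pent k + (2 * k + 1)

-- Shanks' finite form of the pentagonal number theorem: the terms α j d with j + d = n sum to a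
-- truncation of the pentagonal series, since passing from n to n + 1 telescopes through γ.
module _ where
  -- The quotient of q-factorials in Shanks' formula, written as the product of 1 - q^i over j < i ≤
  -- j + d.
  ∏ : ℕ → ℕ → PowerSeries
  ∏ zero    j = one
  ∏ (suc d) j = (one ⊟ q^ (j + suc d)) ⊠ ∏ d j

  ∏-left : ∀ d j → ∏ (suc d) j ≈ (one ⊟ q^ suc j) ⊠ ∏ d (suc j)
  ∏-left zero    j = ⊠-congʳ (⊞-congˡ (R.-‿cong (q^-≡ (ℕ.+-comm j 1))))
  ∏-left (suc d) j = R.trans (⊠-congˡ (∏-left d j))
    (R.trans (S.solve 3 (λ x y z → x :* (y :* z) := y :* (x :* z)) R.refl
               (one ⊟ q^ (j + suc (suc d))) (one ⊟ q^ suc j) (∏ d (suc j)))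
      (⊠-congˡ (⊠-congʳ (⊞-congˡ (R.-‿cong (q^-≡ (ℕ.+-suc j (suc d))))))))

  ∏-fUpTo : ∀ n → ∏ n 0 ≈ fUpTo 1 n
  ∏-fUpTo zero    = R.refl
  ∏-fUpTo (suc n) = R.sym (R.trans (fUpTo-⊠ 1 n)
    (R.*-cong (⊞-congˡ (R.-‿cong (q^-≡ (ℕ.*-identityˡ (suc n))))) (R.sym (∏-fUpTo n))))

  α γ : ℕ → ℕ → PowerSeries
  α j d = K (sgn j) ⊠ q^ (j * (j + d) + tri (suc j)) ⊠ ∏ d j
  γ j d = ⊝ (K (sgn j) ⊠ q^ (suc j * suc (j + d) + tri (suc j)) ⊠ ∏ d j)

  telescope : ∀ j d → γ j (suc d) ⊞ α (suc j) (suc d) ≈ α (suc j) d ⊞ γ (suc j) d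
  telescope j d = begin
    γ j (suc d) ⊞ α (suc j) (suc d)
      ≈⟨ R.+-cong
           (R.-‿cong (R.*-cong (⊠-congˡ (q^-≡ (e₁ j d (tri (suc j))))) (∏-left d j)))
           (⊠-congʳ (⊠-congˡ (R.trans (q^-≡ (e₂ j d (tri (2 + j)))) (R.sym (q^-+ E (suc j)))))) ⟩
    ⊝ (K (sgn j) ⊠ q^ E ⊠ ((one ⊟ q^ suc j) ⊠ ∏ d (suc j))) ⊞
      K (sgn (suc j)) ⊠ (q^ E ⊠ q^ suc j) ⊠ ((one ⊟ q^ (suc j + suc d)) ⊠ ∏ d (suc j))
      ≈⟨ ⊞-congʳ (R.trans (S.solve 3 (λ k x p → :- (k :* x :* p) := (:- k) :* x :* p) R.refl
           (K (sgn j)) (q^ E) ((one ⊟ q^ suc j) ⊠ ∏ d (suc j))) (⊠-congʳ (⊠-congʳ (R.sym (K-neg (sgn j)))))) ⟩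
    K (sgn (suc j)) ⊠ q^ E ⊠ ((one ⊟ q^ suc j) ⊠ ∏ d (suc j)) ⊞
      K (sgn (suc j)) ⊠ (q^ E ⊠ q^ suc j) ⊠ ((one ⊟ q^ (suc j + suc d)) ⊠ ∏ d (suc j))
      ≈⟨ ⊞-congˡ (⊠-congˡ (R.trans (R.distribʳ (∏ d (suc j)) one (⊝ q^ (suc j + suc d)))
           (⊞-congʳ (R.*-identityˡ (∏ d (suc j)))))) ⟩
    K (sgn (suc j)) ⊠ q^ E ⊠ ((one ⊟ q^ suc j) ⊠ ∏ d (suc j)) ⊞
      K (sgn (suc j)) ⊠ (q^ E ⊠ q^ suc j) ⊠ (∏ d (suc j) ⊞ ⊝ q^ (suc j + suc d) ⊠ ∏ d (suc j))
      ≈⟨ ⊞-congʳ (⊠-congˡ (R.trans (R.distribʳ (∏ d (suc j)) one (⊝ q^ suc j))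
           (⊞-congʳ (R.*-identityˡ (∏ d (suc j)))))) ⟩
    K (sgn (suc j)) ⊠ q^ E ⊠ (∏ d (suc j) ⊞ ⊝ q^ suc j ⊠ ∏ d (suc j)) ⊞
      K (sgn (suc j)) ⊠ (q^ E ⊠ q^ suc j) ⊠ (∏ d (suc j) ⊞ ⊝ q^ (suc j + suc d) ⊠ ∏ d (suc j))
      ≈⟨ S.solve 5 (λ k x a b p → k :* x :* (p :+ (:- a) :* p) :+ k :* (x :* a) :* (p :+ (:- b) :* p) :=
           k :* x :* p :+ :- (k :* (x :* (a :* b)) :* p)) R.refl
           (K (sgn (suc j))) (q^ E) (q^ suc j) (q^ (suc j + suc d)) (∏ d (suc j)) ⟩
    α (suc j) d ⊞ ⊝ (K (sgn (suc j)) ⊠ (q^ E ⊠ (q^ suc j ⊠ q^ (suc j + suc d))) ⊠ ∏ d (suc j))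
      ≈⟨ ⊞-congˡ (R.-‿cong (⊠-congʳ (⊠-congˡ (R.trans (⊠-congˡ (q^-+ (suc j) (suc j + suc d)))
           (R.trans (q^-+ E (suc j + (suc j + suc d))) (q^-≡ (e₃ j d (tri (2 + j))))))))) ⟩
    α (suc j) d ⊞ γ (suc j) d ∎
    where
    open ≈-Reasoning
    E : ℕ
    E = suc j * (suc j + d) + tri (2 + j)
    e₁ : ∀ j d t → suc j * suc (j + suc d) + t ≡ suc j * (suc j + d) + (suc j + t)
    e₁ = ℕ-ring.solve-∀
    e₂ : ∀ j d t → suc j * (suc j + suc d) + t ≡ suc j * (suc j + d) + t + suc j
    e₂ = ℕ-ring.solve-∀
    e₃ : ∀ j d t → suc j * (suc j + d) + t + (suc j + (suc j + suc d)) ≡ suc (suc j) * suc (suc j + d) + t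
    e₃ = ℕ-ring.solve-∀

  Sₙ : ℕ → PowerSeries
  Sₙ n = Σ< (suc n) (λ j → α j (n ∸ j))

  partial : ∀ j n → j ≤ n →
            Σ< (suc j) (λ i → α i (suc n ∸ i)) ≈ Σ< (suc j) (λ i → α i (n ∸ i)) ⊞ γ j (n ∸ j)
  partial zero n _ = begin
    Σ< 1 (λ i → α i (suc n ∸ i))
      ≈⟨ single (λ i → α i (suc n ∸ i)) ⟩
    α 0 (suc n)
      ≈⟨ R.trans (⊠-congˡ (R.distribʳ (∏ n 0) one (⊝ q^ suc n))) (R.trans
           (⊠-congˡ (⊞-congʳ (R.*-identityˡ (∏ n 0))))
           (S.solve 4 (λ k x a p → k :* x :* (p :+ (:- a) :* p) := k :* x :* p :+ :- (k :* (x :* a) :* p)) R.refl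
             (K 1ℤ) (q^ 0) (q^ suc n) (∏ n 0))) ⟩
    α 0 n ⊞ ⊝ (K 1ℤ ⊠ (q^ 0 ⊠ q^ suc n) ⊠ ∏ n 0)
      ≈⟨ R.+-cong (R.sym (single (λ i → α i (n ∸ i))))
           (R.-‿cong (⊠-congʳ (⊠-congˡ (R.trans (q^-+ 0 (suc n)) (q^-≡ (e n)))))) ⟩
    Σ< 1 (λ i → α i (n ∸ i)) ⊞ γ 0 n ∎
    where
    open ≈-Reasoning
    single : ∀ F → Σ< 1 F ≈ F 0
    single F = R.trans (Σ<-last 0 F) (R.trans (⊞-congʳ (Σ<-zero F)) (R.+-identityˡ (F 0)))
    e : ∀ n → suc n ≡ 1 * suc n + 0
    e = ℕ-ring.solve-∀
  partial (suc j) n j<n = begin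
    Σ< (2 + j) (λ i → α i (suc n ∸ i))
      ≈⟨ Σ<-last (suc j) (λ i → α i (suc n ∸ i)) ⟩
    Σ< (suc j) (λ i → α i (suc n ∸ i)) ⊞ α (suc j) (n ∸ j)
      ≈⟨ R.+-cong (partial j n (ℕ.<⇒≤ j<n)) (R.reflexive (cong (α (suc j)) n∸j)) ⟩
    (Σ< (suc j) (λ i → α i (n ∸ i)) ⊞ γ j (n ∸ j)) ⊞ α (suc j) (suc d)
      ≈⟨ R.trans (R.+-assoc (Σ< (suc j) (λ i → α i (n ∸ i))) (γ j (n ∸ j)) (α (suc j) (suc d)))
           (⊞-congˡ (R.trans (⊞-congʳ (R.reflexive (cong (γ j) n∸j))) (telescope j d))) ⟩
    Σ< (suc j) (λ i → α i (n ∸ i)) ⊞ (α (suc j) d ⊞ γ (suc j) d)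
      ≈⟨ R.trans (R.sym (R.+-assoc (Σ< (suc j) (λ i → α i (n ∸ i))) (α (suc j) d) (γ (suc j) d)))
           (⊞-congʳ (R.sym (Σ<-last (suc j) (λ i → α i (n ∸ i))))) ⟩
    Σ< (2 + j) (λ i → α i (n ∸ i)) ⊞ γ (suc j) d ∎
    where
    open ≈-Reasoning
    d : ℕ
    d = n ∸ suc j
    n∸j : n ∸ j ≡ suc d
    n∸j = ℕ.+-∸-assoc 1 j<n

  pent-closed : ∀ n → pent n + n * n ≡ n * (n + n) + tri (suc n)
  pent-closed zero    = refl
  pent-closed (suc n) = trans (e₁ n (pent n)) (trans (cong (_+ (5 * n + 3)) (pent-closed n)) (e₂ n (tri (suc n))))
    where
    e₁ : ∀ n p → p + (3 * n + 2) + suc n * suc n ≡ (p + n * n) + (5 * n + 3)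
    e₁ = ℕ-ring.solve-∀
    e₂ : ∀ n t → n * (n + n) + t + (5 * n + 3) ≡ suc n * (suc n + suc n) + (suc n + t)
    e₂ = ℕ-ring.solve-∀

  pent-exponent : ∀ n → suc n * (suc n + 0) + tri (2 + n) ≡ pent (suc n)
  pent-exponent n = ℕ.+-cancelʳ-≡ (suc n * suc n) _ _ (trans (e n (tri (2 + n))) (sym (pent-closed (suc n))))
    where
    e : ∀ n t → suc n * (suc n + 0) + t + suc n * suc n ≡ suc n * (suc n + suc n) + t
    e = ℕ-ring.solve-∀

  pent′-exponent : ∀ n → suc n * suc (n + 0) + tri (suc n) ≡ pent′ n
  pent′-exponent n = ℕ.+-cancelʳ-≡ (n * n) _ _ (trans (e₁ n (tri (suc n)))
    (trans (cong (_+ (2 * n + 1)) (sym (pent-closed n))) (e₂ n (pent n))))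
    where
    e₁ : ∀ n t → suc n * suc (n + 0) + t + n * n ≡ n * (n + n) + t + (2 * n + 1)
    e₁ = ℕ-ring.solve-∀
    e₂ : ∀ n p → p + n * n + (2 * n + 1) ≡ p + (2 * n + 1) + n * n
    e₂ = ℕ-ring.solve-∀

pentagonal-term : ℕ → PowerSeries
pentagonal-term n = K (sgn (suc n)) ⊠ (q^ pent′ n ⊞ q^ pent (suc n))

Sₙ-suc : ∀ n → Sₙ (suc n) ≈ Sₙ n ⊞ pentagonal-term n
Sₙ-suc n = begin
  Sₙ (suc n)
    ≈⟨ Σ<-last (suc n) (λ j → α j (suc n ∸ j)) ⟩
  Σ< (suc n) (λ j → α j (suc n ∸ j)) ⊞ α (suc n) (n ∸ n)
    ≈⟨ ⊞-congʳ (partial n n ℕ.≤-refl) ⟩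
  (Sₙ n ⊞ γ n (n ∸ n)) ⊞ α (suc n) (n ∸ n)
    ≈⟨ R.+-cong (⊞-congˡ (R.reflexive (cong (γ n) (ℕ.n∸n≡0 n)))) (R.reflexive (cong (α (suc n)) (ℕ.n∸n≡0 n))) ⟩
  (Sₙ n ⊞ γ n 0) ⊞ α (suc n) 0
    ≈⟨ R.+-cong (⊞-congˡ (R.-‿cong (R.trans (⊠-congʳ (⊠-congˡ (q^-≡ (pent′-exponent n))))
           (R.*-identityʳ (K (sgn n) ⊠ q^ pent′ n)))))
         (R.trans (⊠-congʳ (⊠-congˡ (q^-≡ (pent-exponent n)))) (R.*-identityʳ (K (sgn (suc n)) ⊠ q^ pent (suc n)))) ⟩
  (Sₙ n ⊟ K (sgn n) ⊠ q^ pent′ n) ⊞ K (sgn (suc n)) ⊠ q^ pent (suc n)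
    ≈⟨ R.trans (R.+-assoc (Sₙ n) (⊝ (K (sgn n) ⊠ q^ pent′ n)) (K (sgn (suc n)) ⊠ q^ pent (suc n)))
         (⊞-congˡ (R.trans (⊞-congʳ (R.trans (S.solve 2 (λ k x → :- (k :* x) := (:- k) :* x) R.refl (K (sgn n)) (q^ pent′ n))
             (⊠-congʳ (R.sym (K-neg (sgn n))))))
           (R.sym (R.distribˡ (K (sgn (suc n))) (q^ pent′ n) (q^ pent (suc n)))))) ⟩
  Sₙ n ⊞ pentagonal-term n ∎
  where open ≈-Reasoning

Sₙ-closed : ∀ n → Sₙ n ≈ one ⊞ Σ< n pentagonal-term
Sₙ-closed zero = begin
  Sₙ 0
    ≈⟨ R.trans (Σ<-last 0 (λ j → α j (0 ∸ j))) (R.+-cong (Σ<-zero (λ j → α j (0 ∸ j)))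
         (R.trans (R.*-identityʳ (K 1ℤ ⊠ q^ 0)) (S.solve 1 (λ x → # 1 :* x := x) R.refl (q^ 0)))) ⟩
  𝟘 ⊞ one
    ≈⟨ R.trans (R.+-comm 𝟘 one) (⊞-congˡ (R.sym (Σ<-zero pentagonal-term))) ⟩
  one ⊞ Σ< 0 pentagonal-term ∎
  where open ≈-Reasoning
Sₙ-closed (suc n) = begin
  Sₙ (suc n)                                           ≈⟨ Sₙ-suc n ⟩
  Sₙ n ⊞ pentagonal-term n                             ≈⟨ ⊞-congʳ (Sₙ-closed n) ⟩
  (one ⊞ Σ< n pentagonal-term) ⊞ pentagonal-term n     ≈⟨ R.+-assoc one (Σ< n pentagonal-term) (pentagonal-term n) ⟩
  one ⊞ (Σ< n pentagonal-term ⊞ pentagonal-term n)     ≈⟨ ⊞-congˡ (R.sym (Σ<-last n pentagonal-term)) ⟩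
  one ⊞ Σ< (suc n) pentagonal-term                     ∎
  where open ≈-Reasoning

-- Every term `α j` with j > 0 has order above n, and the term j = 0 is the truncated product.
Sₙ-limit : ∀ n → Sₙ (2 + n) n ≡ f 1 n
Sₙ-limit n = begin
  Sₙ (2 + n) n
    ≡⟨ at (Σ<-suc (2 + n) (λ j → α j (2 + n ∸ j))) n ⟩
  (α 0 (2 + n) ⊞ Σ< (2 + n) rest) n
    ≡⟨ trans (⊞-at (α 0 (2 + n)) (Σ< (2 + n) rest) n) (cong₂ ℤ._+_ (trans (at head n) (f-limit 1 (ℕ.m≤n+m n 2))) tail) ⟩
  f 1 n ℤ.+ 0ℤ
    ≡⟨ ℤ.+-identityʳ (f 1 n) ⟩
  f 1 n ∎
  where
  open ≡-Reasoning
  rest : ℕ → PowerSeries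
  rest j = α (suc j) (suc n ∸ j)
  head : α 0 (2 + n) ≈ fUpTo 1 (2 + n)
  head = R.trans (⊠-congʳ (S.solve 1 (λ x → # 1 :* x := x) R.refl (q^ 0)))
    (R.trans (R.*-identityˡ (∏ (2 + n) 0)) (∏-fUpTo (2 + n)))
  tail : Σ< (2 + n) rest n ≡ 0ℤ
  tail = trans (Σ<-local-< n (2 + n) rest (λ j j<2+n →
      Ord-≈ (R.*-comm (∏ (suc n ∸ j) (suc j)) (K (sgn (suc j)) ⊠ q^ (suc j * (suc j + (suc n ∸ j)) + tri (2 + j))))
        (Ord-⊠ʳ (∏ (suc n ∸ j) (suc j)) (Ord-⊠ʳ (K (sgn (suc j))) (Ord-q^ (big j (ℕ.≤-pred j<2+n))))) n ℕ.≤-refl))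
      (at (Σ<-𝟘 (2 + n)) n)
    where
    big : ∀ j → j ≤ suc n → suc n ≤ suc j * (suc j + (suc n ∸ j)) + tri (2 + j)
    big j j≤ = ℕ.≤-trans (ℕ.≤-trans (ℕ.≤-reflexive (sym (ℕ.m+[n∸m]≡n j≤))) (ℕ.n≤1+n _))
      (ℕ.≤-trans (ℕ.m≤n*m (suc j + (suc n ∸ j)) (suc j)) (ℕ.m≤m+n _ (tri (2 + j))))
    Σ<-local-< : ∀ n M F → (∀ j → j < M → F j n ≡ 0ℤ) → Σ< M F n ≡ Σ< M (λ _ → 𝟘) n
    Σ<-local-< n zero    F p = trans (at (Σ<-zero F) n) (sym (at (Σ<-zero (λ _ → 𝟘)) n))
    Σ<-local-< n (suc M) F p = trans (trans (at (Σ<-last M F) n) (⊞-at (Σ< M F) (F M) n))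
      (trans (cong₂ ℤ._+_ (Σ<-local-< n M F (λ j j<M → p j (ℕ.m<n⇒m<1+n j<M))) (p M ℕ.≤-refl))
        (sym (trans (at (Σ<-last M (λ _ → 𝟘)) n) (⊞-at (Σ< M (λ _ → 𝟘)) 𝟘 n))))

k≤pent : ∀ k → k ≤ pent k
k≤pent zero    = z≤n
k≤pent (suc k) = ℕ.≤-trans (ℕ.≤-reflexive (ℕ.+-comm 1 k))
  (ℕ.+-mono-≤ (k≤pent k) (ℕ.≤-trans (s≤s z≤n) (ℕ.m≤n+m 2 (3 * k))))

k≤pent′ : ∀ k → k ≤ pent′ k
k≤pent′ k = ℕ.≤-trans (k≤pent k) (ℕ.m≤m+n (pent k) (2 * k + 1))

pentagonal : f 1 ≈ one ⊞ Σ∞ pentagonal-term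
pentagonal = pw λ n → trans (sym (Sₙ-limit n)) (trans (at (Sₙ-closed (2 + n)) n)
  (trans (⊞-at one (Σ< (2 + n) pentagonal-term) n)
    (trans (cong (ℤ._+_ (one n)) (sym (Σ∞-at pentagonal-term n))) (sym (⊞-at one (Σ∞ pentagonal-term) n)))))

-- The quintuple product identity

double : ℕ → ℕ
double zero    = zero
double (suc n) = suc (suc (double n))

double≡ : ∀ n → double n ≡ 2 * n
double≡ zero    = refl
double≡ (suc n) = trans (cong (λ x → suc (suc x)) (double≡ n)) (e n)
  where
  e : ∀ n → suc (suc (2 * n)) ≡ 2 * suc n
  e = ℕ-ring.solve-∀

sgn-double : ∀ n → sgn (double n) ≡ 1ℤ
sgn-double zero    = refl
sgn-double (suc n) = trans (ℤ.neg-involutive (sgn (double n))) (sgn-double n)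

sq : ℕ → ℕ
sq m = suc m * suc m

sq-suc : ∀ m → sq (suc m) ≡ sq m + (1 + double (suc m))
sq-suc m = trans (e m) (cong (λ x → sq m + (1 + x)) (sym (double≡ (suc m))))
  where
  e : ∀ m → suc (suc m) * suc (suc m) ≡ suc m * suc m + (1 + 2 * suc m)
  e = ℕ-ring.solve-∀

m≤sq : ∀ m → suc m ≤ sq m
m≤sq m = ℕ.m≤m*n (suc m) (suc m)

pred-double≤sq : ∀ m → pred (double (suc m)) ≤ sq m
pred-double≤sq m = ℕ.≤-trans (ℕ.≤-reflexive (cong suc (double≡ m)))
  (ℕ.≤-trans (ℕ.m≤m+n (suc (2 * m)) (m * m)) (ℕ.≤-reflexive (e m)))
  where
  e : ∀ m → suc (2 * m) + m * m ≡ suc m * suc m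
  e = ℕ-ring.solve-∀

φ-term : ℕ → PowerSeries
φ-term m = K (sgn (suc m)) ⊠ q^ sq m

φ-bounded : Bounded φ-term
φ-bounded m = Ord-⊠ʳ (K (sgn (suc m))) (Ord-q^ (ℕ.≤-trans ℕ.pred[n]≤n (ℕ.≤-trans (ℕ.n≤1+n m) (m≤sq m))))

-- Ramanujan's φ(-q), the sum of (-1)ᵐ q^(m²) over all integers m.
φ : PowerSeries
φ = one ⊞ K (+ 2) ⊠ Σ∞ φ-term

φ⊠-bounded : (F : ℕ → PowerSeries) → Bounded (λ m → φ-term m ⊠ F m)
φ⊠-bounded F m = Ord-≈ (R.*-comm (F m) (φ-term m)) (Ord-⊠ʳ (F m) (φ-bounded m))

-- The coefficient of z^s in the product of the triple product series with ∑ (-1)^m q^(m²) z^(2m).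
E : ℕ → PowerSeries
E s = τ s ⊞ Σ∞ (λ m → φ-term m ⊠ (τ⁻ s (double (suc m)) ⊞ τ (double (suc m) + s)))

private
  E⁻ E⁺ : ℕ → PowerSeries
  E⁻ s = Σ∞ (λ m → φ-term m ⊠ τ⁻ s (double (suc m)))
  E⁺ s = Σ∞ (λ m → φ-term m ⊠ τ (double (suc m) + s))

E-split : ∀ s → E s ≈ τ s ⊞ (E⁻ s ⊞ E⁺ s)
E-split s = ⊞-congˡ (R.trans
  (Σ∞-cong (λ m → R.distribˡ (φ-term m) (τ⁻ s (double (suc m))) (τ (double (suc m) + s))))
  (Σ∞-⊞ (λ m → φ-term m ⊠ τ⁻ s (double (suc m))) (λ m → φ-term m ⊠ τ (double (suc m) + s))))

φ-term-suc : ∀ m → φ-term (suc m) ≈ ⊝ (φ-term m ⊠ (q^ 1 ⊠ q^ double (suc m)))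
φ-term-suc m = R.trans (R.*-cong (K-neg (sgn (suc m)))
    (R.trans (q^-≡ (sq-suc m)) (R.sym (R.trans (⊠-congˡ (q^-+ 1 (double (suc m)))) (q^-+ (sq m) (1 + double (suc m)))))))
  (S.solve 4 (λ k x a b → (:- k) :* (x :* (a :* b)) := :- (k :* x :* (a :* b))) R.refl
    (K (sgn (suc m))) (q^ sq m) (q^ 1) (q^ double (suc m)))

φ-term-0 : φ-term 0 ≈ ⊝ q^ 1
φ-term-0 = S.solve 1 (λ x → con (ℤ.- 1ℤ) :* x := :- x) R.refl (q^ 1)

E⁻-rec : ∀ s → E⁻ (3 + s) ≈ ⊝ (q^ 1 ⊠ τ (suc s)) ⊞ q^ suc s ⊠ E⁻ s
E⁻-rec s = begin
  E⁻ (3 + s)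
    ≈⟨ Σ∞-suc (φ⊠-bounded (λ m → τ⁻ (3 + s) (double (suc m)))) ⟩
  φ-term 0 ⊠ τ (suc s) ⊞ Σ∞ (λ m → φ-term (suc m) ⊠ τ⁻ (suc s) (double (suc m)))
    ≈⟨ R.+-cong (R.trans (⊠-congʳ φ-term-0) (S.solve 2 (λ x t → (:- x) :* t := :- (x :* t)) R.refl (q^ 1) (τ (suc s))))
         (R.trans (Σ∞-cong term) (R.sym (Σ∞-⊠ (q^ suc s) (φ⊠-bounded (λ m → τ⁻ s (double (suc m))))))) ⟩
  ⊝ (q^ 1 ⊠ τ (suc s)) ⊞ q^ suc s ⊠ E⁻ s ∎
  where
  open ≈-Reasoning
  term : ∀ m → φ-term (suc m) ⊠ τ⁻ (suc s) (double (suc m)) ≈ q^ suc s ⊠ (φ-term m ⊠ τ⁻ s (double (suc m)))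
  term m = begin
    φ-term (suc m) ⊠ τ⁻ (suc s) (double (suc m))
      ≈⟨ R.trans (⊠-congʳ (φ-term-suc m)) (S.solve 4 (λ f a b t → (:- (f :* (a :* b))) :* t := :- (f :* a :* (b :* t))) R.refl
           (φ-term m) (q^ 1) (q^ double (suc m)) (τ⁻ (suc s) (double (suc m)))) ⟩
    ⊝ (φ-term m ⊠ q^ 1 ⊠ (q^ double (suc m) ⊠ τ⁻ (suc s) (double (suc m))))
      ≈⟨ R.-‿cong (⊠-congˡ (τ⁻-suc s (double (suc m)))) ⟩
    ⊝ (φ-term m ⊠ q^ 1 ⊠ ⊝ (q^ s ⊠ τ⁻ s (double (suc m))))
      ≈⟨ S.solve 4 (λ f a b t → :- (f :* a :* (:- (b :* t))) := (a :* b) :* (f :* t)) R.refl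
           (φ-term m) (q^ 1) (q^ s) (τ⁻ s (double (suc m))) ⟩
    (q^ 1 ⊠ q^ s) ⊠ (φ-term m ⊠ τ⁻ s (double (suc m)))
      ≈⟨ ⊠-congʳ (q^-+ 1 s) ⟩
    q^ suc s ⊠ (φ-term m ⊠ τ⁻ s (double (suc m))) ∎

E⁺-rec : ∀ s → q^ suc s ⊠ E⁺ s ≈ ⊝ (q^ suc s ⊠ (q^ 1 ⊠ τ (2 + s))) ⊞ E⁺ (3 + s)
E⁺-rec s = begin
  q^ suc s ⊠ E⁺ s
    ≈⟨ ⊠-congˡ (Σ∞-suc (φ⊠-bounded (λ m → τ (double (suc m) + s)))) ⟩
  q^ suc s ⊠ (φ-term 0 ⊠ τ (2 + s) ⊞ Σ∞ (λ m → φ-term (suc m) ⊠ τ (2 + double (suc m) + s)))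
    ≈⟨ R.distribˡ (q^ suc s) (φ-term 0 ⊠ τ (2 + s)) (Σ∞ (λ m → φ-term (suc m) ⊠ τ (2 + double (suc m) + s))) ⟩
  q^ suc s ⊠ (φ-term 0 ⊠ τ (2 + s)) ⊞ q^ suc s ⊠ Σ∞ (λ m → φ-term (suc m) ⊠ τ (2 + double (suc m) + s))
    ≈⟨ R.+-cong (R.trans (⊠-congˡ (⊠-congʳ φ-term-0))
           (S.solve 3 (λ y x t → y :* ((:- x) :* t) := :- (y :* (x :* t))) R.refl (q^ suc s) (q^ 1) (τ (2 + s))))
         (R.trans (Σ∞-⊠ (q^ suc s) bd) (Σ∞-cong term)) ⟩
  ⊝ (q^ suc s ⊠ (q^ 1 ⊠ τ (2 + s))) ⊞ E⁺ (3 + s) ∎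
  where
  open ≈-Reasoning
  bd : Bounded (λ m → φ-term (suc m) ⊠ τ (2 + double (suc m) + s))
  bd m = Ord-≤ ℕ.pred[n]≤n (φ⊠-bounded (λ m → τ (2 + double m + s)) (suc m))
  term : ∀ m → q^ suc s ⊠ (φ-term (suc m) ⊠ τ (2 + double (suc m) + s)) ≈ φ-term m ⊠ τ (double (suc m) + (3 + s))
  term m = begin
    q^ suc s ⊠ (φ-term (suc m) ⊠ τ n)
      ≈⟨ ⊠-congˡ (⊠-congʳ (φ-term-suc m)) ⟩
    q^ suc s ⊠ (⊝ (φ-term m ⊠ (q^ 1 ⊠ q^ double (suc m))) ⊠ τ n)
      ≈⟨ S.solve 5 (λ y f a b t → y :* ((:- (f :* (a :* b))) :* t) := f :* (:- (((a :* b) :* y) :* t))) R.refl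
           (q^ suc s) (φ-term m) (q^ 1) (q^ double (suc m)) (τ n) ⟩
    φ-term m ⊠ ⊝ (((q^ 1 ⊠ q^ double (suc m)) ⊠ q^ suc s) ⊠ τ n)
      ≈⟨ ⊠-congˡ (R.-‿cong (⊠-congʳ (R.trans (⊠-congʳ (q^-+ 1 (double (suc m))))
           (R.trans (q^-+ (1 + double (suc m)) (suc s)) (q^-≡ (ℕ.+-suc (1 + double (suc m)) s)))))) ⟩
    φ-term m ⊠ ⊝ (q^ n ⊠ τ n)
      ≈⟨ ⊠-congˡ (R.trans (R.sym (τ-suc n)) (R.reflexive (cong τ (e (double (suc m)) s)))) ⟩
    φ-term m ⊠ τ (double (suc m) + (3 + s)) ∎
    where
    n : ℕ
    n = 2 + double (suc m) + s
    e : ∀ x s → suc (2 + x + s) ≡ x + (3 + s)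
    e = ℕ-ring.solve-∀

-- Under z ↦ qz the triple product gains the factor - 1/z and ∑ (-1)ᵐ q^(m²) z^(2m) the factor -
-- 1/(qz²); their product gains 1/(qz³). Three consecutive coefficients therefore determine all of
-- them.
E-rec : ∀ s → E (3 + s) ≈ q^ suc s ⊠ E s
E-rec s = begin
  E (3 + s)
    ≈⟨ R.trans (E-split (3 + s)) (R.+-cong (R.trans (τ-suc (2 + s)) (R.-‿cong (⊠-congʳ (R.sym (q^-+ 1 (suc s))))))
         (R.+-cong (E⁻-rec s) (S.solve 2 (λ a b → b := a :+ (:- a :+ b)) R.refl (q^ suc s ⊠ (q^ 1 ⊠ τ (2 + s))) (E⁺ (3 + s))))) ⟩
  ⊝ ((q^ 1 ⊠ q^ suc s) ⊠ τ (2 + s)) ⊞ ((⊝ (q^ 1 ⊠ τ (suc s)) ⊞ q^ suc s ⊠ E⁻ s) ⊞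
    (q^ suc s ⊠ (q^ 1 ⊠ τ (2 + s)) ⊞ (⊝ (q^ suc s ⊠ (q^ 1 ⊠ τ (2 + s))) ⊞ E⁺ (3 + s))))
    ≈⟨ ⊞-congˡ (R.+-cong (⊞-congʳ (R.-‿cong (⊠-congˡ (τ-suc s)))) (⊞-congˡ (R.sym (E⁺-rec s)))) ⟩
  ⊝ ((q^ 1 ⊠ q^ suc s) ⊠ τ (2 + s)) ⊞ ((⊝ (q^ 1 ⊠ ⊝ (q^ s ⊠ τ s)) ⊞ q^ suc s ⊠ E⁻ s) ⊞
    (q^ suc s ⊠ (q^ 1 ⊠ τ (2 + s)) ⊞ q^ suc s ⊠ E⁺ s))
    ≈⟨ S.solve 7 (λ x y z t u a b → :- ((x :* y) :* u) :+ ((:- (x :* (:- (z :* t))) :+ y :* a) :+ (y :* (x :* u) :+ y :* b)) :=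
         (x :* z) :* t :+ y :* (a :+ b)) R.refl (q^ 1) (q^ suc s) (q^ s) (τ s) (τ (2 + s)) (E⁻ s) (E⁺ s) ⟩
  (q^ 1 ⊠ q^ s) ⊠ τ s ⊞ q^ suc s ⊠ (E⁻ s ⊞ E⁺ s)
    ≈⟨ ⊞-congʳ (⊠-congʳ (q^-+ 1 s)) ⟩
  q^ suc s ⊠ τ s ⊞ q^ suc s ⊠ (E⁻ s ⊞ E⁺ s)
    ≈⟨ R.trans (R.sym (R.distribˡ (q^ suc s) (τ s) (E⁻ s ⊞ E⁺ s))) (⊠-congˡ (R.sym (E-split s))) ⟩
  q^ suc s ⊠ E s ∎
  where open ≈-Reasoning

-- The reflection n ↦ 1 - n of `τ`, combined with the symmetry m ↦ - m of the second series.
E-1 : E 1 ≈ ⊝ E 0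
E-1 = begin
  E 1
    ≈⟨ R.+-cong (R.trans (S.solve 1 (λ t → t := :- (:- t)) R.refl (τ 1)) (R.-‿cong (R.sym (τ⁻-zeroˡ 0))))
         (Σ∞-cong term) ⟩
  ⊝ τ 0 ⊞ Σ∞ (λ m → ⊝ (φ-term m ⊠ (τ⁻ 0 (double (suc m)) ⊞ τ (double (suc m) + 0))))
    ≈⟨ ⊞-congˡ (Σ∞-⊝ (λ m → φ-term m ⊠ (τ⁻ 0 (double (suc m)) ⊞ τ (double (suc m) + 0)))) ⟩
  ⊝ τ 0 ⊞ ⊝ Σ∞ (λ m → φ-term m ⊠ (τ⁻ 0 (double (suc m)) ⊞ τ (double (suc m) + 0)))
    ≈⟨ S.solve 2 (λ a b → :- a :+ :- b := :- (a :+ b)) R.refl (τ 0)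
         (Σ∞ (λ m → φ-term m ⊠ (τ⁻ 0 (double (suc m)) ⊞ τ (double (suc m) + 0)))) ⟩
  ⊝ E 0 ∎
  where
  open ≈-Reasoning
  term : ∀ m → φ-term m ⊠ (τ⁻ 0 (suc (double m)) ⊞ τ (double (suc m) + 1)) ≈
               ⊝ (φ-term m ⊠ (τ⁻ 0 (double (suc m)) ⊞ τ (double (suc m) + 0)))
  term m = begin
    φ-term m ⊠ (⊝ τ (2 + double m) ⊞ τ (double (suc m) + 1))
      ≈⟨ ⊠-congˡ (R.+-cong (R.-‿cong (R.reflexive (cong τ (sym (ℕ.+-identityʳ (double (suc m)))))))
           (R.reflexive (cong τ (ℕ.+-comm (double (suc m)) 1)))) ⟩
    φ-term m ⊠ (⊝ τ (double (suc m) + 0) ⊞ τ (3 + double m))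
      ≈⟨ S.solve 3 (λ f a b → f :* (:- a :+ b) := :- (f :* (:- b :+ a))) R.refl
           (φ-term m) (τ (double (suc m) + 0)) (τ (3 + double m)) ⟩
    ⊝ (φ-term m ⊠ (⊝ τ (3 + double m) ⊞ τ (double (suc m) + 0))) ∎

-- The terms with positive and negative shifts agree up to sign and a step in m, so they telescope
-- to - `U 0`, which cancels `τ 2`.
E-2 : E 2 ≈ 𝟘
E-2 = begin
  E 2
    ≈⟨ R.trans (E-split 2) (⊞-congˡ (R.+-cong
         (R.trans (Σ∞-cong (λ m → R.trans (⊠-congˡ (τ⁻-zeroˡ (double m)))
            (S.solve 2 (λ f t → f :* (:- t) := :- (f :* t)) R.refl (φ-term m) (τ (suc (double m)))))) (Σ∞-⊝ U))
         (Σ∞-cong shift))) ⟩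
  τ 2 ⊞ (⊝ Σ∞ U ⊞ Σ∞ (U ∘ suc))
    ≈⟨ R.+-cong (τ-suc 1) (⊞-congʳ (R.-‿cong (R.trans (Σ∞-suc (φ⊠-bounded (λ m → τ (suc (double m)))))
         (⊞-congʳ (⊠-congʳ φ-term-0))))) ⟩
  ⊝ (q^ 1 ⊠ τ 1) ⊞ (⊝ (⊝ q^ 1 ⊠ τ 1 ⊞ Σ∞ (U ∘ suc)) ⊞ Σ∞ (U ∘ suc))
    ≈⟨ S.solve 3 (λ x t u → :- (x :* t) :+ (:- ((:- x) :* t :+ u) :+ u) := # 0) R.refl (q^ 1) (τ 1) (Σ∞ (U ∘ suc)) ⟩
  K 0ℤ
    ≈⟨ (pw λ { zero → refl ; (suc n) → refl }) ⟩
  𝟘 ∎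
  where
  open ≈-Reasoning
  U : ℕ → PowerSeries
  U m = φ-term m ⊠ τ (suc (double m))
  shift : ∀ m → φ-term m ⊠ τ (double (suc m) + 2) ≈ U (suc m)
  shift m = begin
    φ-term m ⊠ τ (double (suc m) + 2)
      ≈⟨ ⊠-congˡ (R.trans (R.reflexive (cong τ (ℕ.+-comm (double (suc m)) 2))) (τ-suc (suc (double (suc m))))) ⟩
    φ-term m ⊠ ⊝ (q^ suc (double (suc m)) ⊠ τ (suc (double (suc m))))
      ≈⟨ ⊠-congˡ (R.-‿cong (⊠-congʳ (R.sym (q^-+ 1 (double (suc m)))))) ⟩
    φ-term m ⊠ ⊝ ((q^ 1 ⊠ q^ double (suc m)) ⊠ τ (suc (double (suc m))))
      ≈⟨ S.solve 3 (λ f x t → f :* (:- (x :* t)) := (:- (f :* x)) :* t) R.refl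
           (φ-term m) (q^ 1 ⊠ q^ double (suc m)) (τ (suc (double (suc m)))) ⟩
    ⊝ (φ-term m ⊠ (q^ 1 ⊠ q^ double (suc m))) ⊠ τ (suc (double (suc m)))
      ≈⟨ ⊠-congʳ (R.sym (φ-term-suc m)) ⟩
    U (suc m) ∎

tri-double : ∀ n → tri (double n) + n ≡ n * (n + n)
tri-double zero    = refl
tri-double (suc n) = trans (cong (λ d → suc d + (d + tri (double n)) + suc n) (double≡ n))
  (trans (e₁ n (tri (double n))) (trans (cong (_+ (4 * n + 2)) (tri-double n)) (e₂ n)))
  where
  e₁ : ∀ n t → suc (2 * n) + (2 * n + t) + suc n ≡ t + n + (4 * n + 2)
  e₁ = ℕ-ring.solve-∀
  e₂ : ∀ n → n * (n + n) + (4 * n + 2) ≡ suc n * (suc n + suc n)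
  e₂ = ℕ-ring.solve-∀

2*pent : ∀ n → 2 * pent n ≡ n * (3 * n + 1)
2*pent zero    = refl
2*pent (suc n) = trans (e₁ n (pent n)) (trans (cong (_+ (6 * n + 4)) (2*pent n)) (e₂ n))
  where
  e₁ : ∀ n p → 2 * (p + (3 * n + 2)) ≡ 2 * p + (6 * n + 4)
  e₁ = ℕ-ring.solve-∀
  e₂ : ∀ n → n * (3 * n + 1) + (6 * n + 4) ≡ suc n * (3 * suc n + 1)
  e₂ = ℕ-ring.solve-∀

pent′-sq : ∀ m → sq m + tri (double (suc m)) ≡ 2 * pent′ m
pent′-sq m = ℕ.+-cancelʳ-≡ (suc m) _ _ (trans (ℕ.+-assoc (sq m) _ (suc m))
  (trans (cong (_+_ (sq m)) (tri-double (suc m))) (trans (e₁ m) (trans (cong (_+ (4 * m + 2 + suc m)) (sym (2*pent m))) (e₂ m (pent m))))))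
  where
  e₁ : ∀ m → suc m * suc m + suc m * (suc m + suc m) ≡ m * (3 * m + 1) + (4 * m + 2 + suc m)
  e₁ = ℕ-ring.solve-∀
  e₂ : ∀ m p → 2 * p + (4 * m + 2 + suc m) ≡ 2 * (p + (2 * m + 1)) + suc m
  e₂ = ℕ-ring.solve-∀

pent-sq : ∀ m → sq m + tri (suc (double (suc m))) ≡ 2 * pent (suc m)
pent-sq m = begin
  sq m + (double (suc m) + tri (double (suc m)))   ≡⟨ e₁ (sq m) (double (suc m)) (tri (double (suc m))) ⟩
  (sq m + tri (double (suc m))) + double (suc m)   ≡⟨ cong₂ _+_ (pent′-sq m) (double≡ (suc m)) ⟩
  2 * pent′ m + 2 * suc m                          ≡⟨ e₂ m (pent m) ⟩
  2 * pent (suc m)                                 ∎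
  where
  open ≡-Reasoning
  e₁ : ∀ a b c → a + (b + c) ≡ (a + c) + b
  e₁ = ℕ-ring.solve-∀
  e₂ : ∀ m p → 2 * (p + (2 * m + 1)) + 2 * suc m ≡ 2 * (p + (3 * m + 2))
  e₂ = ℕ-ring.solve-∀

-- Since m² + m(2m ∓ 1) = m(3m ∓ 1) is twice a pentagonal number, the coefficient of z⁰ is the
-- pentagonal series at q².
E-0 : E 0 ≈ f 2
E-0 = begin
  E 0
    ≈⟨ R.+-cong (S.solve 1 (λ x → # 1 :* x := x) R.refl (q^ 0)) (Σ∞-cong term) ⟩
  one ⊞ Σ∞ (λ m → sub 2 (pentagonal-term m))
    ≈⟨ R.sym (R.+-cong (sub-q^ 2 0) (sub-Σ∞ 2 bd)) ⟩
  sub 2 one ⊞ sub 2 (Σ∞ pentagonal-term)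
    ≈⟨ R.sym (R.trans (sub-cong 2 pentagonal) (sub-⊞ 2 one (Σ∞ pentagonal-term))) ⟩
  sub 2 (f 1)
    ≈⟨ sub-f 2 ⟩
  f 2 ∎
  where
  open ≈-Reasoning
  bd : Bounded pentagonal-term
  bd m = Ord-⊠ʳ (K (sgn (suc m))) (Ord-⊞ (Ord-q^ (ℕ.≤-trans ℕ.pred[n]≤n (k≤pent′ m)))
    (Ord-q^ (ℕ.≤-trans ℕ.pred[n]≤n (ℕ.≤-trans (ℕ.n≤1+n m) (k≤pent (suc m))))))
  even : ∀ m → τ (double (suc m) + 0) ≈ q^ tri (double (suc m))
  even m = R.trans (R.reflexive (cong τ (ℕ.+-identityʳ (double (suc m)))))
    (R.trans (⊠-congʳ (K-≡ (sgn-double (suc m)))) (S.solve 1 (λ x → # 1 :* x := x) R.refl (q^ tri (double (suc m)))))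
  odd : ∀ m → ⊝ τ (suc (double (suc m))) ≈ q^ tri (suc (double (suc m)))
  odd m = R.trans (R.-‿cong (⊠-congʳ (K-≡ (cong ℤ.-_ (sgn-double (suc m))))))
    (S.solve 1 (λ x → :- (con (ℤ.- 1ℤ) :* x) := x) R.refl (q^ tri (suc (double (suc m)))))
  term : ∀ m → φ-term m ⊠ (τ⁻ 0 (double (suc m)) ⊞ τ (double (suc m) + 0)) ≈ sub 2 (pentagonal-term m)
  term m = begin
    φ-term m ⊠ (⊝ τ (suc (double (suc m))) ⊞ τ (double (suc m) + 0))
      ≈⟨ ⊠-congˡ (R.+-cong (odd m) (even m)) ⟩
    K (sgn (suc m)) ⊠ q^ sq m ⊠ (q^ tri (suc (double (suc m))) ⊞ q^ tri (double (suc m)))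
      ≈⟨ S.solve 4 (λ k x a b → k :* x :* (a :+ b) := k :* (x :* b :+ x :* a)) R.refl
           (K (sgn (suc m))) (q^ sq m) (q^ tri (suc (double (suc m)))) (q^ tri (double (suc m))) ⟩
    K (sgn (suc m)) ⊠ (q^ sq m ⊠ q^ tri (double (suc m)) ⊞ q^ sq m ⊠ q^ tri (suc (double (suc m))))
      ≈⟨ ⊠-congˡ (R.+-cong (R.trans (q^-+ (sq m) _) (R.trans (q^-≡ (pent′-sq m)) (R.sym (sub-q^ 2 (pent′ m)))))
           (R.trans (q^-+ (sq m) _) (R.trans (q^-≡ (pent-sq m)) (R.sym (sub-q^ 2 (pent (suc m))))))) ⟩
    K (sgn (suc m)) ⊠ (sub 2 (q^ pent′ m) ⊞ sub 2 (q^ pent (suc m)))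
      ≈⟨ R.sym (R.trans (sub-K⊠ 2 (sgn (suc m)) (q^ pent′ m ⊞ q^ pent (suc m)))
           (⊠-congˡ (sub-⊞ 2 (q^ pent′ m) (q^ pent (suc m))))) ⟩
    sub 2 (pentagonal-term m) ∎

-- Together with the other two residues modulo 3, this is the quintuple product identity read off
-- coefficient by coefficient in z.
E-closed₁ : ∀ k → E (1 + 3 * k) ≈ ⊝ (q^ pent k ⊠ f 2)
E-closed₁ zero    = R.trans E-1 (R.-‿cong (R.trans E-0 (R.sym (R.*-identityˡ (f 2)))))
E-closed₁ (suc k) = begin
  E (1 + 3 * suc k)                    ≈⟨ R.reflexive (cong E (e k)) ⟩
  E (3 + (1 + 3 * k))                  ≈⟨ E-rec (1 + 3 * k) ⟩
  q^ (2 + 3 * k) ⊠ E (1 + 3 * k)       ≈⟨ ⊠-congˡ (E-closed₁ k) ⟩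
  q^ (2 + 3 * k) ⊠ ⊝ (q^ pent k ⊠ f 2)
    ≈⟨ S.solve 3 (λ x y z → x :* (:- (y :* z)) := :- ((y :* x) :* z)) R.refl (q^ (2 + 3 * k)) (q^ pent k) (f 2) ⟩
  ⊝ ((q^ pent k ⊠ q^ (2 + 3 * k)) ⊠ f 2)
    ≈⟨ R.-‿cong (⊠-congʳ (R.trans (q^-+ (pent k) (2 + 3 * k)) (q^-≡ (cong (_+_ (pent k)) (ℕ.+-comm 2 (3 * k)))))) ⟩
  ⊝ (q^ pent (suc k) ⊠ f 2) ∎
  where
  open ≈-Reasoning
  e : ∀ k → 1 + 3 * suc k ≡ 3 + (1 + 3 * k)
  e = ℕ-ring.solve-∀

E-closed₂ : ∀ k → E (2 + 3 * k) ≈ 𝟘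
E-closed₂ zero    = E-2
E-closed₂ (suc k) = R.trans (R.reflexive (cong E (e k))) (R.trans (E-rec (2 + 3 * k))
  (R.trans (⊠-congˡ (E-closed₂ k)) (R.zeroʳ (q^ (3 + 3 * k)))))
  where
  e : ∀ k → 2 + 3 * suc k ≡ 3 + (2 + 3 * k)
  e = ℕ-ring.solve-∀

E-closed₃ : ∀ k → E (3 + 3 * k) ≈ q^ pent′ k ⊠ f 2
E-closed₃ zero    = R.trans (E-rec 0) (⊠-congˡ E-0)
E-closed₃ (suc k) = begin
  E (3 + 3 * suc k)                        ≈⟨ R.reflexive (cong E (e k)) ⟩
  E (3 + (3 + 3 * k))                      ≈⟨ E-rec (3 + 3 * k) ⟩
  q^ (4 + 3 * k) ⊠ E (3 + 3 * k)           ≈⟨ ⊠-congˡ (E-closed₃ k) ⟩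
  q^ (4 + 3 * k) ⊠ (q^ pent′ k ⊠ f 2)      ≈⟨ R.sym (R.*-assoc (q^ (4 + 3 * k)) (q^ pent′ k) (f 2)) ⟩
  (q^ (4 + 3 * k) ⊠ q^ pent′ k) ⊠ f 2
    ≈⟨ ⊠-congʳ (R.trans (q^-+ (4 + 3 * k) (pent′ k)) (q^-≡ (e′ k (pent k)))) ⟩
  q^ pent′ (suc k) ⊠ f 2                   ∎
  where
  open ≈-Reasoning
  e : ∀ k → 3 + 3 * suc k ≡ 3 + (3 + 3 * k)
  e = ℕ-ring.solve-∀
  e′ : ∀ k p → 4 + 3 * k + (p + (2 * k + 1)) ≡ p + (3 * k + 2) + (2 * suc k + 1)
  e′ = ℕ-ring.solve-∀

Pent : (ℕ → ℤ) → (ℕ → ℤ) → PowerSeries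
Pent u v = Σ∞ (λ k → K (u k) ⊠ q^ pent k ⊞ K (v k) ⊠ q^ pent′ k)

Pent-bounded : (u v : ℕ → ℤ) → Bounded (λ k → K (u k) ⊠ q^ pent k ⊞ K (v k) ⊠ q^ pent′ k)
Pent-bounded u v k = Ord-⊞ (Ord-⊠ʳ (K (u k)) (Ord-q^ (ℕ.≤-trans ℕ.pred[n]≤n (k≤pent k))))
  (Ord-⊠ʳ (K (v k)) (Ord-q^ (ℕ.≤-trans ℕ.pred[n]≤n (k≤pent′ k))))

-- The quadratic form x² + 2y² = 3(k² + 8m²) behind this identity: both sides sum the weight g over
-- the terms of the product of E with the two theta series, grouped in two ways.
φ-pentagonal : ∀ g → (∀ z → g (1ℤ ℤ.- z) ≡ ℤ.- 1ℤ ℤ.* g z) →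
  (∀ z m → g (z ℤ.+ + double m) ℤ.- ℤ.- 1ℤ ℤ.* g (z ℤ.- + double m) ≡ + 2 ℤ.* g z) →
  φ ⊠ Θ (λ i → g (+ suc i)) ≈ f 2 ⊠ Pent (λ k → ℤ.- g (+ (1 + 3 * k))) (λ k → g (+ (3 + 3 * k)))
φ-pentagonal g g-odd g-affine = begin
  φ ⊠ Θg
    ≈⟨ R.trans (R.distribʳ Θg one (K (+ 2) ⊠ Σ∞ φ-term)) (R.+-cong (R.*-identityˡ Θg)
         (R.trans (S.solve 3 (λ c s t → c :* s :* t := (c :* t) :* s) R.refl (K (+ 2)) (Σ∞ φ-term) Θg)
         (R.trans (Σ∞-⊠ (K (+ 2) ⊠ Θg) φ-bounded)
           (Σ∞-cong (λ m → R.trans (R.*-comm (K (+ 2) ⊠ Θg) (φ-term m)) (⊠-congˡ (R.sym (Θ-* (+ 2) (λ i → g (+ suc i)))))))))) ⟩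
  Θg ⊞ Σ∞ (λ m → φ-term m ⊠ Θ (λ i → + 2 ℤ.* g (+ suc i)))
    -- Writing 2 g(z) as g(z + 2m) + g(z - 2m) gives each term the form that `reflection` produces.
    ≈⟨ ⊞-congˡ (Σ∞-cong (λ m → R.trans (⊠-congˡ (Θ-cong (λ i → sym (g-affine (+ suc i) (suc m)))))
         (Σ∞-⊠ (φ-term m) (Θ-bounded (weight m))))) ⟩
  Θg ⊞ Σ∞ (λ m → Σ∞ (λ i → φ-term m ⊠ (K (weight m i) ⊠ τ (suc i))))
    ≈⟨ ⊞-congˡ (Σ∞-cong (λ m → R.sym (reflection (double (suc m)) (Ord-φ m) (ℤ.- 1ℤ) g g-odd))) ⟩
  Θg ⊞ Σ∞ (λ m → Σ∞ (λ i → K (g (+ suc i)) ⊠ X m i))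
    ≈⟨ ⊞-congˡ (Σ∞-swap (λ m i → K (g (+ suc i)) ⊠ X m i)) ⟩
  Θg ⊞ Σ∞ (λ i → Σ∞ (λ m → K (g (+ suc i)) ⊠ X m i))
    ≈⟨ R.sym (Σ∞-⊞ (λ i → K (g (+ suc i)) ⊠ τ (suc i)) (λ i → Σ∞ (λ m → K (g (+ suc i)) ⊠ X m i))) ⟩
  Σ∞ (λ i → K (g (+ suc i)) ⊠ τ (suc i) ⊞ Σ∞ (λ m → K (g (+ suc i)) ⊠ X m i))
    ≈⟨ Σ∞-cong (λ i → R.trans (⊞-congˡ (Σ∞-K (g (+ suc i)) (λ m → X m i)))
         (R.trans (R.sym (R.distribˡ (K (g (+ suc i))) (τ (suc i)) (Σ∞ (λ m → X m i))))
           (⊠-congˡ (⊞-congˡ (Σ∞-cong (λ m → ⊠-congˡ (S.solve 2 (λ a b → a :- con (ℤ.- 1ℤ) :* b := a :+ b) R.refl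
             (τ⁻ (suc i) (double (suc m))) (τ (double (suc m) + suc i))))))))) ⟩
  Σ∞ (λ i → K (g (+ suc i)) ⊠ E (suc i))
    -- The closed forms of `E` depend on the residue of s modulo 3.
    ≈⟨ Σ∞-blocks 3 bdE ⟩
  Σ∞ (λ k → Σ< 3 (λ j → K (g (+ suc (3 * k + j))) ⊠ E (suc (3 * k + j))))
    ≈⟨ Σ∞-cong block ⟩
  Σ∞ (λ k → f 2 ⊠ (K (ℤ.- g (+ (1 + 3 * k))) ⊠ q^ pent k ⊞ K (g (+ (3 + 3 * k))) ⊠ q^ pent′ k))
    ≈⟨ R.sym (Σ∞-⊠ (f 2) (Pent-bounded _ _)) ⟩
  f 2 ⊠ Pent (λ k → ℤ.- g (+ (1 + 3 * k))) (λ k → g (+ (3 + 3 * k))) ∎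
  where
  open ≈-Reasoning
  Θg : PowerSeries
  Θg = Θ (λ i → g (+ suc i))
  weight : ℕ → ℕ → ℤ
  weight m i = g (+ suc i ℤ.+ + double (suc m)) ℤ.- ℤ.- 1ℤ ℤ.* g (+ suc i ℤ.- + double (suc m))
  X : ℕ → ℕ → PowerSeries
  X m i = φ-term m ⊠ (τ⁻ (suc i) (double (suc m)) ⊟ K (ℤ.- 1ℤ) ⊠ τ (double (suc m) + suc i))
  Ord-φ : ∀ m → Ord (pred (double (suc m))) (φ-term m)
  Ord-φ m = Ord-⊠ʳ (K (sgn (suc m))) (Ord-q^ (pred-double≤sq m))
  bdE : Bounded (λ i → K (g (+ suc i)) ⊠ E (suc i))
  bdE i = Ord-⊠ʳ (K (g (+ suc i))) (Ord-⊞ (Ord-≤ ℕ.pred[n]≤n (Ord-τ (suc i)))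
    (Ord-Σ∞ (λ m → Ord-≈ (R.sym (R.distribˡ (φ-term m) (τ⁻ (suc i) (double (suc m))) (τ (double (suc m) + suc i))))
      (Ord-⊞ (Ord-τ⁻-⊠ {double (suc m)} (Ord-φ m) i)
        (Ord-⊠ʳ (φ-term m) (Ord-≤ (ℕ.pred-mono-≤ (ℕ.≤-trans (ℕ.n≤1+n i) (ℕ.m≤n+m (suc i) (double (suc m))))) (Ord-τ (double (suc m) + suc i))))))))
  block : ∀ k → Σ< 3 (λ j → K (g (+ suc (3 * k + j))) ⊠ E (suc (3 * k + j))) ≈
                f 2 ⊠ (K (ℤ.- g (+ (1 + 3 * k))) ⊠ q^ pent k ⊞ K (g (+ (3 + 3 * k))) ⊠ q^ pent′ k)
  block k = begin
    Σ< 3 F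
      ≈⟨ R.trans (Σ<-last 2 F) (⊞-congʳ (R.trans (Σ<-last 1 F) (⊞-congʳ (R.trans (Σ<-last 0 F)
           (R.trans (⊞-congʳ (Σ<-zero F)) (R.+-identityˡ (F 0))))))) ⟩
    (F 0 ⊞ F 1) ⊞ F 2
      ≈⟨ R.+-cong (R.+-cong (at-index 0) (at-index 1)) (at-index 2) ⟩
    (G (1 + 3 * k) ⊞ G (2 + 3 * k)) ⊞ G (3 + 3 * k)
      ≈⟨ R.+-cong (R.trans (⊞-congˡ (R.trans (⊠-congˡ (E-closed₂ k)) (R.zeroʳ (K (g (+ (2 + 3 * k)))))))
           (R.trans (R.+-identityʳ (G (1 + 3 * k))) (⊠-congˡ (E-closed₁ k)))) (⊠-congˡ (E-closed₃ k)) ⟩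
    K (g (+ (1 + 3 * k))) ⊠ ⊝ (q^ pent k ⊠ f 2) ⊞ K (g (+ (3 + 3 * k))) ⊠ (q^ pent′ k ⊠ f 2)
      ≈⟨ S.solve 5 (λ a b x y w → a :* (:- (x :* w)) :+ b :* (y :* w) := w :* ((:- a) :* x :+ b :* y)) R.refl
           (K (g (+ (1 + 3 * k)))) (K (g (+ (3 + 3 * k)))) (q^ pent k) (q^ pent′ k) (f 2) ⟩
    f 2 ⊠ (⊝ K (g (+ (1 + 3 * k))) ⊠ q^ pent k ⊞ K (g (+ (3 + 3 * k))) ⊠ q^ pent′ k)
      ≈⟨ ⊠-congˡ (⊞-congʳ (⊠-congʳ (R.sym (K-neg (g (+ (1 + 3 * k))))))) ⟩
    f 2 ⊠ (K (ℤ.- g (+ (1 + 3 * k))) ⊠ q^ pent k ⊞ K (g (+ (3 + 3 * k))) ⊠ q^ pent′ k) ∎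
    where
    F G : ℕ → PowerSeries
    F j = K (g (+ suc (3 * k + j))) ⊠ E (suc (3 * k + j))
    G s = K (g (+ s)) ⊠ E s
    at-index : ∀ j → F j ≈ G (suc j + 3 * k)
    at-index j = R.reflexive (cong (λ s → G (suc s)) (ℕ.+-comm (3 * k) j))

-- Identities proved by linear combination

infixl 1 _&_
infix 2 _⊙_

_⊙_ : ∀ C {A B} → A ≈ B → C ⊠ (A ⊟ B) ≈ 𝟘
C ⊙ A≈B = R.trans (⊠-congˡ (R.trans (⊞-congʳ A≈B) (R.-‿inverseʳ _))) (R.zeroʳ C)

_&_ : ∀ {U V} → U ≈ 𝟘 → V ≈ 𝟘 → U ⊞ V ≈ 𝟘
p & r = R.trans (R.+-cong p r) (R.+-identityˡ 𝟘)

-- The terms `C ⊙ p`, joined by `&`, form a certificate: the difference of the two sides is a sum of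
-- multiples C (A - B) of known equations A ≈ B, and the solver checks this polynomial identity.
by-combination : ∀ {U X Y} → U ≈ 𝟘 → X ⊟ Y ≈ U → X ≈ Y
by-combination {U} {X} {Y} U≈𝟘 p = begin
  X              ≈⟨ S.solve 2 (λ x y → x := (x :- y) :+ y) R.refl X Y ⟩
  (X ⊟ Y) ⊞ Y    ≈⟨ ⊞-congʳ (R.trans p U≈𝟘) ⟩
  𝟘 ⊞ Y          ≈⟨ R.+-identityˡ Y ⟩
  Y              ∎
  where open ≈-Reasoning

⊠-cancelˡ : ∀ F {X Y} → F 0 ≡ 1ℤ → F ⊠ X ≈ F ⊠ Y → X ≈ Y
⊠-cancelˡ F {X} {Y} F₀ p = R.trans (R.sym (unit X)) (R.trans (⊠-congˡ p) (unit Y))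
  where
  unit : ∀ Z → recip F ⊠ (F ⊠ Z) ≈ Z
  unit Z = R.trans (S.solve 3 (λ r f z → r :* (f :* z) := (f :* r) :* z) R.refl (recip F) F Z)
    (R.trans (⊠-congʳ (R.trans (⊠-at F (recip F)) (pw (recip-inverse {F} F₀)))) (R.*-identityˡ Z))

D-⊟ : ∀ F G → D (F ⊟ G) ≈ D F ⊟ D G
D-⊟ F G = R.trans (D-⊞ F (⊝ G)) (⊞-congˡ (D-⊝ G))

E₂ E₄ E₆ : PowerSeries
E₂ = K 1ℤ ⊟ K (+ 24) ⊠ S₍ 1 ₎
E₄ = K 1ℤ ⊞ K (+ 240) ⊠ S₍ 3 ₎
E₆ = K 1ℤ ⊟ K (+ 504) ⊠ S₍ 5 ₎

E₂′ E₄′ E₆′ : PowerSeries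
E₂′ = sub 2 E₂
E₄′ = sub 2 E₄
E₆′ = sub 2 E₆

-- Ramanujan's differential equations, from the moments of the triple product series.

J₃ : J₍ 3 ₎ ≈ E₂ ⊠ J₍ 1 ₎
J₃ = by-combination (K 1ℤ ⊙ J-relation₁)
  (S.solve 3 (λ s a b → b :- (# 1 :- # 24 :* s) :* a := # 1 :* (# 3 :* (# 8 :* (a :* s)) :- (a :- b))) R.refl
    S₍ 1 ₎ J₍ 1 ₎ J₍ 3 ₎)

-- A moment relation solved for its highest moment, the lower one being eliminated by `J₃`; `J₇`
-- continues in the same way.
J₅ : K (+ 3) ⊠ J₍ 5 ₎ ≈ (K (+ 5) ⊠ E₂ ⊠ E₂ ⊟ K (+ 2) ⊠ E₄) ⊠ J₍ 1 ₎
J₅ = K-cancel (+ 2) (by-combination (K 1ℤ ⊙ J-relation₃ & K (+ 10) ⊠ E₂ ⊙ J₃)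
  (S.solve 5 (λ s₁ s₃ a b c →
    let e₂ = # 1 :- # 24 :* s₁; e₄ = # 1 :+ # 240 :* s₃ in
    # 2 :* (# 3 :* c) :- # 2 :* ((# 5 :* e₂ :* e₂ :- # 2 :* e₄) :* a) :=
    # 1 :* (# 15 :* (# 16 :* (b :* s₁) :+ # 64 :* (a :* s₃)) :-
      (con (ℤ.- + 6) :* c :+ (# 10 :* b :+ con (ℤ.- + 4) :* a))) :+
    # 10 :* e₂ :* (b :- e₂ :* a)) R.refl
    S₍ 1 ₎ S₍ 3 ₎ J₍ 1 ₎ J₍ 3 ₎ J₍ 5 ₎))

J₇ : K (+ 9) ⊠ J₍ 7 ₎ ≈ (K (+ 16) ⊠ E₆ ⊟ K (+ 42) ⊠ E₂ ⊠ E₄ ⊞ K (+ 35) ⊠ E₂ ⊠ E₂ ⊠ E₂) ⊠ J₍ 1 ₎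
J₇ = by-combination (K 1ℤ ⊙ J-relation₅ & K (+ 7) ⊠ E₂ ⊙ J₅ & ⊝ (K (+ 28) ⊠ E₄) ⊙ J₃)
  (S.solve 7 (λ s₁ s₃ s₅ a b c d →
    let e₂ = # 1 :- # 24 :* s₁; e₄ = # 1 :+ # 240 :* s₃; e₆ = # 1 :- # 504 :* s₅ in
    # 9 :* d :- (# 16 :* e₆ :- # 42 :* e₂ :* e₄ :+ # 35 :* e₂ :* e₂ :* e₂) :* a :=
    # 1 :* (# 21 :* (# 24 :* (c :* s₁) :+ (# 320 :* (b :* s₃) :+ # 384 :* (a :* s₅))) :-
      (con (ℤ.- + 9) :* d :+ (# 21 :* c :+ (con (ℤ.- + 28) :* b :+ # 16 :* a)))) :+
    # 7 :* e₂ :* (# 3 :* c :- (# 5 :* e₂ :* e₂ :- # 2 :* e₄) :* a) :+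
    (:- (# 28 :* e₄)) :* (b :- e₂ :* a)) R.refl
    S₍ 1 ₎ S₍ 3 ₎ S₍ 5 ₎ J₍ 1 ₎ J₍ 3 ₎ J₍ 5 ₎ J₍ 7 ₎)

Θ-0 : ∀ w → Θ w 0 ≡ ℤ.- w 0
Θ-0 w = begin
  Θ w 0
    ≡⟨ at (Σ∞-suc (Θ-bounded w)) 0 ⟩
  (K (w 0) ⊠ τ 1 ⊞ Σ∞ (λ i → K (w (suc i)) ⊠ τ (2 + i))) 0
    ≡⟨ ⊞-at (K (w 0) ⊠ τ 1) (Σ∞ (λ i → K (w (suc i)) ⊠ τ (2 + i))) 0 ⟩
  (K (w 0) ⊠ τ 1) 0 ℤ.+ Σ∞ (λ i → K (w (suc i)) ⊠ τ (2 + i)) 0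
    ≡⟨ cong₂ ℤ._+_ (trans (K-⊠ (w 0) (τ 1) 0) (cong (w 0 ℤ.*_) (K-⊠ (ℤ.- 1ℤ) (q^ 0) 0)))
         (Ord-Σ∞ {1} (λ i → Ord-⊠ʳ (K (w (suc i))) (Ord-≤ (s≤s z≤n) (Ord-τ (2 + i)))) 0 (s≤s z≤n)) ⟩
  w 0 ℤ.* ℤ.- 1ℤ ℤ.+ 0ℤ
    ≡⟨ simplify (w 0) ⟩
  ℤ.- w 0 ∎
  where
  open ≡-Reasoning
  simplify : ∀ w → w ℤ.* ℤ.- 1ℤ ℤ.+ 0ℤ ≡ ℤ.- w
  simplify = solve-∀

J₁-cancel : ∀ {X Y} → X ⊠ J₍ 1 ₎ ≈ Y ⊠ J₍ 1 ₎ → X ≈ Y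
J₁-cancel {X} {Y} p = ⊠-cancelˡ (⊝ J₍ 1 ₎)
  (trans (⊝-at J₍ 1 ₎ 0) (cong ℤ.-_ (Θ-0 (λ i → y (+ suc i) ℤ.^ 1))))
  (R.trans (flip X) (R.trans (R.-‿cong p) (R.sym (flip Y))))
  where
  flip : ∀ X → ⊝ J₍ 1 ₎ ⊠ X ≈ ⊝ (X ⊠ J₍ 1 ₎)
  flip X = S.solve 2 (λ x j → (:- j) :* x := :- (x :* j)) R.refl X J₍ 1 ₎

Ψ₀-cancel : ∀ {X Y} → X ⊠ Ψ₍ 0 ₎ ≈ Y ⊠ Ψ₍ 0 ₎ → X ≈ Y
Ψ₀-cancel {X} {Y} p = ⊠-cancelˡ Ψ₍ 0 ₎ (Θ-0 (λ i → sgn (suc i) ℤ.* y (+ suc i) ℤ.^ 0))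
  (R.trans (R.*-comm Ψ₍ 0 ₎ X) (R.trans p (R.*-comm Y Ψ₍ 0 ₎)))

-- D J₃ is computed twice, by the heat equation and by differentiating J₃ = E₂ J₁. In the difference
-- J₁ is a common factor and can be cancelled.
DE₂ : K (+ 12) ⊠ D E₂ ≈ E₂ ⊠ E₂ ⊟ E₄
DE₂ = K-cancel (+ 2) (J₁-cancel (by-combination
  (K (ℤ.- + 24) ⊙ R.trans (D-cong J₃) (D-⊠ E₂ J₍ 1 ₎) & K (+ 3) ⊙ heat-J 3 & K 1ℤ ⊙ J₅ &
   K (ℤ.- + 3) ⊠ E₂ ⊙ heat-J 1 & K (ℤ.- + 3) ⊠ (K 1ℤ ⊞ E₂) ⊙ J₃)
  (S.solve 8 (λ e₂ e₄ de₂ a b c da db →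
    # 2 :* (# 12 :* de₂) :* a :- # 2 :* (e₂ :* e₂ :- e₄) :* a :=
    con (ℤ.- + 24) :* (db :- (de₂ :* a :+ e₂ :* da)) :+ # 3 :* (# 8 :* db :+ b :- c) :+
    # 1 :* (# 3 :* c :- (# 5 :* e₂ :* e₂ :- # 2 :* e₄) :* a) :+
    con (ℤ.- + 3) :* e₂ :* (# 8 :* da :+ a :- b) :+
    con (ℤ.- + 3) :* (# 1 :+ e₂) :* (b :- e₂ :* a)) R.refl
    E₂ E₄ (D E₂) J₍ 1 ₎ J₍ 3 ₎ J₍ 5 ₎ (D J₍ 1 ₎) (D J₍ 3 ₎))))

D-K⊠⊠ : ∀ c F G → D (K c ⊠ F ⊠ G) ≈ K c ⊠ (D F ⊠ G ⊞ F ⊠ D G)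
D-K⊠⊠ c F G = R.trans (D-cong (R.*-assoc (K c) F G)) (R.trans (D-K⊠ c (F ⊠ G)) (⊠-congˡ (D-⊠ F G)))

-- The comparison behind `DE₂`, one step higher: D J₅ from the heat equation and from `J₅`.
DE₄ : K (+ 3) ⊠ D E₄ ≈ E₂ ⊠ E₄ ⊟ E₆
DE₄ = K-cancel (+ 16) (J₁-cancel (by-combination
  (K (ℤ.- 1ℤ) ⊙ J₇ & K (ℤ.- + 9) ⊙ heat-J 5 & K (+ 24) ⊙ DJ₅ & K (+ 3) ⊠ V ⊙ heat-J 1 &
   K (+ 3) ⊙ J₅ & K (+ 3) ⊠ V ⊙ J₃ & K (+ 20) ⊠ E₂ ⊠ J₍ 1 ₎ ⊙ DE₂)
  (S.solve 11 (λ e₂ e₄ e₆ de₂ de₄ a b c d da dc →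
    let v = # 5 :* e₂ :* e₂ :- # 2 :* e₄ in
    # 16 :* (# 3 :* de₄) :* a :- # 16 :* (e₂ :* e₄ :- e₆) :* a :=
    con (ℤ.- 1ℤ) :* (# 9 :* d :- (# 16 :* e₆ :- # 42 :* e₂ :* e₄ :+ # 35 :* e₂ :* e₂ :* e₂) :* a) :+
    con (ℤ.- + 9) :* (# 8 :* dc :+ c :- d) :+
    # 24 :* (# 3 :* dc :- ((# 5 :* (de₂ :* e₂ :+ e₂ :* de₂) :- # 2 :* de₄) :* a :+ v :* da)) :+
    # 3 :* v :* (# 8 :* da :+ a :- b) :+ # 3 :* (# 3 :* c :- v :* a) :+
    # 3 :* v :* (b :- e₂ :* a) :+
    # 20 :* e₂ :* a :* (# 12 :* de₂ :- (e₂ :* e₂ :- e₄))) R.refl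
    E₂ E₄ E₆ (D E₂) (D E₄) J₍ 1 ₎ J₍ 3 ₎ J₍ 5 ₎ J₍ 7 ₎ (D J₍ 1 ₎) (D J₍ 5 ₎))))
  where
  V : PowerSeries
  V = K (+ 5) ⊠ E₂ ⊠ E₂ ⊟ K (+ 2) ⊠ E₄
  DJ₅ : K (+ 3) ⊠ D J₍ 5 ₎ ≈ (K (+ 5) ⊠ (D E₂ ⊠ E₂ ⊞ E₂ ⊠ D E₂) ⊟ K (+ 2) ⊠ D E₄) ⊠ J₍ 1 ₎ ⊞ V ⊠ D J₍ 1 ₎
  DJ₅ = R.trans (R.sym (D-K⊠ (+ 3) J₍ 5 ₎)) (R.trans (D-cong J₅) (R.trans (D-⊠ V J₍ 1 ₎)
    (⊞-congʳ (⊠-congʳ (R.trans (D-⊟ (K (+ 5) ⊠ E₂ ⊠ E₂) (K (+ 2) ⊠ E₄))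
      (R.+-cong (D-K⊠⊠ (+ 5) E₂ E₂) (R.-‿cong (D-K⊠ (+ 2) E₄))))))))

sub-⊝ : ∀ k .{{_ : NonZero k}} F → sub k (⊝ F) ≈ ⊝ sub k F
sub-⊝ k F = R.trans (sub-cong k (neg F)) (R.trans (sub-K⊠ k (ℤ.- 1ℤ) F) (R.sym (neg (sub k F))))
  where
  neg : ∀ F → ⊝ F ≈ K (ℤ.- 1ℤ) ⊠ F
  neg F = S.solve 1 (λ x → :- x := con (ℤ.- 1ℤ) :* x) R.refl F

sub-⊟ : ∀ k .{{_ : NonZero k}} F G → sub k (F ⊟ G) ≈ sub k F ⊟ sub k G
sub-⊟ k F G = R.trans (sub-⊞ k F (⊝ G)) (⊞-congˡ (sub-⊝ k G))

DE₂′ : K (+ 6) ⊠ D E₂′ ≈ E₂′ ⊠ E₂′ ⊟ E₄′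
DE₂′ = R.trans (R.trans (⊠-congˡ (D-sub 2 E₂))
    (S.solve 1 (λ x → # 6 :* (# 2 :* x) := # 12 :* x) R.refl (sub 2 (D E₂))))
  (R.trans (R.sym (sub-K⊠ 2 (+ 12) (D E₂))) (R.trans (sub-cong 2 DE₂)
    (R.trans (sub-⊟ 2 (E₂ ⊠ E₂) E₄) (⊞-congʳ (sub-⊠ 2 E₂ E₂)))))

DE₄′ : K (+ 3) ⊠ D E₄′ ≈ K (+ 2) ⊠ (E₂′ ⊠ E₄′ ⊟ E₆′)
DE₄′ = R.trans (R.trans (⊠-congˡ (D-sub 2 E₄))
    (S.solve 1 (λ x → # 3 :* (# 2 :* x) := # 2 :* (# 3 :* x)) R.refl (sub 2 (D E₄))))
  (⊠-congˡ (R.trans (R.sym (sub-K⊠ 2 (+ 3) (D E₄))) (R.trans (sub-cong 2 DE₄)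
    (R.trans (sub-⊟ 2 (E₂ ⊠ E₄) E₆) (⊞-congʳ (sub-⊠ 2 E₂ E₄))))))

-- Level two

sub-K : ∀ k .{{_ : NonZero k}} c → sub k (K c) ≈ K c
sub-K k c = R.trans (sub-cong k (unit c)) (R.trans (sub-K⊠ k c one)
  (R.trans (⊠-congˡ (R.trans (sub-q^ k 0) (q^-≡ (ℕ.*-zeroʳ k)))) (R.sym (unit c))))
  where
  unit : ∀ c → K c ≈ K c ⊠ one
  unit c = R.sym (R.*-identityʳ (K c))

Λ-odd : ∀ m → Λ (suc (2 * m)) ≈ sub 2 (Λ m)
Λ-odd m = R.sym (R.trans (sub-Σ∞ 2 (Λ-bounded m)) (Σ∞-cong (λ d → R.trans (sub-q^ 2 (suc m * suc d)) (q^-≡ (e m d)))))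
  where
  e : ∀ m d → 2 * (suc m * suc d) ≡ suc (suc (2 * m)) * suc d
  e = ℕ-ring.solve-∀

-- Adding `S₍ b ₎` cancels the terms with odd m and doubles those with even m = 2m′, where m^b = 2^b
-- m′^b and the Lambert term is that of m′ at q².
N≈ : ∀ b → N₍ b ₎ ≈ ⊝ S₍ b ₎ ⊞ K ((+ 2) ℤ.^ suc b) ⊠ sub 2 S₍ b ₎
N≈ b = begin
  N₍ b ₎
    ≈⟨ S.solve 2 (λ n s → n := :- s :+ (n :+ s)) R.refl N₍ b ₎ S₍ b ₎ ⟩
  ⊝ S₍ b ₎ ⊞ (N₍ b ₎ ⊞ S₍ b ₎)
    ≈⟨ ⊞-congˡ (R.trans (R.sym (Σ∞-⊞ _ _)) (Σ∞-cong (λ m → R.trans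
         (R.sym (R.distribʳ (Λ m) (K (sgn (suc m) ℤ.* μ m)) (K (μ m)))) (⊠-congʳ (R.sym (K-+ (sgn (suc m) ℤ.* μ m) (μ m))))))) ⟩
  ⊝ S₍ b ₎ ⊞ Lam ν
    ≈⟨ ⊞-congˡ (R.trans (Σ∞-blocks 2 (Lam-bounded ν)) (Σ∞-cong block)) ⟩
  ⊝ S₍ b ₎ ⊞ Σ∞ (λ m → K ((+ 2) ℤ.^ suc b) ⊠ sub 2 (K (μ m) ⊠ Λ m))
    ≈⟨ ⊞-congˡ (R.trans (Σ∞-K ((+ 2) ℤ.^ suc b) (λ m → sub 2 (K (μ m) ⊠ Λ m)))
         (⊠-congˡ (R.sym (sub-Σ∞ 2 (Lam-bounded μ))))) ⟩
  ⊝ S₍ b ₎ ⊞ K ((+ 2) ℤ.^ suc b) ⊠ sub 2 S₍ b ₎ ∎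
  where
  open ≈-Reasoning
  μ ν : ℕ → ℤ
  μ m = (+ suc m) ℤ.^ b
  ν m = sgn (suc m) ℤ.* μ m ℤ.+ μ m
  sgn-even : ∀ m → sgn (2 * m) ≡ 1ℤ
  sgn-even m = trans (cong sgn (sym (double≡ m))) (sgn-double m)
  ν-even : ∀ m → ν (2 * m) ≡ 0ℤ
  ν-even m = trans (cong (λ s → ℤ.- s ℤ.* μ (2 * m) ℤ.+ μ (2 * m)) (sgn-even m)) (e (μ (2 * m)))
    where
    e : ∀ x → ℤ.- 1ℤ ℤ.* x ℤ.+ x ≡ 0ℤ
    e = solve-∀
  ν-odd : ∀ m → ν (suc (2 * m)) ≡ (+ 2) ℤ.^ suc b ℤ.* μ m
  ν-odd m = trans (cong₂ (λ s x → ℤ.- (ℤ.- s) ℤ.* x ℤ.+ x) (sgn-even m) power) (e ((+ 2) ℤ.^ b) (μ m))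
    where
    power : μ (suc (2 * m)) ≡ (+ 2) ℤ.^ b ℤ.* μ m
    power = trans (cong (ℤ._^ b) (trans (cong +_ (e′ m)) (ℤ.pos-* 2 (suc m)))) (^-distrib b (+ 2) (+ suc m))
      where
      e′ : ∀ m → suc (suc (2 * m)) ≡ 2 * suc m
      e′ = ℕ-ring.solve-∀
      ^-distrib : ∀ b x y → (x ℤ.* y) ℤ.^ b ≡ x ℤ.^ b ℤ.* y ℤ.^ b
      ^-distrib zero    x y = refl
      ^-distrib (suc b) x y = trans (cong (x ℤ.* y ℤ.*_) (^-distrib b x y)) (interchange x y (x ℤ.^ b) (y ℤ.^ b))
        where
        interchange : ∀ x y u v → x ℤ.* y ℤ.* (u ℤ.* v) ≡ x ℤ.* u ℤ.* (y ℤ.* v)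
        interchange = solve-∀
    e : ∀ t x → ℤ.- (ℤ.- 1ℤ) ℤ.* (t ℤ.* x) ℤ.+ t ℤ.* x ≡ + 2 ℤ.* t ℤ.* x
    e = solve-∀
  block : ∀ m → Σ< 2 (λ j → K (ν (2 * m + j)) ⊠ Λ (2 * m + j)) ≈ K ((+ 2) ℤ.^ suc b) ⊠ sub 2 (K (μ m) ⊠ Λ m)
  block m = begin
    Σ< 2 F
      ≈⟨ R.trans (Σ<-last 1 F) (⊞-congʳ (R.trans (Σ<-last 0 F) (R.trans (⊞-congʳ (Σ<-zero F)) (R.+-identityˡ (F 0))))) ⟩
    F 0 ⊞ F 1
      ≈⟨ R.+-cong (R.trans (R.reflexive (cong G (ℕ.+-identityʳ (2 * m)))) (⊠-congʳ (K-≡ (ν-even m))))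
           (R.trans (R.reflexive (cong G (ℕ.+-comm (2 * m) 1))) (R.*-cong (R.trans (K-≡ (ν-odd m)) (K-* ((+ 2) ℤ.^ suc b) (μ m))) (Λ-odd m))) ⟩
    K 0ℤ ⊠ Λ (2 * m) ⊞ K ((+ 2) ℤ.^ suc b) ⊠ K (μ m) ⊠ sub 2 (Λ m)
      ≈⟨ S.solve 4 (λ l k u s → # 0 :* l :+ k :* u :* s := k :* (u :* s)) R.refl
           (Λ (2 * m)) (K ((+ 2) ℤ.^ suc b)) (K (μ m)) (sub 2 (Λ m)) ⟩
    K ((+ 2) ℤ.^ suc b) ⊠ (K (μ m) ⊠ sub 2 (Λ m))
      ≈⟨ ⊠-congˡ (R.sym (sub-K⊠ 2 (μ m) (Λ m))) ⟩
    K ((+ 2) ℤ.^ suc b) ⊠ sub 2 (K (μ m) ⊠ Λ m) ∎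
    where
    F G : ℕ → PowerSeries
    F j = K (ν (2 * m + j)) ⊠ Λ (2 * m + j)
    G m = K (ν m) ⊠ Λ m

E₂′≈ : E₂′ ≈ K 1ℤ ⊟ K (+ 24) ⊠ sub 2 S₍ 1 ₎
E₂′≈ = R.trans (sub-⊟ 2 (K 1ℤ) (K (+ 24) ⊠ S₍ 1 ₎)) (R.+-cong (sub-K 2 1ℤ) (R.-‿cong (sub-K⊠ 2 (+ 24) S₍ 1 ₎)))

E₄′≈ : E₄′ ≈ K 1ℤ ⊞ K (+ 240) ⊠ sub 2 S₍ 3 ₎
E₄′≈ = R.trans (sub-⊞ 2 (K 1ℤ) (K (+ 240) ⊠ S₍ 3 ₎)) (R.+-cong (sub-K 2 1ℤ) (sub-K⊠ 2 (+ 240) S₍ 3 ₎))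

E₆′≈ : E₆′ ≈ K 1ℤ ⊟ K (+ 504) ⊠ sub 2 S₍ 5 ₎
E₆′≈ = R.trans (sub-⊟ 2 (K 1ℤ) (K (+ 504) ⊠ S₍ 5 ₎)) (R.+-cong (sub-K 2 1ℤ) (R.-‿cong (sub-K⊠ 2 (+ 504) S₍ 5 ₎)))

-- The first three are the alternating Lambert series of weights 1, 3, 5, normalized to have no
-- denominators. `X` is the combination in which the quasimodular anomaly of `E₂` cancels: a modular
-- form of weight 2 and level 2.
H L₄ L₆ X : PowerSeries
H  = K (+ 4) ⊠ E₂′ ⊟ E₂
L₄ = K (+ 2) ⊠ E₄ ⊟ K (+ 32) ⊠ E₄′
L₆ = K (+ 1024) ⊠ E₆′ ⊟ K (+ 16) ⊠ E₆
X  = K (+ 2) ⊠ E₂′ ⊟ E₂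

H≈ : H ≈ K (+ 3) ⊟ K (+ 24) ⊠ N₍ 1 ₎
H≈ = by-combination (K (+ 4) ⊙ E₂′≈ & K (+ 24) ⊙ N≈ 1)
  (S.solve 4 (λ e n s s′ → # 4 :* e :- (# 1 :- # 24 :* s) :- (# 3 :- # 24 :* n) :=
    # 4 :* (e :- (# 1 :- # 24 :* s′)) :+ # 24 :* (n :- (:- s :+ # 4 :* s′))) R.refl
    E₂′ N₍ 1 ₎ S₍ 1 ₎ (sub 2 S₍ 1 ₎))

L₄≈ : L₄ ≈ ⊝ (K (+ 30) ⊞ K (+ 480) ⊠ N₍ 3 ₎)
L₄≈ = by-combination (⊝ K (+ 32) ⊙ E₄′≈ & K (+ 480) ⊙ N≈ 3)
  (S.solve 4 (λ e n s s′ → # 2 :* (# 1 :+ # 240 :* s) :- # 32 :* e :- (:- (# 30 :+ # 480 :* n)) :=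
    (:- # 32) :* (e :- (# 1 :+ # 240 :* s′)) :+ # 480 :* (n :- (:- s :+ # 16 :* s′))) R.refl
    E₄′ N₍ 3 ₎ S₍ 3 ₎ (sub 2 S₍ 3 ₎))

L₆≈ : L₆ ≈ K (+ 1008) ⊟ K (+ 8064) ⊠ N₍ 5 ₎
L₆≈ = by-combination (K (+ 1024) ⊙ E₆′≈ & K (+ 8064) ⊙ N≈ 5)
  (S.solve 4 (λ e n s s′ → # 1024 :* e :- # 16 :* (# 1 :- # 504 :* s) :- (# 1008 :- # 8064 :* n) :=
    # 1024 :* (e :- (# 1 :- # 504 :* s′)) :+ # 8064 :* (n :- (:- s :+ # 64 :* s′))) R.refl
    E₆′ N₍ 5 ₎ S₍ 5 ₎ (sub 2 S₍ 5 ₎))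

Ψ₂ : K (+ 3) ⊠ Ψ₍ 2 ₎ ≈ H ⊠ Ψ₍ 0 ₎
Ψ₂ = by-combination (K (+ 3) ⊙ Ψ-relation₁ & ⊝ Ψ₍ 0 ₎ ⊙ H≈)
  (S.solve 4 (λ h n a b → # 3 :* b :- h :* a :=
    # 3 :* (# 2 :* (# 4 :* (a :* n)) :- (a :- b)) :+ (:- a) :* (h :- (# 3 :- # 24 :* n))) R.refl
    H N₍ 1 ₎ Ψ₍ 0 ₎ Ψ₍ 2 ₎)

Ψ₄ : K (+ 15) ⊠ Ψ₍ 4 ₎ ≈ K (+ 15) ⊠ H ⊠ Ψ₍ 2 ₎ ⊞ L₄ ⊠ Ψ₍ 0 ₎
Ψ₄ = by-combination (K (+ 15) ⊙ Ψ-relation₃ & ⊝ (K (+ 15) ⊠ Ψ₍ 2 ₎) ⊙ H≈ & ⊝ Ψ₍ 0 ₎ ⊙ L₄≈)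
  (S.solve 7 (λ h l n₁ n₃ a b c → # 15 :* c :- (# 15 :* h :* b :+ l :* a) :=
    # 15 :* (# 2 :* (# 12 :* (b :* n₁) :+ # 16 :* (a :* n₃)) :-
      (# 3 :* b :+ (con (ℤ.- + 2) :* a :+ con (ℤ.- 1ℤ) :* c))) :+
    (:- (# 15 :* b)) :* (h :- (# 3 :- # 24 :* n₁)) :+
    (:- a) :* (l :- (:- (# 30 :+ # 480 :* n₃)))) R.refl
    H L₄ N₍ 1 ₎ N₍ 3 ₎ Ψ₍ 0 ₎ Ψ₍ 2 ₎ Ψ₍ 4 ₎)

Ψ₆ : K (+ 63) ⊠ Ψ₍ 6 ₎ ≈ K (+ 105) ⊠ H ⊠ Ψ₍ 4 ₎ ⊞ K (+ 42) ⊠ L₄ ⊠ Ψ₍ 2 ₎ ⊞ L₆ ⊠ Ψ₍ 0 ₎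
Ψ₆ = by-combination (K (+ 63) ⊙ Ψ-relation₅ & ⊝ (K (+ 105) ⊠ Ψ₍ 4 ₎) ⊙ H≈ & ⊝ (K (+ 42) ⊠ Ψ₍ 2 ₎) ⊙ L₄≈ & ⊝ Ψ₍ 0 ₎ ⊙ L₆≈)
  (S.solve 10 (λ h l m n₁ n₃ n₅ a b c d → # 63 :* d :- (# 105 :* h :* c :+ # 42 :* l :* b :+ m :* a) :=
    # 63 :* (# 2 :* (# 20 :* (c :* n₁) :+ (# 160 :* (b :* n₃) :+ # 64 :* (a :* n₅))) :-
      (con (ℤ.- 1ℤ) :* d :+ (# 5 :* c :+ (con (ℤ.- + 20) :* b :+ # 16 :* a)))) :+
    (:- (# 105 :* c)) :* (h :- (# 3 :- # 24 :* n₁)) :+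
    (:- (# 42 :* b)) :* (l :- (:- (# 30 :+ # 480 :* n₃))) :+
    (:- a) :* (m :- (# 1008 :- # 8064 :* n₅))) R.refl
    H L₄ L₆ N₍ 1 ₎ N₍ 3 ₎ N₍ 5 ₎ Ψ₍ 0 ₎ Ψ₍ 2 ₎ Ψ₍ 4 ₎ Ψ₍ 6 ₎)

DH : D H ≈ K (+ 4) ⊠ D E₂′ ⊟ D E₂
DH = R.trans (D-⊟ (K (+ 4) ⊠ E₂′) E₂) (⊞-congʳ (D-K⊠ (+ 4) E₂′))

DX : D X ≈ K (+ 2) ⊠ D E₂′ ⊟ D E₂
DX = R.trans (D-⊟ (K (+ 2) ⊠ E₂′) E₂) (⊞-congʳ (D-K⊠ (+ 2) E₂′))

DL₄ : D L₄ ≈ K (+ 2) ⊠ D E₄ ⊟ K (+ 32) ⊠ D E₄′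
DL₄ = R.trans (D-⊟ (K (+ 2) ⊠ E₄) (K (+ 32) ⊠ E₄′)) (R.+-cong (D-K⊠ (+ 2) E₄) (R.-‿cong (D-K⊠ (+ 32) E₄′)))

-- D Ψ₂ computed from the heat equation and from 3 Ψ₂ = H Ψ₀, with Ψ₀ cancelled.
DH-Ψ : K (+ 120) ⊠ D H ≈ K (+ 10) ⊠ H ⊠ H ⊞ K (+ 3) ⊠ L₄
DH-Ψ = Ψ₀-cancel (by-combination
  (⊝ K (+ 120) ⊙ R.trans (R.sym (D-K⊠ (+ 3) Ψ₍ 2 ₎)) (R.trans (D-cong Ψ₂) (D-⊠ H Ψ₍ 0 ₎)) & K (+ 45) ⊙ heat-Ψ 2 &
   K (+ 3) ⊙ Ψ₄ & ⊝ (K (+ 15) ⊠ H) ⊙ heat-Ψ 0 & K (+ 10) ⊠ H ⊟ K (+ 15) ⊙ Ψ₂)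
  (S.solve 8 (λ h dh l a b c da db →
    # 120 :* dh :* a :- (# 10 :* h :* h :+ # 3 :* l) :* a :=
    (:- # 120) :* (# 3 :* db :- (dh :* a :+ h :* da)) :+ # 45 :* (# 8 :* db :+ b :- c) :+
    # 3 :* (# 15 :* c :- (# 15 :* h :* b :+ l :* a)) :+
    (:- (# 15 :* h)) :* (# 8 :* da :+ a :- b) :+
    (# 10 :* h :- # 15) :* (# 3 :* b :- h :* a)) R.refl
    H (D H) L₄ Ψ₍ 0 ₎ Ψ₍ 2 ₎ Ψ₍ 4 ₎ (D Ψ₍ 0 ₎) (D Ψ₍ 2 ₎)))

-- `D H` is now known in two ways, from the moments `Ψ` and from Ramanujan's equations at q and q²;
-- the comparison leaves an algebraic relation.
X² : K (+ 5) ⊠ X ⊠ X ≈ E₄ ⊞ K (+ 4) ⊠ E₄′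
X² = K-cancel (+ 4) (by-combination
  (⊝ K 1ℤ ⊙ DH-Ψ & K (+ 120) ⊙ DH & K (+ 80) ⊙ DE₂′ & ⊝ K (+ 10) ⊙ DE₂)
  (S.solve 7 (λ p p′ q q′ dp dp′ dh →
    let x = # 2 :* p′ :- p; h = # 4 :* p′ :- p; l = # 2 :* q :- # 32 :* q′ in
    # 4 :* (# 5 :* x :* x) :- # 4 :* (q :+ # 4 :* q′) :=
    (:- # 1) :* (# 120 :* dh :- (# 10 :* h :* h :+ # 3 :* l)) :+
    # 120 :* (dh :- (# 4 :* dp′ :- dp)) :+ # 80 :* (# 6 :* dp′ :- (p′ :* p′ :- q′)) :+
    (:- # 10) :* (# 12 :* dp :- (p :* p :- q))) R.refl
    E₂ E₂′ E₄ E₄′ (D E₂) (D E₂′) (D H)))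

-- The derivative of `X²`, with all derivatives replaced by Ramanujan's equations.
X³ : K (+ 8) ⊠ E₆′ ⊞ E₆ ≈ K (+ 15) ⊠ X ⊠ X ⊠ X ⊟ K (+ 6) ⊠ X ⊠ E₄
X³ = K-cancel (+ 4) (by-combination
  (K (+ 12) ⊙ DX² & ⊝ (K (+ 120) ⊠ X) ⊙ DX & ⊝ (K (+ 40) ⊠ X) ⊙ DE₂′ & K (+ 10) ⊠ X ⊙ DE₂ &
   K (+ 4) ⊙ DE₄ & K (+ 16) ⊙ DE₄′ & ⊝ (K (+ 8) ⊠ E₂′ ⊞ K (+ 10) ⊠ X) ⊙ X²)
  (S.solve 11 (λ p p′ q q′ r r′ dp dp′ dq dq′ dx →
    let x = # 2 :* p′ :- p in
    # 4 :* (# 8 :* r′ :+ r) :- # 4 :* (# 15 :* x :* x :* x :- # 6 :* x :* q) :=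
    # 12 :* (# 5 :* (dx :* x :+ x :* dx) :- (dq :+ # 4 :* dq′)) :+
    (:- (# 120 :* x)) :* (dx :- (# 2 :* dp′ :- dp)) :+
    (:- (# 40 :* x)) :* (# 6 :* dp′ :- (p′ :* p′ :- q′)) :+
    # 10 :* x :* (# 12 :* dp :- (p :* p :- q)) :+
    # 4 :* (# 3 :* dq :- (p :* q :- r)) :+
    # 16 :* (# 3 :* dq′ :- # 2 :* (p′ :* q′ :- r′)) :+
    (:- (# 8 :* p′ :+ # 10 :* x)) :* (# 5 :* x :* x :- (q :+ # 4 :* q′))) R.refl
    E₂ E₂′ E₄ E₄′ E₆ E₆′ (D E₂) (D E₂′) (D E₄) (D E₄′) (D X)))
  where
  DX² : K (+ 5) ⊠ (D X ⊠ X ⊞ X ⊠ D X) ≈ D E₄ ⊞ K (+ 4) ⊠ D E₄′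
  DX² = R.trans (R.sym (D-K⊠⊠ (+ 5) X X)) (R.trans (D-cong X²)
    (R.trans (D-⊞ E₄ (K (+ 4) ⊠ E₄′)) (⊞-congˡ (D-K⊠ (+ 4) E₄′))))

DL₄-Ψ : K (+ 504) ⊠ D L₄ ≈ K (+ 168) ⊠ H ⊠ L₄ ⊞ K (+ 15) ⊠ L₆
DL₄-Ψ = by-combination (K 1ℤ ⊙ DM & ⊝ (K (+ 42) ⊠ H) ⊙ DH-Ψ)
  (S.solve 5 (λ h l m dh dl →
    # 504 :* dl :- (# 168 :* h :* l :+ # 15 :* m) :=
    # 1 :* (# 504 :* (# 5 :* (dh :* h :+ h :* dh) :+ dl) :-
      (# 84 :* h :* (# 5 :* h :* h :+ l) :+ # 210 :* h :* l :+ # 15 :* m)) :+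
    (:- (# 42 :* h)) :* (# 120 :* dh :- (# 10 :* h :* h :+ # 3 :* l))) R.refl
    H L₄ L₆ (D H) (D L₄))
  where
  M dM : PowerSeries
  M  = K (+ 5) ⊠ H ⊠ H ⊞ L₄
  dM = K (+ 5) ⊠ (D H ⊠ H ⊞ H ⊠ D H) ⊞ D L₄
  Ψ₄′ : K (+ 15) ⊠ Ψ₍ 4 ₎ ≈ M ⊠ Ψ₍ 0 ₎
  Ψ₄′ = by-combination (K 1ℤ ⊙ Ψ₄ & K (+ 5) ⊠ H ⊙ Ψ₂)
    (S.solve 5 (λ h l a b c → # 15 :* c :- (# 5 :* h :* h :+ l) :* a :=
      # 1 :* (# 15 :* c :- (# 15 :* h :* b :+ l :* a)) :+ # 5 :* h :* (# 3 :* b :- h :* a)) R.refl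
      H L₄ Ψ₍ 0 ₎ Ψ₍ 2 ₎ Ψ₍ 4 ₎)
  DΨ₄ : K (+ 15) ⊠ D Ψ₍ 4 ₎ ≈ dM ⊠ Ψ₍ 0 ₎ ⊞ M ⊠ D Ψ₍ 0 ₎
  DΨ₄ = R.trans (R.sym (D-K⊠ (+ 15) Ψ₍ 4 ₎)) (R.trans (D-cong Ψ₄′) (R.trans (D-⊠ M Ψ₍ 0 ₎)
    (⊞-congʳ (⊠-congʳ (R.trans (D-⊞ (K (+ 5) ⊠ H ⊠ H) L₄) (⊞-congʳ (D-K⊠⊠ (+ 5) H H)))))))
  DM : K (+ 504) ⊠ dM ≈ K (+ 84) ⊠ H ⊠ M ⊞ K (+ 210) ⊠ H ⊠ L₄ ⊞ K (+ 15) ⊠ L₆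
  DM = Ψ₀-cancel (by-combination
    (⊝ K (+ 504) ⊙ DΨ₄ & K (+ 945) ⊙ heat-Ψ 4 & K (+ 15) ⊙ Ψ₆ & ⊝ (K (+ 63) ⊠ M) ⊙ heat-Ψ 0 &
     K (+ 105) ⊠ H ⊟ K (+ 63) ⊙ Ψ₄′ & K (+ 210) ⊠ L₄ ⊟ K (+ 21) ⊠ M ⊙ Ψ₂)
    (S.solve 11 (λ h l w m dm a b c d da dc →
      # 504 :* dm :* a :- (# 84 :* h :* m :+ # 210 :* h :* l :+ # 15 :* w) :* a :=
      (:- # 504) :* (# 15 :* dc :- (dm :* a :+ m :* da)) :+
      # 945 :* (# 8 :* dc :+ c :- d) :+
      # 15 :* (# 63 :* d :- (# 105 :* h :* c :+ # 42 :* l :* b :+ w :* a)) :+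
      (:- (# 63 :* m)) :* (# 8 :* da :+ a :- b) :+
      (# 105 :* h :- # 63) :* (# 15 :* c :- m :* a) :+
      (# 210 :* l :- # 21 :* m) :* (# 3 :* b :- h :* a)) R.refl
      H L₄ L₆ M dM Ψ₍ 0 ₎ Ψ₍ 2 ₎ Ψ₍ 4 ₎ Ψ₍ 6 ₎ (D Ψ₍ 0 ₎) (D Ψ₍ 4 ₎)))

-- `X³` alone does not separate `E₆` from `E₆′`; the two expressions for `D L₄` supply a second
-- relation.
X³′ : K (+ 7) ⊠ X ⊠ (K (+ 10) ⊠ X ⊠ X ⊟ K (+ 3) ⊠ E₄) ≈ K (+ 48) ⊠ E₆′ ⊞ E₆
X³′ = K-cancel (+ 96) (by-combination
  (K 1ℤ ⊙ DL₄-Ψ & ⊝ K (+ 504) ⊙ DL₄ & ⊝ K (+ 336) ⊙ DE₄ & K (+ 5376) ⊙ DE₄′ & K (+ 1344) ⊠ X ⊙ X²)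
  (S.solve 9 (λ p p′ q q′ r r′ dq dq′ dl →
    let x = # 2 :* p′ :- p; h = # 4 :* p′ :- p; l = # 2 :* q :- # 32 :* q′ in
    # 96 :* (# 7 :* x :* (# 10 :* x :* x :- # 3 :* q)) :- # 96 :* (# 48 :* r′ :+ r) :=
    # 1 :* (# 504 :* dl :- (# 168 :* h :* l :+ # 15 :* (# 1024 :* r′ :- # 16 :* r))) :+
    (:- # 504) :* (dl :- (# 2 :* dq :- # 32 :* dq′)) :+
    (:- # 336) :* (# 3 :* dq :- (p :* q :- r)) :+
    # 5376 :* (# 3 :* dq′ :- # 2 :* (p′ :* q′ :- r′)) :+
    # 1344 :* x :* (# 5 :* x :* x :- (q :+ # 4 :* q′))) R.refl
    E₂ E₂′ E₄ E₄′ E₆ E₆′ (D E₄) (D E₄′) (D L₄)))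

-- Elimination of `E₆′` between `X³` and `X³′`.
E₆-X : E₆ ≈ K (+ 4) ⊠ X ⊠ X ⊠ X ⊟ K (+ 3) ⊠ X ⊠ E₄
E₆-X = K-cancel (+ 5) (by-combination (K (+ 6) ⊙ X³ & K 1ℤ ⊙ X³′)
  (S.solve 4 (λ x q r r′ →
    # 5 :* r :- # 5 :* (# 4 :* x :* x :* x :- # 3 :* x :* q) :=
    # 6 :* (# 8 :* r′ :+ r :- (# 15 :* x :* x :* x :- # 6 :* x :* q)) :+
    # 1 :* (# 7 :* x :* (# 10 :* x :* x :- # 3 :* q) :- (# 48 :* r′ :+ r))) R.refl
    X E₄ E₆ E₆′))

-- Eta quotients and theta series

f₁ f₂ : PowerSeries
f₁ = f 1
f₂ = f 2

Df₁ : D f₁ ≈ ⊝ (S₍ 1 ₎ ⊠ f₁)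
Df₁ = R.trans D-f (R.-‿cong (⊠-congʳ (Σ∞-cong (λ m → ⊠-congʳ (K-≡ (sym (ℤ.*-identityʳ (+ suc m))))))))

Df : ∀ k .{{_ : NonZero k}} → D (f k) ≈ ⊝ (K (+ k) ⊠ sub k S₍ 1 ₎ ⊠ f k)
Df k = begin
  D (f k)
    ≈⟨ D-cong (R.sym (sub-f k)) ⟩
  D (sub k f₁)
    ≈⟨ R.trans (D-sub k f₁) (⊠-congˡ (R.trans (sub-cong k Df₁) (R.trans (sub-⊝ k (S₍ 1 ₎ ⊠ f₁)) (R.-‿cong (sub-⊠ k S₍ 1 ₎ f₁))))) ⟩
  K (+ k) ⊠ ⊝ (sub k S₍ 1 ₎ ⊠ sub k f₁)
    ≈⟨ ⊠-congˡ (R.-‿cong (⊠-congˡ (sub-f k))) ⟩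
  K (+ k) ⊠ ⊝ (sub k S₍ 1 ₎ ⊠ f k)
    ≈⟨ S.solve 3 (λ k s g → k :* (:- (s :* g)) := :- (k :* s :* g)) R.refl (K (+ k)) (sub k S₍ 1 ₎) (f k) ⟩
  ⊝ (K (+ k) ⊠ sub k S₍ 1 ₎ ⊠ f k) ∎
  where open ≈-Reasoning

K⊠-0 : ∀ c {F} → F 0 ≡ 0ℤ → (K c ⊠ F) 0 ≡ 0ℤ
K⊠-0 c {F} F₀ = trans (K-⊠ c F 0) (trans (cong (c ℤ.*_) F₀) (ℤ.*-zeroʳ c))

⊠-1 : ∀ {F G} → F 0 ≡ 1ℤ → G 0 ≡ 1ℤ → (F ⊠ G) 0 ≡ 1ℤ
⊠-1 {F} {G} F₀ G₀ = trans (at (⊠-at F G) 0) (cong₂ (λ a b → a ℤ.* b ℤ.+ 0ℤ) F₀ G₀)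

-- Both sides have the logarithmic derivative - 3 S₁: on the right the heat equation and J₃ = E₂ J₁
-- give D J₁ = (E₂ - 1) J₁ / 8. The sign comes from τ₁ = - 1.
jacobi : f₁ ⊠ f₁ ⊠ f₁ ≈ ⊝ J₍ 1 ₎
jacobi = D-unique {V = K (ℤ.- + 3) ⊠ S₍ 1 ₎} (K⊠-0 (ℤ.- + 3) (Lam-0 _)) cube minus-J
  (trans (⊠-1 {f₁ ⊠ f₁} {f₁} (⊠-1 {f₁} {f₁} refl refl) refl) (sym (trans (⊝-at J₍ 1 ₎ 0) (cong ℤ.-_ (Θ-0 _)))))
  where
  cube : D (f₁ ⊠ f₁ ⊠ f₁) ≈ K (ℤ.- + 3) ⊠ S₍ 1 ₎ ⊠ (f₁ ⊠ f₁ ⊠ f₁)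
  cube = R.trans (R.trans (D-⊠ (f₁ ⊠ f₁) f₁) (⊞-congʳ (⊠-congʳ (D-⊠ f₁ f₁))))
    (by-combination (K (+ 3) ⊠ f₁ ⊠ f₁ ⊙ Df₁)
      (S.solve 3 (λ g dg s → (dg :* g :+ g :* dg) :* g :+ g :* g :* dg :- con (ℤ.- + 3) :* s :* (g :* g :* g) :=
        # 3 :* g :* g :* (dg :- :- (s :* g))) R.refl f₁ (D f₁) S₍ 1 ₎))
  minus-J : D (⊝ J₍ 1 ₎) ≈ K (ℤ.- + 3) ⊠ S₍ 1 ₎ ⊠ ⊝ J₍ 1 ₎
  minus-J = R.trans (D-⊝ J₍ 1 ₎) (K-cancel (+ 8) (by-combination (⊝ K 1ℤ ⊙ heat-J 1 & ⊝ K 1ℤ ⊙ J₃)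
    (S.solve 4 (λ a b da s → # 8 :* (:- da) :- # 8 :* (con (ℤ.- + 3) :* s :* (:- a)) :=
      (:- # 1) :* (# 8 :* da :+ a :- b) :+ (:- # 1) :* (b :- (# 1 :- # 24 :* s) :* a)) R.refl
      J₍ 1 ₎ J₍ 3 ₎ (D J₍ 1 ₎) S₍ 1 ₎)))

-- Gauss's product for ∑ q^(n(n+1)/2): both sides have the logarithmic derivative - 4 S₁(q²).
f₁Ψ₀ : f₁ ⊠ Ψ₍ 0 ₎ ≈ f₂ ⊠ f₂
f₁Ψ₀ = D-unique {V = K (ℤ.- + 4) ⊠ sub 2 S₍ 1 ₎} (K⊠-0 (ℤ.- + 4) (trans (sub-multiple 2 S₍ 1 ₎ 0) (Lam-0 _)))
  left right (trans (⊠-1 {f₁} {Ψ₍ 0 ₎} refl (Θ-0 _)) (sym (⊠-1 {f₂} {f₂} refl refl)))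
  where
  left : D (f₁ ⊠ Ψ₍ 0 ₎) ≈ K (ℤ.- + 4) ⊠ sub 2 S₍ 1 ₎ ⊠ (f₁ ⊠ Ψ₍ 0 ₎)
  left = R.trans (D-⊠ f₁ Ψ₍ 0 ₎) (K-cancel (+ 24) (by-combination
    (K (+ 24) ⊠ Ψ₍ 0 ₎ ⊙ Df₁ & K (+ 3) ⊠ f₁ ⊙ heat-Ψ 0 & f₁ ⊙ Ψ₂ & K (+ 4) ⊠ f₁ ⊠ Ψ₍ 0 ₎ ⊙ E₂′≈)
    (S.solve 8 (λ g dg a b da s s′ e′ →
      # 24 :* (dg :* a :+ g :* da) :- # 24 :* (con (ℤ.- + 4) :* s′ :* (g :* a)) :=
      # 24 :* a :* (dg :- :- (s :* g)) :+ # 3 :* g :* (# 8 :* da :+ a :- b) :+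
      g :* (# 3 :* b :- (# 4 :* e′ :- (# 1 :- # 24 :* s)) :* a) :+
      # 4 :* g :* a :* (e′ :- (# 1 :- # 24 :* s′))) R.refl
      f₁ (D f₁) Ψ₍ 0 ₎ Ψ₍ 2 ₎ (D Ψ₍ 0 ₎) S₍ 1 ₎ (sub 2 S₍ 1 ₎) E₂′)))
  right : D (f₂ ⊠ f₂) ≈ K (ℤ.- + 4) ⊠ sub 2 S₍ 1 ₎ ⊠ (f₂ ⊠ f₂)
  right = R.trans (D-⊠ f₂ f₂) (by-combination (K (+ 2) ⊠ f₂ ⊙ Df 2)
    (S.solve 3 (λ g dg s → dg :* g :+ g :* dg :- con (ℤ.- + 4) :* s :* (g :* g) :=
      # 2 :* g :* (dg :- :- (# 2 :* s :* g))) R.refl f₂ (D f₂) (sub 2 S₍ 1 ₎)))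

sgn-triple : ∀ k → sgn (3 * k) ≡ sgn k
sgn-triple zero    = refl
sgn-triple (suc k) = trans (cong sgn (e k)) (trans (ℤ.neg-involutive _) (cong ℤ.-_ (sgn-triple k)))
  where
  e : ∀ k → 3 * suc k ≡ 3 + 3 * k
  e = ℕ-ring.solve-∀

f₁-Pent : f₁ ≈ Pent sgn (λ k → sgn (suc k))
f₁-Pent = begin
  f₁
    ≈⟨ pentagonal ⟩
  one ⊞ Σ∞ pentagonal-term
    ≈⟨ ⊞-congˡ (R.trans (Σ∞-cong (λ k → R.distribˡ (K (sgn (suc k))) (q^ pent′ k) (q^ pent (suc k)))) (Σ∞-⊞ B (A ∘ suc))) ⟩
  one ⊞ (Σ∞ B ⊞ Σ∞ (A ∘ suc))
    ≈⟨ S.solve 3 (λ x a b → x :+ (b :+ a) := (# 1 :* x :+ a) :+ b) R.refl one (Σ∞ (A ∘ suc)) (Σ∞ B) ⟩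
  (K 1ℤ ⊠ one ⊞ Σ∞ (A ∘ suc)) ⊞ Σ∞ B
    ≈⟨ ⊞-congʳ (R.sym (Σ∞-suc (λ k → Ord-⊠ʳ (K (sgn k)) (Ord-q^ (ℕ.≤-trans ℕ.pred[n]≤n (k≤pent k)))))) ⟩
  Σ∞ A ⊞ Σ∞ B
    ≈⟨ R.sym (Σ∞-⊞ A B) ⟩
  Pent sgn (λ k → sgn (suc k)) ∎
  where
  open ≈-Reasoning
  A B : ℕ → PowerSeries
  A k = K (sgn k) ⊠ q^ pent k
  B k = K (sgn (suc k)) ⊠ q^ pent′ k

Pent-cong : ∀ {u u′ v v′} → (∀ k → u k ≡ u′ k) → (∀ k → v k ≡ v′ k) → Pent u v ≈ Pent u′ v′
Pent-cong p r = Σ∞-cong (λ k → R.+-cong (⊠-congʳ (K-≡ (p k))) (⊠-congʳ (K-≡ (r k))))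

-- The quintuple product identity summed over s with the alternating weight; the weight `y` gives
-- `φJ₁` instead.
φΨ₀ : φ ⊠ Ψ₍ 0 ₎ ≈ f₂ ⊠ f₁
φΨ₀ = R.trans (⊠-congˡ (Θ-cong (λ i → ℤ.*-identityʳ (sgn (suc i)))))
  (R.trans (φ-pentagonal sgnℤ odd affine) (⊠-congˡ (R.trans (Pent-cong
     (λ k → trans (ℤ.neg-involutive _) (sgn-triple k))
     (λ k → trans (ℤ.neg-involutive _) (cong ℤ.-_ (sgn-triple k)))) (R.sym f₁-Pent))))
  where
  odd : ∀ z → sgnℤ (1ℤ ℤ.- z) ≡ ℤ.- 1ℤ ℤ.* sgnℤ z
  odd z = trans (sgnℤ-reflect z) (e (sgnℤ z))
    where
    e : ∀ s → ℤ.- s ≡ ℤ.- 1ℤ ℤ.* s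
    e = solve-∀
  affine : ∀ z m → sgnℤ (z ℤ.+ + double m) ℤ.- ℤ.- 1ℤ ℤ.* sgnℤ (z ℤ.- + double m) ≡ + 2 ℤ.* sgnℤ z
  affine z m = trans (cong₂ (λ a b → a ℤ.- ℤ.- 1ℤ ℤ.* b)
      (trans (sgnℤ-+ z (double m)) (cong (sgnℤ z ℤ.*_) (sgn-double m)))
      (trans (sgnℤ-∸ z (double m)) (cong (sgnℤ z ℤ.*_) (sgn-double m)))) (e (sgnℤ z))
    where
    e : ∀ s → s ℤ.* 1ℤ ℤ.- ℤ.- 1ℤ ℤ.* (s ℤ.* 1ℤ) ≡ + 2 ℤ.* s
    e = solve-∀

θ : PowerSeries
θ = Pent (λ k → y (+ (1 + 3 * k))) (λ k → ℤ.- y (+ (3 + 3 * k)))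

φJ₁ : φ ⊠ J₍ 1 ₎ ≈ ⊝ (f₂ ⊠ θ)
φJ₁ = begin
  φ ⊠ J₍ 1 ₎
    ≈⟨ ⊠-congˡ (Θ-cong (λ i → ℤ.*-identityʳ (y (+ suc i)))) ⟩
  φ ⊠ Θ (λ i → y (+ suc i))
    ≈⟨ φ-pentagonal y odd (λ z m → affine z (+ double m)) ⟩
  f₂ ⊠ Pent (λ k → ℤ.- y (+ (1 + 3 * k))) (λ k → y (+ (3 + 3 * k)))
    ≈⟨ ⊠-congˡ (R.trans (Σ∞-cong (λ k → negate (y (+ (1 + 3 * k))) (y (+ (3 + 3 * k))) (q^ pent k) (q^ pent′ k)))
         (Σ∞-⊝ (λ k → K (y (+ (1 + 3 * k))) ⊠ q^ pent k ⊞ K (ℤ.- y (+ (3 + 3 * k))) ⊠ q^ pent′ k))) ⟩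
  f₂ ⊠ ⊝ θ
    ≈⟨ S.solve 2 (λ g t → g :* (:- t) := :- (g :* t)) R.refl f₂ θ ⟩
  ⊝ (f₂ ⊠ θ) ∎
  where
  open ≈-Reasoning
  odd : ∀ z → y (1ℤ ℤ.- z) ≡ ℤ.- 1ℤ ℤ.* y z
  odd = e
    where
    e : ∀ z → + 2 ℤ.* (1ℤ ℤ.- z) ℤ.- 1ℤ ≡ ℤ.- 1ℤ ℤ.* (+ 2 ℤ.* z ℤ.- 1ℤ)
    e = solve-∀
  affine : ∀ z m → y (z ℤ.+ m) ℤ.- ℤ.- 1ℤ ℤ.* y (z ℤ.- m) ≡ + 2 ℤ.* y z
  affine = e
    where
    e : ∀ z m → (+ 2 ℤ.* (z ℤ.+ m) ℤ.- 1ℤ) ℤ.- ℤ.- 1ℤ ℤ.* (+ 2 ℤ.* (z ℤ.- m) ℤ.- 1ℤ) ≡ + 2 ℤ.* (+ 2 ℤ.* z ℤ.- 1ℤ)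
    e = solve-∀
  negate : ∀ a b F G → K (ℤ.- a) ⊠ F ⊞ K b ⊠ G ≈ ⊝ (K a ⊠ F ⊞ K (ℤ.- b) ⊠ G)
  negate a b F G = R.trans (⊞-congʳ (⊠-congʳ (K-neg a)))
    (R.trans (S.solve 4 (λ a b f g → (:- a) :* f :+ b :* g := :- (a :* f :+ (:- b) :* g)) R.refl (K a) (K b) F G)
      (R.-‿cong (⊞-congˡ (⊠-congʳ (R.sym (K-neg b))))))

φf₂ : φ ⊠ f₂ ≈ f₁ ⊠ f₁
φf₂ = ⊠-cancelˡ f₂ refl (by-combination (⊝ φ ⊙ f₁Ψ₀ & f₁ ⊙ φΨ₀)
  (S.solve 4 (λ g h p w → h :* (p :* h) :- h :* (g :* g) := (:- p) :* (g :* w :- h :* h) :+ g :* (p :* w :- h :* g)) R.refl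
    f₁ f₂ φ Ψ₍ 0 ₎))

-- The chain f₂ (f₂ θ) = - f₂ φ J₁ = f₂ φ f₁³ = f₁² f₁³.
f₂²θ : f₂ ⊠ f₂ ⊠ θ ≈ f₁ ⊠ f₁ ⊠ f₁ ⊠ f₁ ⊠ f₁
f₂²θ = by-combination (f₂ ⊙ φJ₁ & ⊝ (f₂ ⊠ φ) ⊙ jacobi & f₁ ⊠ f₁ ⊠ f₁ ⊙ φf₂)
  (S.solve 5 (λ g h p t j → h :* h :* t :- g :* g :* g :* g :* g :=
    h :* (p :* j :- :- (h :* t)) :+ (:- (h :* p)) :* (g :* g :* g :- :- j) :+ g :* g :* g :* (p :* h :- g :* g)) R.refl
    f₁ f₂ φ θ J₍ 1 ₎)

a₃ : PowerSeries
a₃ = a 3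

a₃-inverse : f₁ ⊠ (f₂ ⊠ f₂) ⊠ a₃ ≈ one
a₃-inverse = R.trans (⊠-congʳ (⊠-congˡ (⊠-congˡ (R.sym (R.*-identityʳ f₂)))))
  (R.trans (⊠-at (f₁ ⊠ (f₂ ⊠ (f₂ ⊠ one))) a₃)
    (pw λ n → trans (at (R.trans (R.sym (⊠-at (f₁ ⊠ (f₂ ⊠ (f₂ ⊠ one))) a₃))
      (R.trans (⊠-congʳ (R.trans (⊠-at f₁ (f₂ ⊠ (f₂ ⊠ one)))
        (R.trans (R.sym (⊠-at f₁ (f₂ ⊠ (f₂ ⊠ one)))) (R.trans (⊠-congˡ (R.trans (⊠-congˡ (⊠-at f₂ one)) (⊠-at f₂ (f₂ ⊛ one))))
          (⊠-at f₁ (f₂ ⊛ (f₂ ⊛ one))))))) (⊠-at (f₁ ⊛ (f₂ ⊛ (f₂ ⊛ one))) a₃))) n) (a-generatingFunction 3 n)))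

a₃f₁⁷ : a₃ ⊠ (f₁ ⊠ f₁ ⊠ f₁ ⊠ f₁ ⊠ f₁ ⊠ f₁ ⊠ f₁) ≈ f₁ ⊠ θ
a₃f₁⁷ = R.trans (by-combination (⊝ (a₃ ⊠ f₁ ⊠ f₁) ⊙ f₂²θ & f₁ ⊠ θ ⊙ a₃-inverse)
  (S.solve 5 (λ A g h t o → A :* (g :* g :* g :* g :* g :* g :* g) :- g :* t :* o :=
    (:- (A :* g :* g)) :* (h :* h :* t :- g :* g :* g :* g :* g) :+ g :* t :* (g :* (h :* h) :* A :- o)) R.refl
    a₃ f₁ f₂ θ one)) (R.*-identityʳ (f₁ ⊠ θ))

-- The third Rankin–Cohen bracket of θ and f₁

-- 24 q d/dq acting on q^(1/24) F, with the power of q removed. For `θ` and `f₁` it multiplies the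
-- term with x² = 24n + 1 by x².
Δ : PowerSeries → PowerSeries
Δ F = K (+ 24) ⊠ D F ⊞ F

Δ-cong : ∀ {F G} → F ≈ G → Δ F ≈ Δ G
Δ-cong p = R.+-cong (⊠-congˡ (D-cong p)) p

-- Once `Δ F` is a multiple w F, iterating `Δ` is a computation with multipliers: u becomes 24 D u +
-- u w.
Δ-⊠ : ∀ {F w} u {u′} → Δ F ≈ w ⊠ F → K (+ 24) ⊠ D u ⊞ u ⊠ w ≈ u′ → Δ (u ⊠ F) ≈ u′ ⊠ F
Δ-⊠ {F} {w} u {u′} ΔF p = R.trans (⊞-congʳ (⊠-congˡ (D-⊠ u F)))
  (R.trans (by-combination (u ⊙ ΔF)
    (S.solve 5 (λ u du g dg w → # 24 :* (du :* g :+ u :* dg) :+ u :* g :- (# 24 :* du :+ u :* w) :* g :=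
      u :* (# 24 :* dg :+ g :- w :* g)) R.refl u (D u) F (D F) w)) (⊠-congʳ p))

Δf₁ : Δ f₁ ≈ E₂ ⊠ f₁
Δf₁ = by-combination (K (+ 24) ⊙ Df₁)
  (S.solve 3 (λ g dg s → # 24 :* dg :+ g :- (# 1 :- # 24 :* s) :* g := # 24 :* (dg :- :- (s :* g))) R.refl
    f₁ (D f₁) S₍ 1 ₎)

v₂ v₃ : PowerSeries
v₂ = K (+ 3) ⊠ E₂ ⊠ E₂ ⊟ K (+ 2) ⊠ E₄
v₃ = K (+ 15) ⊠ E₂ ⊠ E₂ ⊠ E₂ ⊟ K (+ 30) ⊠ E₂ ⊠ E₄ ⊞ K (+ 16) ⊠ E₆

Δ²f₁ : Δ (Δ f₁) ≈ v₂ ⊠ f₁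
Δ²f₁ = R.trans (Δ-cong Δf₁) (Δ-⊠ E₂ Δf₁ (by-combination (K (+ 2) ⊙ DE₂)
  (S.solve 3 (λ p q dp → # 24 :* dp :+ p :* p :- (# 3 :* p :* p :- # 2 :* q) :=
    # 2 :* (# 12 :* dp :- (p :* p :- q))) R.refl E₂ E₄ (D E₂))))

Δ³f₁ : Δ (Δ (Δ f₁)) ≈ v₃ ⊠ f₁
Δ³f₁ = R.trans (Δ-cong Δ²f₁) (Δ-⊠ v₂ Δf₁ (by-combination
  (K (+ 24) ⊙ Dv₂ & K (+ 12) ⊠ E₂ ⊙ DE₂ & ⊝ K (+ 16) ⊙ DE₄)
  (S.solve 6 (λ p q r dp dq dv →
    # 24 :* dv :+ (# 3 :* p :* p :- # 2 :* q) :* p :-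
      (# 15 :* p :* p :* p :- # 30 :* p :* q :+ # 16 :* r) :=
    # 24 :* (dv :- (# 3 :* (dp :* p :+ p :* dp) :- # 2 :* dq)) :+
    # 12 :* p :* (# 12 :* dp :- (p :* p :- q)) :+ (:- # 16) :* (# 3 :* dq :- (p :* q :- r))) R.refl
    E₂ E₄ E₆ (D E₂) (D E₄) (D v₂))))
  where
  Dv₂ : D v₂ ≈ K (+ 3) ⊠ (D E₂ ⊠ E₂ ⊞ E₂ ⊠ D E₂) ⊟ K (+ 2) ⊠ D E₄
  Dv₂ = R.trans (D-⊟ (K (+ 3) ⊠ E₂ ⊠ E₂) (K (+ 2) ⊠ E₄)) (R.+-cong (D-K⊠⊠ (+ 3) E₂ E₂) (R.-‿cong (D-K⊠ (+ 2) E₄)))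

-- Multipliers of the iterates of `Δ` on `θ`. As θ = f₁⁵/f₂², the first is 5 E₂ - 2 · 2 E₂(q²), and
-- 5 - 4 = 1 accounts for the summand `F` in `Δ F`. `dY` is 24 D u₁.
u₁ u₂ u₃ dY : PowerSeries
u₁ = K (+ 5) ⊠ E₂ ⊟ K (+ 4) ⊠ E₂′
dY = K (+ 10) ⊠ (E₂ ⊠ E₂ ⊟ E₄) ⊟ K (+ 16) ⊠ (E₂′ ⊠ E₂′ ⊟ E₄′)
u₂ = dY ⊞ u₁ ⊠ u₁
u₃ = (K (+ 40) ⊠ E₂ ⊠ (E₂ ⊠ E₂ ⊟ E₄) ⊟ K (+ 80) ⊠ (E₂ ⊠ E₄ ⊟ E₆)) ⊟
     (K (+ 128) ⊠ E₂′ ⊠ (E₂′ ⊠ E₂′ ⊟ E₄′) ⊟ K (+ 256) ⊠ (E₂′ ⊠ E₄′ ⊟ E₆′)) ⊞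
     K (+ 2) ⊠ u₁ ⊠ dY ⊞ u₂ ⊠ u₁

Δθ : Δ θ ≈ u₁ ⊠ θ
Δθ = ⊠-cancelˡ (f₂ ⊠ f₂) (⊠-1 {f₂} {f₂} refl refl) (by-combination
  (K (+ 24) ⊙ Df₂²θ & K (+ 5) ⊠ f₁ ⊠ f₁ ⊠ f₁ ⊠ f₁ ⊙ Δf₁ & ⊝ (K (+ 48) ⊠ f₂ ⊠ θ) ⊙ Df 2 &
   ⊝ (K (+ 5) ⊠ (E₂ ⊟ K 1ℤ)) ⊙ f₂²θ & K (+ 4) ⊠ f₂ ⊠ f₂ ⊠ θ ⊙ E₂′≈)
  (S.solve 9 (λ g h t dg dh dt p p′ s′ →
    h :* h :* (# 24 :* dt :+ t) :- h :* h :* ((# 5 :* p :- # 4 :* p′) :* t) :=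
    # 24 :* ((dh :* h :+ h :* dh) :* t :+ h :* h :* dt :- # 5 :* g :* g :* g :* g :* dg) :+
    # 5 :* g :* g :* g :* g :* (# 24 :* dg :+ g :- p :* g) :+
    (:- (# 48 :* h :* t)) :* (dh :- :- (# 2 :* s′ :* h)) :+
    (:- (# 5 :* (p :- # 1))) :* (h :* h :* t :- g :* g :* g :* g :* g) :+
    # 4 :* h :* h :* t :* (p′ :- (# 1 :- # 24 :* s′))) R.refl
    f₁ f₂ θ (D f₁) (D f₂) (D θ) E₂ E₂′ (sub 2 S₍ 1 ₎)))
  where
  Df₂²θ : (D f₂ ⊠ f₂ ⊞ f₂ ⊠ D f₂) ⊠ θ ⊞ f₂ ⊠ f₂ ⊠ D θ ≈ K (+ 5) ⊠ f₁ ⊠ f₁ ⊠ f₁ ⊠ f₁ ⊠ D f₁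
  Df₂²θ = R.trans (R.sym (R.trans (D-⊠ (f₂ ⊠ f₂) θ) (⊞-congʳ (⊠-congʳ (D-⊠ f₂ f₂)))))
    (R.trans (D-cong f₂²θ) (R.trans
      (R.trans (D-⊠ (f₁ ⊠ f₁ ⊠ f₁ ⊠ f₁) f₁) (⊞-congʳ (⊠-congʳ (R.trans (D-⊠ (f₁ ⊠ f₁ ⊠ f₁) f₁)
        (⊞-congʳ (⊠-congʳ (R.trans (D-⊠ (f₁ ⊠ f₁) f₁) (⊞-congʳ (⊠-congʳ (D-⊠ f₁ f₁))))))))))
      (S.solve 2 (λ g d → (((d :* g :+ g :* d) :* g :+ g :* g :* d) :* g :+ g :* g :* g :* d) :* g :+ g :* g :* g :* g :* d :=
        # 5 :* g :* g :* g :* g :* d) R.refl f₁ (D f₁))))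

Du₁ : K (+ 24) ⊠ D u₁ ≈ dY
Du₁ = R.trans (⊠-congˡ (R.trans (D-⊟ (K (+ 5) ⊠ E₂) (K (+ 4) ⊠ E₂′)) (R.+-cong (D-K⊠ (+ 5) E₂) (R.-‿cong (D-K⊠ (+ 4) E₂′)))))
  (by-combination (K (+ 10) ⊙ DE₂ & ⊝ K (+ 16) ⊙ DE₂′)
    (S.solve 6 (λ p p′ q q′ dp dp′ →
      # 24 :* (# 5 :* dp :- # 4 :* dp′) :- (# 10 :* (p :* p :- q) :- # 16 :* (p′ :* p′ :- q′)) :=
      # 10 :* (# 12 :* dp :- (p :* p :- q)) :+ (:- # 16) :* (# 6 :* dp′ :- (p′ :* p′ :- q′))) R.refl
      E₂ E₂′ E₄ E₄′ (D E₂) (D E₂′)))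

Δ²θ : Δ (Δ θ) ≈ u₂ ⊠ θ
Δ²θ = R.trans (Δ-cong Δθ) (Δ-⊠ u₁ Δθ (⊞-congʳ Du₁))

Δ³θ : Δ (Δ (Δ θ)) ≈ u₃ ⊠ θ
Δ³θ = R.trans (Δ-cong Δ²θ) (Δ-⊠ u₂ Δθ (⊞-congʳ (R.trans (⊠-congˡ Du₂) (by-combination
  (K (+ 20) ⊠ (K (+ 2) ⊠ E₂) ⊙ DE₂ & ⊝ K (+ 80) ⊙ DE₄ & ⊝ (K (+ 128) ⊠ E₂′) ⊙ DE₂′ & K (+ 128) ⊙ DE₄′ & K (+ 2) ⊠ u₁ ⊙ Du₁)
  (S.solve 12 (λ p p′ q q′ r r′ dp dp′ dq dq′ u du →
    let z = # 10 :* (p :* p :- q) :- # 16 :* (p′ :* p′ :- q′) in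
    # 24 :* (# 10 :* (dp :* p :+ p :* dp :- dq) :- # 16 :* (dp′ :* p′ :+ p′ :* dp′ :- dq′) :+ (du :* u :+ u :* du)) :-
      ((# 40 :* p :* (p :* p :- q) :- # 80 :* (p :* q :- r)) :-
       (# 128 :* p′ :* (p′ :* p′ :- q′) :- # 256 :* (p′ :* q′ :- r′)) :+ # 2 :* u :* z) :=
    # 20 :* (# 2 :* p) :* (# 12 :* dp :- (p :* p :- q)) :+
    (:- # 80) :* (# 3 :* dq :- (p :* q :- r)) :+
    (:- (# 128 :* p′)) :* (# 6 :* dp′ :- (p′ :* p′ :- q′)) :+
    # 128 :* (# 3 :* dq′ :- # 2 :* (p′ :* q′ :- r′)) :+
    # 2 :* u :* (# 24 :* du :- z)) R.refl
    E₂ E₂′ E₄ E₄′ E₆ E₆′ (D E₂) (D E₂′) (D E₄) (D E₄′) u₁ (D u₁))))))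
  where
  square : ∀ F → D (F ⊠ F) ≈ D F ⊠ F ⊞ F ⊠ D F
  square F = D-⊠ F F
  Du₂ : D u₂ ≈ K (+ 10) ⊠ (D E₂ ⊠ E₂ ⊞ E₂ ⊠ D E₂ ⊟ D E₄) ⊟ K (+ 16) ⊠ (D E₂′ ⊠ E₂′ ⊞ E₂′ ⊠ D E₂′ ⊟ D E₄′) ⊞
                (D u₁ ⊠ u₁ ⊞ u₁ ⊠ D u₁)
  Du₂ = R.trans (D-⊞ dY (u₁ ⊠ u₁)) (R.+-cong
    (R.trans (D-⊟ (K (+ 10) ⊠ (E₂ ⊠ E₂ ⊟ E₄)) (K (+ 16) ⊠ (E₂′ ⊠ E₂′ ⊟ E₄′)))
      (R.+-cong (R.trans (D-K⊠ (+ 10) (E₂ ⊠ E₂ ⊟ E₄)) (⊠-congˡ (R.trans (D-⊟ (E₂ ⊠ E₂) E₄) (⊞-congʳ (square E₂)))))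
        (R.-‿cong (R.trans (D-K⊠ (+ 16) (E₂′ ⊠ E₂′ ⊟ E₄′)) (⊠-congˡ (R.trans (D-⊟ (E₂′ ⊠ E₂′) E₄′) (⊞-congʳ (square E₂′))))))))
    (square u₁))

-- The Rankin-Cohen coefficients for weights 3/2 and 1/2, scaled to integers, are the binomials of 7
-- at 0, 2, 4, 6 with alternating signs.
bracket : PowerSeries
bracket = Δ (Δ (Δ θ)) ⊠ f₁ ⊟ K (+ 21) ⊠ Δ (Δ θ) ⊠ Δ f₁ ⊞ K (+ 35) ⊠ Δ θ ⊠ Δ (Δ f₁) ⊟ K (+ 7) ⊠ θ ⊠ Δ (Δ (Δ f₁))

-- `E₂` drops out, as expected of a bracket, and `X²` and `X³` remove the forms in q². This leaves
-- 368 X E₄ - 360 X³; trading X³ for `E₆` turns the coefficient of X E₄ into 98 = 2 · 49.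
bracket-closed : bracket ≈ (K (+ 98) ⊠ X ⊠ E₄ ⊟ K (+ 90) ⊠ E₆) ⊠ (f₁ ⊠ θ)
bracket-closed = R.trans
  (R.+-cong (R.+-cong (R.+-cong (⊠-congʳ Δ³θ) (R.-‿cong (R.*-cong (⊠-congˡ Δ²θ) Δf₁))) (R.*-cong (⊠-congˡ Δθ) Δ²f₁))
            (R.-‿cong (⊠-congˡ Δ³f₁)))
  (by-combination (⊝ (K (+ 24) ⊠ X) ⊠ (f₁ ⊠ θ) ⊙ X² & ⊝ K (+ 32) ⊠ (f₁ ⊠ θ) ⊙ X³ & ⊝ K (+ 90) ⊠ (f₁ ⊠ θ) ⊙ R.sym E₆-X)
  (S.solve 8 (λ p p′ q q′ r r′ g t →
    let x = # 2 :* p′ :- p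
        u₁ = # 5 :* p :- # 4 :* p′
        z = # 10 :* (p :* p :- q) :- # 16 :* (p′ :* p′ :- q′)
        u₂ = z :+ u₁ :* u₁
        u₃ = (# 40 :* p :* (p :* p :- q) :- # 80 :* (p :* q :- r)) :-
             (# 128 :* p′ :* (p′ :* p′ :- q′) :- # 256 :* (p′ :* q′ :- r′)) :+ # 2 :* u₁ :* z :+ u₂ :* u₁
        v₂ = # 3 :* p :* p :- # 2 :* q
        v₃ = # 15 :* p :* p :* p :- # 30 :* p :* q :+ # 16 :* r
    in
    u₃ :* t :* g :- # 21 :* (u₂ :* t) :* (p :* g) :+ # 35 :* (u₁ :* t) :* (v₂ :* g) :- # 7 :* t :* (v₃ :* g) :-
      (# 98 :* x :* q :- # 90 :* r) :* (g :* t) :=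
    (:- (# 24 :* x)) :* (g :* t) :* (# 5 :* x :* x :- (q :+ # 4 :* q′)) :+
    (:- # 32) :* (g :* t) :* (# 8 :* r′ :+ r :- (# 15 :* x :* x :* x :- # 6 :* x :* q)) :+
    (:- # 90) :* (g :* t) :* (# 4 :* x :* x :* x :- # 3 :* x :* q :- r)) R.refl
    E₂ E₂′ E₄ E₄′ E₆ E₆′ f₁ θ))

-- Divisibility of coefficients of theta series

∣0 : ∀ {d} → d ∣ₛ 0ℤ
∣0 = Signed.divides 0ℤ refl

∣-Σ∞ : ∀ {d F n} → (∀ i → d ∣ₛ F i n) → d ∣ₛ Σ∞ F n
∣-Σ∞ {d} {F} {n} p = subst (d ∣ₛ_) (sym (Σ∞-at F n)) (go (2 + n))
  where
  go : ∀ M → d ∣ₛ Σ< M F n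
  go zero    = subst (d ∣ₛ_) (sym (at (Σ<-zero F) n)) ∣0
  go (suc M) = subst (d ∣ₛ_) (sym (trans (at (Σ<-last M F) n) (⊞-at (Σ< M F) (F M) n)))
    (Signed.∣m∣n⇒∣m+n (go M) (p M))

∣-⊠ : ∀ {d F G} n → (∀ i j → i + j ≡ n → d ∣ₛ F i ℤ.* G j) → d ∣ₛ (F ⊠ G) n
∣-⊠ {d} {F} {G} n p = subst (d ∣ₛ_) (sym (at (⊠-at F G) n)) (go F n p)
  where
  go : ∀ F n → (∀ i j → i + j ≡ n → d ∣ₛ F i ℤ.* G j) → d ∣ₛ (F ⊛ G) n
  go F zero    p = Signed.∣m∣n⇒∣m+n (p 0 0 refl) ∣0
  go F (suc n) p = Signed.∣m∣n⇒∣m+n (p 0 (suc n) refl) (go (F ∘ suc) n (λ i j e → p (suc i) j (cong suc e)))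

∣-monomial : ∀ {d} c w e n → (e ≡ n → d ∣ₛ c ℤ.* w) → d ∣ₛ c ℤ.* (K w ⊠ q^ e) n
∣-monomial {d} c w e n p with n ℕ.≟ e
... | yes refl = subst (λ x → d ∣ₛ c ℤ.* x) (sym (trans (K-⊠ w (q^ e) e) (trans (cong (w ℤ.*_) (q^-eq e)) (ℤ.*-identityʳ w)))) (p refl)
... | no  n≢e  = subst (λ x → d ∣ₛ c ℤ.* x) (sym (trans (K-⊠ w (q^ e) n) (trans (cong (w ℤ.*_) (q^-≢ n≢e)) (ℤ.*-zeroʳ w))))
  (subst (d ∣ₛ_) (sym (ℤ.*-zeroʳ c)) ∣0)

-- The factor `c` stands for a coefficient of another series, so that the criterion applies to both
-- factors of a product in turn.
∣-Pent : ∀ {d} c u v n → (∀ k → pent k ≡ n → d ∣ₛ c ℤ.* u k) → (∀ k → pent′ k ≡ n → d ∣ₛ c ℤ.* v k) →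
         d ∣ₛ c ℤ.* Pent u v n
∣-Pent {d} c u v n p r = subst (d ∣ₛ_) (trans (at (Σ∞-K c F) n) (K-⊠ c (Pent u v) n))
  (∣-Σ∞ (λ k → subst (d ∣ₛ_) (sym (trans (K-⊠ c (F k) n) (trans (cong (c ℤ.*_) (⊞-at (K (u k) ⊠ q^ pent k) (K (v k) ⊠ q^ pent′ k) n))
      (ℤ.*-distribˡ-+ c _ _))))
    (Signed.∣m∣n⇒∣m+n (∣-monomial c (u k) (pent k) n (p k)) (∣-monomial c (v k) (pent′ k) n (r k)))))
  where
  F : ℕ → PowerSeries
  F k = K (u k) ⊠ q^ pent k ⊞ K (v k) ⊠ q^ pent′ k

pent-square : ∀ k → 24 * pent k + 1 ≡ (1 + 6 * k) * (1 + 6 * k)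
pent-square k = trans (e₁ (pent k)) (trans (cong (λ p → 12 * p + 1) (2*pent k)) (e₂ k))
  where
  e₁ : ∀ p → 24 * p + 1 ≡ 12 * (2 * p) + 1
  e₁ = ℕ-ring.solve-∀
  e₂ : ∀ k → 12 * (k * (3 * k + 1)) + 1 ≡ (1 + 6 * k) * (1 + 6 * k)
  e₂ = ℕ-ring.solve-∀

pent′-square : ∀ k → 24 * pent′ k + 1 ≡ (5 + 6 * k) * (5 + 6 * k)
pent′-square k = trans (e₁ k (pent k)) (trans (cong (_+ (48 * k + 24)) (pent-square k)) (e₂ k))
  where
  e₁ : ∀ k p → 24 * (p + (2 * k + 1)) + 1 ≡ 24 * p + 1 + (48 * k + 24)
  e₁ = ℕ-ring.solve-∀
  e₂ : ∀ k → (1 + 6 * k) * (1 + 6 * k) + (48 * k + 24) ≡ (5 + 6 * k) * (5 + 6 * k)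
  e₂ = ℕ-ring.solve-∀

∣-θ : ∀ {d} c n → (∀ x → 24 * n + 1 ≡ x * x → d ∣ₛ c ℤ.* + x) → d ∣ₛ c ℤ.* θ n
∣-θ {d} c n p = ∣-Pent c _ _ n
  (λ { k refl → subst (λ x → d ∣ₛ c ℤ.* x) (weight k) (p (1 + 6 * k) (pent-square k)) })
  (λ { k refl → subst (d ∣ₛ_) (trans (ℤ.neg-distribʳ-* c _) (cong (λ x → c ℤ.* ℤ.- x) (weight′ k)))
                  (Signed.∣m⇒∣-m (p (5 + 6 * k) (pent′-square k))) })
  where
  weight : ∀ k → + (1 + 6 * k) ≡ y (+ (1 + 3 * k))
  weight k = trans (cong (ℤ._+_ 1ℤ) (ℤ.pos-* 6 k)) (trans (e (+ k)) (cong (λ x → + 2 ℤ.* (1ℤ ℤ.+ x) ℤ.- 1ℤ) (sym (ℤ.pos-* 3 k))))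
    where
    e : ∀ k → 1ℤ ℤ.+ + 6 ℤ.* k ≡ + 2 ℤ.* (1ℤ ℤ.+ + 3 ℤ.* k) ℤ.- 1ℤ
    e = solve-∀
  weight′ : ∀ k → + (5 + 6 * k) ≡ y (+ (3 + 3 * k))
  weight′ k = trans (cong (ℤ._+_ (+ 5)) (ℤ.pos-* 6 k)) (trans (e (+ k)) (cong (λ x → + 2 ℤ.* (+ 3 ℤ.+ x) ℤ.- 1ℤ) (sym (ℤ.pos-* 3 k))))
    where
    e : ∀ k → + 5 ℤ.+ + 6 ℤ.* k ≡ + 2 ℤ.* (+ 3 ℤ.+ + 3 ℤ.* k) ℤ.- 1ℤ
    e = solve-∀

∣-f₁ : ∀ {d} c n → (∀ x → 24 * n + 1 ≡ x * x → d ∣ₛ c) → d ∣ₛ c ℤ.* f₁ n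
∣-f₁ {d} c n p = subst (λ x → d ∣ₛ c ℤ.* x) (sym (at f₁-Pent n)) (∣-Pent c _ _ n
  (λ { k refl → Signed.∣m⇒∣m*n (sgn k) (p (1 + 6 * k) (pent-square k)) })
  (λ { k refl → Signed.∣m⇒∣m*n (sgn (suc k)) (p (5 + 6 * k) (pent′-square k)) }))

∣-θf₁ : ∀ {d F G} (α β : ℕ → ℤ) n → (∀ i → F i ≡ α i ℤ.* θ i) → (∀ j → G j ≡ β j ℤ.* f₁ j) →
  (∀ i j x z → i + j ≡ n → 24 * i + 1 ≡ x * x → 24 * j + 1 ≡ z * z → d ∣ₛ α i ℤ.* β j ℤ.* + x) →
  d ∣ₛ (F ⊠ G) n
∣-θf₁ {d} {F} {G} α β n F≡ G≡ p = ∣-⊠ n (λ i j e → subst (d ∣ₛ_)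
  (trans (reorder (α i) (β j) (θ i) (f₁ j)) (sym (cong₂ ℤ._*_ (F≡ i) (G≡ j))))
  (∣-f₁ (α i ℤ.* β j ℤ.* θ i) j (λ z ez → ∣-θ (α i ℤ.* β j) i (λ x ex → p i j x z e ex ez))))
  where
  reorder : ∀ a b t g → a ℤ.* b ℤ.* t ℤ.* g ≡ a ℤ.* t ℤ.* (b ℤ.* g)
  reorder = solve-∀

∣-J₁ : ∀ {d} c n → (∀ x → 8 * n + 1 ≡ x * x → d ∣ₛ c ℤ.* + x) → d ∣ₛ c ℤ.* J₍ 1 ₎ n
∣-J₁ {d} c n p = subst (d ∣ₛ_) (trans (at (Σ∞-K c F) n) (K-⊠ c J₍ 1 ₎ n))
  (∣-Σ∞ (λ i → subst (d ∣ₛ_) (sym (trans (K-⊠ c (F i) n) (cong (c ℤ.*_) (at (regroup i) n))))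
    (∣-monomial c (sgn (suc i) ℤ.* y (+ suc i) ℤ.^ 1) (tri (suc i)) n
      (λ { refl → subst (d ∣ₛ_) (weight i) (Signed.∣m⇒∣m*n (sgn (suc i)) (p (1 + 2 * i) (square i))) }))))
  where
  F : ℕ → PowerSeries
  F i = K (y (+ suc i) ℤ.^ 1) ⊠ τ (suc i)
  regroup : ∀ i → F i ≈ K (sgn (suc i) ℤ.* y (+ suc i) ℤ.^ 1) ⊠ q^ tri (suc i)
  regroup i = R.trans (S.solve 3 (λ y s x → y :* (s :* x) := s :* y :* x) R.refl (K (y (+ suc i) ℤ.^ 1)) (K (sgn (suc i))) (q^ tri (suc i)))
    (⊠-congʳ (R.sym (K-* (sgn (suc i)) (y (+ suc i) ℤ.^ 1))))
  weight : ∀ i → c ℤ.* + (1 + 2 * i) ℤ.* sgn (suc i) ≡ c ℤ.* (sgn (suc i) ℤ.* y (+ suc i) ℤ.^ 1)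
  weight i = trans (cong (λ x → c ℤ.* (1ℤ ℤ.+ x) ℤ.* sgn (suc i)) (ℤ.pos-* 2 i)) (e c (sgn (suc i)) (+ i))
    where
    e : ∀ c s i → c ℤ.* (1ℤ ℤ.+ + 2 ℤ.* i) ℤ.* s ≡ c ℤ.* (s ℤ.* ((+ 2 ℤ.* (1ℤ ℤ.+ i) ℤ.- 1ℤ) ℤ.* 1ℤ))
    e = solve-∀
  square : ∀ i → 8 * tri (suc i) + 1 ≡ (1 + 2 * i) * (1 + 2 * i)
  square zero    = refl
  square (suc i) = trans (e₁ i (tri (suc i))) (trans (cong (_+ 8 * suc i) (square i)) (e₂ i))
    where
    e₁ : ∀ i t → 8 * (suc i + t) + 1 ≡ 8 * t + 1 + 8 * suc i
    e₁ = ℕ-ring.solve-∀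
    e₂ : ∀ i → (1 + 2 * i) * (1 + 2 * i) + 8 * suc i ≡ (1 + 2 * suc i) * (1 + 2 * suc i)
    e₂ = ℕ-ring.solve-∀

-- Arithmetic modulo 7

opaque
  euclid-7 : ∀ m n → 7 ∣ℕ m * n → 7 ∣ℕ m ⊎ 7 ∣ℕ n
  euclid-7 m n = euclidsLemma m n (from-yes (prime? 7))

∣ℕ⇒∣ₛ : ∀ {d n} → d ∣ℕ n → + d ∣ₛ + n
∣ℕ⇒∣ₛ = Signed.∣ᵤ⇒∣

7-cancel : ∀ n k → 7 ∤ n → + 7 ∣ₛ + n ℤ.* k → + 7 ∣ₛ k
7-cancel n k 7∤n p with euclid-7 n ℤ.∣ k ∣ (subst (7 ∣ℕ_) (ℤ.abs-* (+ n) k) (Signed.∣⇒∣ᵤ p))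
... | inj₁ 7∣n = contradiction 7∣n 7∤n
... | inj₂ 7∣k = Signed.∣ᵤ⇒∣ 7∣k

-- 25 is the inverse of 2 modulo 49.
49∣2* : ∀ z → + 49 ∣ₛ + 2 ℤ.* z → + 49 ∣ₛ z
49∣2* z p = Signed.∣m+n∣n⇒∣m (subst (+ 49 ∣ₛ_) (e z) (Signed.∣n⇒∣m*n (+ 25) p)) (Signed.∣m⇒∣m*n z Signed.∣-refl)
  where
  e : ∀ z → + 25 ℤ.* (+ 2 ℤ.* z) ≡ z ℤ.+ + 49 ℤ.* z
  e = solve-∀

-- Since m - r divides m⁶ - r⁶, only the six nonzero residues r have to be inspected.
fermat : ∀ m → 7 ∤ m → + 7 ∣ₛ (+ m) ℤ.^ 6 ℤ.- 1ℤ
fermat m 7∤m = subst (+ 7 ∣ₛ_) (telescoping ((+ m) ℤ.^ 6) ((+ r) ℤ.^ 6))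
  (Signed.∣m∣n⇒∣m+n
    (subst (+ 7 ∣ₛ_) (sym (sixth-power-difference (+ m) (+ r))) (Signed.∣m⇒∣m*n _ difference))
    (residue r (m%n<n m 7) (λ r≡0 → 7∤m (m%n≡0⇒n∣m m 7 r≡0))))
  where
  r : ℕ
  r = m % 7
  telescoping : ∀ a b → (a ℤ.- b) ℤ.+ (b ℤ.- 1ℤ) ≡ a ℤ.- 1ℤ
  telescoping = solve-∀
  difference : + 7 ∣ₛ + m ℤ.- + r
  difference = Signed.divides (+ (m / 7)) (trans (cong (λ w → + w ℤ.- + r) (m≡m%n+[m/n]*n m 7))
    (trans (cong (λ w → (+ r ℤ.+ w) ℤ.- + r) (ℤ.pos-* (m / 7) 7)) (e (+ r) (+ (m / 7)))))
    where
    e : ∀ r q → (r ℤ.+ q ℤ.* + 7) ℤ.- r ≡ q ℤ.* + 7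
    e = solve-∀
  residue : ∀ r → r < 7 → r ≢ 0 → + 7 ∣ₛ (+ r) ℤ.^ 6 ℤ.- 1ℤ
  residue 0 _ r≢0 = contradiction refl r≢0
  residue 1 _ _ = Signed.divides (+ 0) refl
  residue 2 _ _ = Signed.divides (+ 9) refl
  residue 3 _ _ = Signed.divides (+ 104) refl
  residue 4 _ _ = Signed.divides (+ 585) refl
  residue 5 _ _ = Signed.divides (+ 2232) refl
  residue 6 _ _ = Signed.divides (+ 6665) refl
  residue (suc (suc (suc (suc (suc (suc (suc _))))))) (s≤s (s≤s (s≤s (s≤s (s≤s (s≤s (s≤s ()))))))) _

7∣square : ∀ x → 7 ∣ℕ x * x → 7 ∣ℕ x
7∣square x p with euclid-7 x x p
... | inj₁ q = q
... | inj₂ q = q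

-- The form x² + z² is anisotropic modulo 7, as - 1 is not a square.
7∣x²+z² : ∀ x z m → x * x + z * z ≡ 7 * m → 7 ∣ℕ x × 7 ∣ℕ z
7∣x²+z² x z m e with 7 ∣? x | 7 ∣? z
... | yes 7∣x | _       = 7∣x , 7∣square z (∣m+n∣m⇒∣n (subst (7 ∣ℕ_) (sym e) (m∣m*n m)) (∣m⇒∣m*n x 7∣x))
... | no  7∤x | yes 7∣z = contradiction (7∣square x (∣m+n∣m⇒∣n (subst (7 ∣ℕ_) (trans (sym e) (ℕ.+-comm (x * x) (z * z))) (m∣m*n m)) (∣m⇒∣m*n z 7∣z))) 7∤x
-- Here x² + z² divides x⁶ + z⁶, which is therefore 0 modulo 7, whereas Fermat gives x⁶ + z⁶ ≡ 2.
... | no  7∤x | no  7∤z = contradiction (∣⇒≤ (Signed.∣⇒∣ᵤ 7∣2)) λ { (s≤s (s≤s ())) }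
  where
  sum : + 7 ∣ₛ (+ x) ℤ.^ 6 ℤ.+ (+ z) ℤ.^ 6
  sum = subst (+ 7 ∣ₛ_) (sym (sixth-power-sum (+ x) (+ z))) (Signed.∣m⇒∣m*n _
    (subst (+ 7 ∣ₛ_) (trans (cong +_ (sym e)) (cong₂ ℤ._+_ (ℤ.pos-* x x) (ℤ.pos-* z z))) (∣ℕ⇒∣ₛ (m∣m*n m))))
  7∣2 : + 7 ∣ₛ + 2
  7∣2 = subst (+ 7 ∣ₛ_) (two ((+ x) ℤ.^ 6) ((+ z) ℤ.^ 6))
    (Signed.∣m∣n⇒∣m-n sum (Signed.∣m∣n⇒∣m+n (fermat x 7∤x) (fermat z 7∤z)))
    where
    two : ∀ a b → (a ℤ.+ b) ℤ.- ((a ℤ.- 1ℤ) ℤ.+ (b ℤ.- 1ℤ)) ≡ + 2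
    two = solve-∀

divide : ∀ d F → (∀ n → d ∣ₛ F n) → Σ PowerSeries (λ G → F ≈ K d ⊠ G)
divide d F p = (λ n → Signed._∣_.quotient (p n)) , pw λ n →
  trans (Signed._∣_.equality (p n)) (trans (ℤ.*-comm (Signed._∣_.quotient (p n)) d) (sym (K-⊠ d _ n)))

-- Frobenius for f₁

infix 9 _⁷
_⁷ : PowerSeries → PowerSeries
F ⁷ = F ⊠ F ⊠ F ⊠ F ⊠ F ⊠ F ⊠ F

f₇ : PowerSeries
f₇ = f 7

-- By multiplicativity the claim rests on a single factor, (1 - z)⁷ ≡ 1 - z⁷ modulo 7.
fUpTo-⁷ : ∀ N → Σ PowerSeries (λ G → fUpTo 1 N ⁷ ≈ fUpTo 7 N ⊞ K (+ 7) ⊠ G)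
fUpTo-⁷ zero = 𝟘 , (R.trans (S.solve 1 (λ o → o :* o :* o :* o :* o :* o :* o := o :* (o :* (o :* (o :* (o :* (o :* o)))))) R.refl one)
  (R.trans (units (R.*-identityˡ one)) (R.sym (R.trans (⊞-congˡ (R.zeroʳ (K (+ 7)))) (R.+-identityʳ one)))))
  where
  units : one ⊠ one ≈ one → one ⊠ (one ⊠ (one ⊠ (one ⊠ (one ⊠ (one ⊠ one))))) ≈ one
  units p = go (go (go (go (go p))))
    where
    go : ∀ {F} → F ≈ one → one ⊠ F ≈ one
    go r = R.trans (R.*-identityˡ _) r
fUpTo-⁷ (suc N) with fUpTo-⁷ N
... | G , p = x⁷ ⊠ G ⊞ h ⊠ fUpTo 7 N , (begin
  fUpTo 1 (suc N) ⁷
    ≈⟨ seven (fUpTo-⊠ 1 N) ⟩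
  (x ⊠ p₁) ⁷
    ≈⟨ S.solve 2 (λ x p → let q = x :* p in q :* q :* q :* q :* q :* q :* q :=
         (x :* x :* x :* x :* x :* x :* x) :* (p :* p :* p :* p :* p :* p :* p)) R.refl x p₁ ⟩
  x⁷ ⊠ p₁ ⁷
    ≈⟨ ⊠-congˡ p ⟩
  x⁷ ⊠ (fUpTo 7 N ⊞ K (+ 7) ⊠ G)
    ≈⟨ R.trans (S.solve 4 (λ x f k g → x :* (f :+ k :* g) := x :* f :+ k :* (x :* g)) R.refl x⁷ (fUpTo 7 N) (K (+ 7)) G)
         (⊞-congʳ (⊠-congʳ factor)) ⟩
  ((one ⊟ q^ (7 * suc N)) ⊞ K (+ 7) ⊠ h) ⊠ fUpTo 7 N ⊞ K (+ 7) ⊠ (x⁷ ⊠ G)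
    ≈⟨ S.solve 5 (λ y k h f g → (y :+ k :* h) :* f :+ k :* g := y :* f :+ k :* (g :+ h :* f)) R.refl
         (one ⊟ q^ (7 * suc N)) (K (+ 7)) h (fUpTo 7 N) (x⁷ ⊠ G) ⟩
  (one ⊟ q^ (7 * suc N)) ⊠ fUpTo 7 N ⊞ K (+ 7) ⊠ (x⁷ ⊠ G ⊞ h ⊠ fUpTo 7 N)
    ≈⟨ ⊞-congʳ (R.sym (fUpTo-⊠ 7 N)) ⟩
  fUpTo 7 (suc N) ⊞ K (+ 7) ⊠ (x⁷ ⊠ G ⊞ h ⊠ fUpTo 7 N) ∎)
  where
  open ≈-Reasoning
  p₁ z x x⁷ h : PowerSeries
  p₁ = fUpTo 1 N
  z  = q^ (1 * suc N)
  x  = one ⊟ z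
  x⁷ = x ⁷
  -- The inner binomial coefficients 7, 21, 35, 35, 21, 7 of (1 - z)⁷, divided by 7.
  h  = ⊝ z ⊞ K (+ 3) ⊠ z ⊠ z ⊟ K (+ 5) ⊠ z ⊠ z ⊠ z ⊞ K (+ 5) ⊠ z ⊠ z ⊠ z ⊠ z ⊟ K (+ 3) ⊠ z ⊠ z ⊠ z ⊠ z ⊠ z ⊞ z ⊠ z ⊠ z ⊠ z ⊠ z ⊠ z
  seven : ∀ {F G} → F ≈ G → F ⁷ ≈ G ⁷
  seven r = R.*-cong (R.*-cong (R.*-cong (R.*-cong (R.*-cong (R.*-cong r r) r) r) r) r) r
  z⁷ : z ⁷ ≈ q^ (7 * suc N)
  z⁷ = R.trans (step (step (step (step (step (q^-+ n n)))))) (q^-≡ (e N))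
    where
    n : ℕ
    n = 1 * suc N
    step : ∀ {F m} → F ≈ q^ m → F ⊠ z ≈ q^ (m + n)
    step {F} {m} r = R.trans (⊠-congʳ r) (q^-+ m n)
    e : ∀ N → (1 * suc N) + (1 * suc N) + (1 * suc N) + (1 * suc N) + (1 * suc N) + (1 * suc N) + (1 * suc N) ≡ 7 * suc N
    e = ℕ-ring.solve-∀
  factor : x⁷ ≈ (one ⊟ q^ (7 * suc N)) ⊞ K (+ 7) ⊠ h
  factor = R.trans (seven (⊞-congʳ (pw one≗K)))
    (R.trans (S.solve 1 (λ z → let x = # 1 :- z in x :* x :* x :* x :* x :* x :* x :=
        (# 1 :- z :* z :* z :* z :* z :* z :* z) :+
        # 7 :* (:- z :+ # 3 :* z :* z :- # 5 :* z :* z :* z :+ # 5 :* z :* z :* z :* z :-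
          # 3 :* z :* z :* z :* z :* z :+ z :* z :* z :* z :* z :* z)) R.refl z)
      (⊞-congʳ (R.+-cong (R.sym (pw one≗K)) (R.-‿cong z⁷))))

opaque
  f₁⁷-mod-7 : Σ PowerSeries (λ G → f₁ ⁷ ≈ f₇ ⊞ K (+ 7) ⊠ G)
  f₁⁷-mod-7 with divide (+ 7) (f₁ ⁷ ⊟ f₇) (λ n → subst (+ 7 ∣ₛ_) (sym (local n)) (Signed.∣m⇒∣m*n (proj₁ (fUpTo-⁷ n) n) Signed.∣-refl))
    where
    local : ∀ n → (f₁ ⁷ ⊟ f₇) n ≡ + 7 ℤ.* proj₁ (fUpTo-⁷ n) n
    local n = begin
      (f₁ ⁷ ⊟ f₇) n
        ≡⟨ trans (⊞-at (f₁ ⁷) (⊝ f₇) n) (cong₂ ℤ._+_ (seven n ℕ.≤-refl) (⊝-at f₇ n)) ⟩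
      (fUpTo 1 n ⁷) n ℤ.- fUpTo 7 n n
        ≡⟨ cong (ℤ._- fUpTo 7 n n) (trans (at (proj₂ (fUpTo-⁷ n)) n) (⊞-at (fUpTo 7 n) (K (+ 7) ⊠ proj₁ (fUpTo-⁷ n)) n)) ⟩
      fUpTo 7 n n ℤ.+ (K (+ 7) ⊠ proj₁ (fUpTo-⁷ n)) n ℤ.- fUpTo 7 n n
        ≡⟨ cancel (fUpTo 7 n n) _ ⟩
      (K (+ 7) ⊠ proj₁ (fUpTo-⁷ n)) n
        ≡⟨ K-⊠ (+ 7) (proj₁ (fUpTo-⁷ n)) n ⟩
      + 7 ℤ.* proj₁ (fUpTo-⁷ n) n ∎
      where
      open ≡-Reasoning
      cancel : ∀ a b → a ℤ.+ b ℤ.- a ≡ b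
      cancel = solve-∀
      base : ∀ i → i ≤ n → f₁ i ≡ fUpTo 1 n i
      base i i≤n = sym (f-limit 1 i≤n)
      times : ∀ {F G} → (∀ i → i ≤ n → F i ≡ G i) → ∀ i → i ≤ n → (F ⊠ f₁) i ≡ (G ⊠ fUpTo 1 n) i
      times r i i≤n = ⊠-local i (λ j j≤i → r j (ℕ.≤-trans j≤i i≤n)) (λ j j≤i → base j (ℕ.≤-trans j≤i i≤n))
      seven : ∀ i → i ≤ n → (f₁ ⁷) i ≡ (fUpTo 1 n ⁷) i
      seven = times (times (times (times (times (times base)))))
  ... | G , p = G , by-combination (K 1ℤ ⊙ p)
    (S.solve 3 (λ a b g → a :- (b :+ # 7 :* g) := # 1 :* (a :- b :- # 7 :* g)) R.refl (f₁ ⁷) f₇ G)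

-- The correction term u modulo 7

u : PowerSeries
u = proj₁ f₁⁷-mod-7 ⊠ recip f₇

f₁⁷ : f₁ ⁷ ≈ f₇ ⊠ (K 1ℤ ⊞ K (+ 7) ⊠ u)
f₁⁷ = R.trans (proj₂ f₁⁷-mod-7) (by-combination (⊝ (K (+ 7) ⊠ proj₁ f₁⁷-mod-7) ⊙ inverse)
  (R.trans (⊞-congʳ (⊞-congˡ (⊠-congˡ (R.sym (R.*-identityʳ (proj₁ f₁⁷-mod-7))))))
    (S.solve 4 (λ f g r o → f :+ # 7 :* (g :* o) :- f :* (# 1 :+ # 7 :* (g :* r)) := (:- (# 7 :* g)) :* (f :* r :- o)) R.refl
      f₇ (proj₁ f₁⁷-mod-7) (recip f₇) one)))
  where
  inverse : f₇ ⊠ recip f₇ ≈ one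
  inverse = R.trans (⊠-at f₇ (recip f₇)) (pw (recip-inverse {f₇} refl))

s₇ : PowerSeries
s₇ = sub 7 S₍ 1 ₎

-- Logarithmic derivatives of f₁⁷ = f₇ (1 + 7u): both f₁⁷ and f₇ contribute a factor 7, so the
-- equation can be divided by 7.
Du : D u ≈ (s₇ ⊟ S₍ 1 ₎) ⊠ (K 1ℤ ⊞ K (+ 7) ⊠ u)
Du = K-cancel (+ 7) (⊠-cancelˡ f₇ refl (by-combination
  (⊝ K 1ℤ ⊙ R.trans (D-cong f₁⁷) product & K 1ℤ ⊙ seventh & ⊝ (K (+ 7) ⊠ S₍ 1 ₎) ⊙ f₁⁷ & ⊝ (K 1ℤ ⊞ K (+ 7) ⊠ u) ⊙ Df 7)
  (S.solve 8 (λ p dp f df u du s s₇ →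
    let w = # 1 :+ # 7 :* u in
    f :* (# 7 :* du) :- f :* (# 7 :* ((s₇ :- s) :* w)) :=
    (:- # 1) :* (dp :- (df :* w :+ f :* (# 7 :* du))) :+ # 1 :* (dp :- :- (# 7 :* s :* p)) :+
    (:- (# 7 :* s)) :* (p :- f :* w) :+ (:- w) :* (df :- :- (# 7 :* s₇ :* f))) R.refl
    (f₁ ⁷) (D (f₁ ⁷)) f₇ (D f₇) u (D u) S₍ 1 ₎ s₇)))
  where
  product : D (f₇ ⊠ (K 1ℤ ⊞ K (+ 7) ⊠ u)) ≈ D f₇ ⊠ (K 1ℤ ⊞ K (+ 7) ⊠ u) ⊞ f₇ ⊠ (K (+ 7) ⊠ D u)
  product = R.trans (D-⊠ f₇ (K 1ℤ ⊞ K (+ 7) ⊠ u)) (⊞-congˡ (⊠-congˡ (R.trans (D-⊞ (K 1ℤ) (K (+ 7) ⊠ u))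
    (R.trans (R.+-cong (D-K 1ℤ) (D-K⊠ (+ 7) u)) (R.+-identityˡ (K (+ 7) ⊠ D u))))))
  logarithmic : ∀ {F c} → D F ≈ ⊝ (K c ⊠ S₍ 1 ₎ ⊠ F) → D (F ⊠ f₁) ≈ ⊝ (K (1ℤ ℤ.+ c) ⊠ S₍ 1 ₎ ⊠ (F ⊠ f₁))
  logarithmic {F} {c} p = R.trans (D-⊠ F f₁) (R.trans
    (by-combination (f₁ ⊙ p & F ⊙ Df₁)
      (S.solve 6 (λ g dg h dh s k → dg :* h :+ g :* dh :- :- ((# 1 :+ k) :* s :* (g :* h)) :=
        h :* (dg :- :- (k :* s :* g)) :+ g :* (dh :- :- (s :* h))) R.refl F (D F) f₁ (D f₁) S₍ 1 ₎ (K c)))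
    (R.-‿cong (⊠-congʳ (⊠-congʳ (R.sym (K-+ 1ℤ c))))))
  seventh : D (f₁ ⁷) ≈ ⊝ (K (+ 7) ⊠ S₍ 1 ₎ ⊠ f₁ ⁷)
  seventh = logarithmic (logarithmic (logarithmic (logarithmic (logarithmic (logarithmic
    (R.trans Df₁ (S.solve 2 (λ s g → :- (s :* g) := :- (# 1 :* s :* g)) R.refl S₍ 1 ₎ f₁)))))))

-- Exchanging divisor and codivisor makes `S₍ 1 ₎` comparable with `D S₍ 5 ₎` monomial by monomial:
-- at q^(md) the difference is m⁵ · md - d = d (m⁶ - 1).
S₁-swap : S₍ 1 ₎ ≈ Σ∞ (λ m → Σ∞ (λ d → K ((+ suc d) ℤ.^ 1) ⊠ q^ (suc m * suc d)))
S₁-swap = R.trans (Σ∞-cong (λ m → R.sym (Σ∞-K ((+ suc m) ℤ.^ 1) (λ d → q^ (suc m * suc d)))))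
  (R.trans (Σ∞-swap (λ m d → K ((+ suc m) ℤ.^ 1) ⊠ q^ (suc m * suc d)))
    (Σ∞-cong (λ d → Σ∞-cong (λ m → ⊠-congˡ (q^-≡ (ℕ.*-comm (suc m) (suc d)))))))

DS₅ : D S₍ 5 ₎ ≈ Σ∞ (λ m → Σ∞ (λ d → K ((+ suc m) ℤ.^ 5 ℤ.* + (suc m * suc d)) ⊠ q^ (suc m * suc d)))
DS₅ = R.trans (D-Σ∞ (λ m → K ((+ suc m) ℤ.^ 5) ⊠ Λ m)) (Σ∞-cong (λ m →
  R.trans (D-K⊠ ((+ suc m) ℤ.^ 5) (Λ m)) (R.trans (⊠-congˡ (D-Σ∞ (λ d → q^ (suc m * suc d))))
    (R.trans (R.sym (Σ∞-K ((+ suc m) ℤ.^ 5) (λ d → D (q^ (suc m * suc d)))))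
      (Σ∞-cong (λ d → R.trans (⊠-congˡ (D-q^ (suc m * suc d)))
        (R.trans (R.sym (R.*-assoc (K ((+ suc m) ℤ.^ 5)) (K (+ (suc m * suc d))) (q^ (suc m * suc d))))
          (⊠-congʳ (R.sym (K-* ((+ suc m) ℤ.^ 5) (+ (suc m * suc d))))))))))))

-- n σ₅(n) ≡ σ₁(n) modulo 7 for n prime to 7, by Fermat's little theorem.
∣-DS₅-S₁ : ∀ n → 7 ∤ n → + 7 ∣ₛ (D S₍ 5 ₎ ⊟ S₍ 1 ₎) n
∣-DS₅-S₁ n 7∤n = subst (+ 7 ∣ₛ_)
  (sym (at (R.trans (R.+-cong DS₅ (R.-‿cong S₁-swap)) combine) n))
  (∣-Σ∞ (λ m → ∣-Σ∞ (λ d → subst (+ 7 ∣ₛ_) (ℤ.*-identityˡ _)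
    (∣-monomial 1ℤ (weight m d) (suc m * suc d) n (λ e → subst (+ 7 ∣ₛ_) (rewrite-weight m d)
      (Signed.∣n⇒∣m*n (+ suc d) (fermat (suc m) (λ 7∣m → 7∤n (subst (7 ∣ℕ_) e (∣m⇒∣m*n (suc d) 7∣m))))))))))
  where
  weight : ℕ → ℕ → ℤ
  weight m d = (+ suc m) ℤ.^ 5 ℤ.* + (suc m * suc d) ℤ.+ ℤ.- (+ suc d) ℤ.^ 1
  combine : Σ∞ (λ m → Σ∞ (λ d → K ((+ suc m) ℤ.^ 5 ℤ.* + (suc m * suc d)) ⊠ q^ (suc m * suc d))) ⊟
            Σ∞ (λ m → Σ∞ (λ d → K ((+ suc d) ℤ.^ 1) ⊠ q^ (suc m * suc d))) ≈
            Σ∞ (λ m → Σ∞ (λ d → K (weight m d) ⊠ q^ (suc m * suc d)))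
  combine = R.trans (⊞-congˡ (R.sym (Σ∞-⊝ _))) (R.trans (R.sym (Σ∞-⊞ _ _)) (Σ∞-cong (λ m →
    R.trans (⊞-congˡ (R.sym (Σ∞-⊝ _))) (R.trans (R.sym (Σ∞-⊞ _ _)) (Σ∞-cong (λ d →
      R.trans (S.solve 3 (λ a b x → a :* x :+ :- (b :* x) := (a :+ :- b) :* x) R.refl
        (K ((+ suc m) ℤ.^ 5 ℤ.* + (suc m * suc d))) (K ((+ suc d) ℤ.^ 1)) (q^ (suc m * suc d)))
      (⊠-congʳ (R.sym (R.trans (K-+ _ (ℤ.- (+ suc d) ℤ.^ 1)) (⊞-congˡ (K-neg ((+ suc d) ℤ.^ 1))))))))))))
  rewrite-weight : ∀ m d → + suc d ℤ.* ((+ suc m) ℤ.^ 6 ℤ.- 1ℤ) ≡ 1ℤ ℤ.* weight m d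
  rewrite-weight m d = trans (e (+ suc m) (+ suc d) ((+ suc m) ℤ.^ 5))
    (cong (λ x → 1ℤ ℤ.* ((+ suc m) ℤ.^ 5 ℤ.* x ℤ.+ ℤ.- (+ suc d) ℤ.^ 1)) (sym (ℤ.pos-* (suc m) (suc d))))
    where
    e : ∀ m d p → d ℤ.* (m ℤ.* p ℤ.- 1ℤ) ≡ 1ℤ ℤ.* (p ℤ.* (m ℤ.* d) ℤ.+ ℤ.- (d ℤ.* 1ℤ))
    e = solve-∀

κ : PowerSeries
κ = u ⊞ S₍ 5 ₎

-- Modulo 7, D κ = (S₁(q⁷) - S₁) + D S₅ vanishes at n prime to 7, and n can be cancelled from n κₙ.
∣-κ : ∀ n → 7 ∤ n → + 7 ∣ₛ κ n
∣-κ n 7∤n = 7-cancel n (κ n) 7∤n (subst (+ 7 ∣ₛ_) (sym value)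
  (Signed.∣m∣n⇒∣m+n (∣-DS₅-S₁ n 7∤n) (Signed.∣m⇒∣m*n (((s₇ ⊟ S₍ 1 ₎) ⊠ u) n) Signed.∣-refl)))
  where
  open ≡-Reasoning
  Dκ : D κ ≈ s₇ ⊞ ((D S₍ 5 ₎ ⊟ S₍ 1 ₎) ⊞ K (+ 7) ⊠ ((s₇ ⊟ S₍ 1 ₎) ⊠ u))
  Dκ = R.trans (D-⊞ u S₍ 5 ₎) (by-combination (K 1ℤ ⊙ Du)
    (S.solve 5 (λ du d₅ s₁ s₇ u → du :+ d₅ :- (s₇ :+ (d₅ :- s₁ :+ # 7 :* ((s₇ :- s₁) :* u))) :=
      # 1 :* (du :- (s₇ :- s₁) :* (# 1 :+ # 7 :* u))) R.refl (D u) (D S₍ 5 ₎) S₍ 1 ₎ s₇ u))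
  value : + n ℤ.* κ n ≡ (D S₍ 5 ₎ ⊟ S₍ 1 ₎) n ℤ.+ + 7 ℤ.* ((s₇ ⊟ S₍ 1 ₎) ⊠ u) n
  value = begin
    + n ℤ.* κ n
      ≡⟨ trans (sym (D-at κ n)) (trans (at Dκ n) (⊞-at s₇ _ n)) ⟩
    s₇ n ℤ.+ ((D S₍ 5 ₎ ⊟ S₍ 1 ₎) ⊞ K (+ 7) ⊠ ((s₇ ⊟ S₍ 1 ₎) ⊠ u)) n
      ≡⟨ cong (ℤ._+ ((D S₍ 5 ₎ ⊟ S₍ 1 ₎) ⊞ K (+ 7) ⊠ ((s₇ ⊟ S₍ 1 ₎) ⊠ u)) n) (sub-nonmultiple 7 S₍ 1 ₎ 7∤n) ⟩
    0ℤ ℤ.+ ((D S₍ 5 ₎ ⊟ S₍ 1 ₎) ⊞ K (+ 7) ⊠ ((s₇ ⊟ S₍ 1 ₎) ⊠ u)) n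
      ≡⟨ trans (ℤ.+-identityˡ _) (trans (⊞-at (D S₍ 5 ₎ ⊟ S₍ 1 ₎) _ n) (cong (ℤ._+_ ((D S₍ 5 ₎ ⊟ S₍ 1 ₎) n)) (K-⊠ (+ 7) _ n))) ⟩
    (D S₍ 5 ₎ ⊟ S₍ 1 ₎) n ℤ.+ + 7 ℤ.* ((s₇ ⊟ S₍ 1 ₎) ⊠ u) n ∎

-- 1 + 7u is inverted modulo 49 by (2 - 14u)(1 + 7u) = 2 - 98u²; the factor 2 makes 14u match the 14
-- S₅ of the bracket. The rest collects the multiples of 49: 98 X E₄, 98 u², the constant 10 + 90 -
-- 2 = 98, and 90 · 504 + 14 = 49 · 926 at S₅.
remainder : PowerSeries
remainder = K (+ 2) ⊠ X ⊠ E₄ ⊠ (f₁ ⊠ θ) ⊞ K (+ 926) ⊠ S₍ 5 ₎ ⊠ (f₁ ⊠ θ) ⊞ K (+ 2) ⊠ a₃ ⊠ f₇ ⊠ u ⊠ u ⊟ K (+ 2) ⊠ (f₁ ⊠ θ)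

2a₃f₇ : K (+ 2) ⊠ (a₃ ⊠ f₇) ≈
        ((K (+ 10) ⊠ (f₁ ⊠ θ) ⊟ bracket) ⊟ K (+ 14) ⊠ ((f₁ ⊠ θ) ⊠ κ)) ⊞ K (+ 49) ⊠ remainder
2a₃f₇ = by-combination
  (K 1ℤ ⊙ bracket-closed & K (+ 2) ⊟ K (+ 14) ⊠ u ⊙ R.trans (⊠-congˡ (R.sym f₁⁷)) a₃f₁⁷)
  (S.solve 8 (λ A f F B u s x q →
    # 2 :* (A :* f) :-
      (((# 10 :* F :- B) :- # 14 :* (F :* (u :+ s))) :+
        # 49 :* (# 2 :* x :* q :* F :+ # 926 :* s :* F :+ # 2 :* A :* f :* u :* u :- # 2 :* F)) :=
    # 1 :* (B :- (# 98 :* x :* q :- # 90 :* (# 1 :- # 504 :* s)) :* F) :+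
    (# 2 :- # 14 :* u) :* (A :* (f :* (# 1 :+ # 7 :* u)) :- F)) R.refl
    a₃ f₇ (f₁ ⊠ θ) bracket u S₍ 5 ₎ X E₄)

-- Coefficients in the progression 7n + 4

sum-of-squares : ∀ n i j x z → i + j ≡ 7 * n + 4 → 24 * i + 1 ≡ x * x → 24 * j + 1 ≡ z * z →
                 x * x + z * z ≡ 7 * (24 * n + 14)
sum-of-squares n i j x z e ex ez = trans (sym (cong₂ _+_ ex ez)) (trans (e₁ i j) (trans (cong (λ s → 24 * s + 2) e) (e₂ n)))
  where
  e₁ : ∀ i j → 24 * i + 1 + (24 * j + 1) ≡ 24 * (i + j) + 2
  e₁ = ℕ-ring.solve-∀
  e₂ : ∀ n → 24 * (7 * n + 4) + 2 ≡ 7 * (24 * n + 14)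
  e₂ = ℕ-ring.solve-∀

f₁θ-comm : ∀ n → (f₁ ⊠ θ) n ≡ (θ ⊠ f₁) n
f₁θ-comm = at (R.*-comm f₁ θ)

∣-f₁θ : ∀ {d} n → (∀ x z → x * x + z * z ≡ 7 * (24 * n + 14) → 7 ∣ℕ x → 7 ∣ℕ z → d ∣ₛ + x) → d ∣ₛ (f₁ ⊠ θ) (7 * n + 4)
∣-f₁θ {d} n p = subst (d ∣ₛ_) (sym (f₁θ-comm (7 * n + 4)))
  (∣-θf₁ (λ _ → 1ℤ) (λ _ → 1ℤ) (7 * n + 4) (λ i → sym (ℤ.*-identityˡ (θ i))) (λ j → sym (ℤ.*-identityˡ (f₁ j)))
    (λ i j x z e ex ez → let e′ = sum-of-squares n i j x z e ex ez in
      Signed.∣n⇒∣m*n (1ℤ ℤ.* 1ℤ) (p x z e′ (proj₁ (7∣x²+z² x z (24 * n + 14) e′)) (proj₂ (7∣x²+z² x z (24 * n + 14) e′)))))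

7∣f₁θ : ∀ n → + 7 ∣ₛ (f₁ ⊠ θ) (7 * n + 4)
7∣f₁θ n = ∣-f₁θ n (λ x z _ 7∣x _ → ∣ℕ⇒∣ₛ 7∣x)

-- If 7 divides x and z, then 49 divides x² + z² = 7 (24 n + 14).
49∣f₁θ : ∀ n → 7 ∤ n → + 49 ∣ₛ (f₁ ⊠ θ) (7 * n + 4)
49∣f₁θ n 7∤n = ∣-f₁θ n λ { x z e (divides x′ refl) (divides z′ refl) → contradiction (7∣n x′ z′ e) 7∤n }
  where
  cancel-24 : ∀ n → 7 ∣ℕ 24 * n → 7 ∣ℕ n
  cancel-24 n p with euclid-7 24 n p
  ... | inj₂ 7∣n  = 7∣n
  ... | inj₁ 7∣24 = contradiction 7∣24 (from-no (7 ∣? 24))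
  7∣n : ∀ x′ z′ → x′ * 7 * (x′ * 7) + z′ * 7 * (z′ * 7) ≡ 7 * (24 * n + 14) → 7 ∣ℕ n
  7∣n x′ z′ e = cancel-24 n (∣m+n∣m⇒∣n {m = 14}
    (divides (x′ * x′ + z′ * z′) (trans (ℕ.+-comm 14 (24 * n)) (ℕ.*-cancelˡ-≡ _ _ 7 (trans (sym e) (e₁ x′ z′)))))
    (divides 2 refl))
    where
    e₁ : ∀ x z → x * 7 * (x * 7) + z * 7 * (z * 7) ≡ 7 * ((x * x + z * z) * 7)
    e₁ = ℕ-ring.solve-∀

ω : ℕ → ℤ
ω n = + 24 ℤ.* + n ℤ.+ 1ℤ

Δ-at : ∀ F n → Δ F n ≡ ω n ℤ.* F n
Δ-at F n = trans (⊞-at (K (+ 24) ⊠ D F) F n)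
  (trans (cong (ℤ._+ F n) (trans (K-⊠ (+ 24) (D F) n) (cong (+ 24 ℤ.*_) (D-at F n)))) (e (+ n) (F n)))
  where
  e : ∀ n x → + 24 ℤ.* (n ℤ.* x) ℤ.+ x ≡ (+ 24 ℤ.* n ℤ.+ 1ℤ) ℤ.* x
  e = solve-∀

Δ²-at : ∀ F n → Δ (Δ F) n ≡ ω n ℤ.* ω n ℤ.* F n
Δ²-at F n = trans (Δ-at (Δ F) n) (trans (cong (ω n ℤ.*_) (Δ-at F n)) (sym (ℤ.*-assoc (ω n) (ω n) (F n))))

Δ³-at : ∀ F n → Δ (Δ (Δ F)) n ≡ ω n ℤ.* ω n ℤ.* ω n ℤ.* F n
Δ³-at F n = trans (Δ²-at (Δ F) n) (trans (cong (ω n ℤ.* ω n ℤ.*_) (Δ-at F n)) (sym (ℤ.*-assoc (ω n ℤ.* ω n) (ω n) (F n))))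

7∣ω : ∀ i x → 24 * i + 1 ≡ x * x → 7 ∣ℕ x → + 7 ∣ₛ ω i
7∣ω i x e 7∣x = subst (+ 7 ∣ₛ_) (trans (cong +_ (sym e)) (cong (ℤ._+ 1ℤ) (ℤ.pos-* 24 i))) (∣ℕ⇒∣ₛ (∣m⇒∣m*n x 7∣x))

49∣* : ∀ {a b} → + 7 ∣ₛ a → + 7 ∣ₛ b → + 49 ∣ₛ a ℤ.* b
49∣* {a} {b} (Signed.divides r refl) (Signed.divides s refl) = Signed.divides (r ℤ.* s) (e r s)
  where
  e : ∀ r s → (r ℤ.* + 7) ℤ.* (s ℤ.* + 7) ≡ (r ℤ.* s) ℤ.* + 49
  e = solve-∀

-- Three applications of `Δ` fall on two factors, so one factor receives at least two of them and
-- contributes the square of a weight `ω` divisible by 7.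
49∣bracket : ∀ n → + 49 ∣ₛ bracket (7 * n + 4)
49∣bracket n = plus (plus (plus
    (term (λ i → ω i ℤ.* ω i ℤ.* ω i) (λ _ → 1ℤ) (Δ³-at θ) (λ j → sym (ℤ.*-identityˡ (f₁ j)))
      (λ i j wi wj → Signed.∣m⇒∣m*n 1ℤ (Signed.∣m⇒∣m*n (ω i) (49∣* wi wi))))
    (minus (term (λ i → + 21 ℤ.* (ω i ℤ.* ω i)) ω (scaled (+ 21) {Δ (Δ θ)} (λ i → ω i ℤ.* ω i) (Δ²-at θ)) (Δ-at f₁)
      (λ i j wi wj → Signed.∣m⇒∣m*n (ω j) (Signed.∣n⇒∣m*n (+ 21) (49∣* wi wi))))))
    (term (λ i → + 35 ℤ.* ω i) (λ j → ω j ℤ.* ω j) (scaled (+ 35) {Δ θ} ω (Δ-at θ)) (Δ²-at f₁)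
      (λ i j wi wj → Signed.∣n⇒∣m*n (+ 35 ℤ.* ω i) (49∣* wj wj))))
    (minus (term (λ _ → + 7) (λ j → ω j ℤ.* ω j ℤ.* ω j) (K-⊠ (+ 7) θ) (Δ³-at f₁)
      (λ i j wi wj → Signed.∣n⇒∣m*n (+ 7) (Signed.∣m⇒∣m*n (ω j) (49∣* wj wj)))))
  where
  plus : ∀ {F G m} → + 49 ∣ₛ F m → + 49 ∣ₛ G m → + 49 ∣ₛ (F ⊞ G) m
  plus {F} {G} {m} p r = subst (+ 49 ∣ₛ_) (sym (⊞-at F G m)) (Signed.∣m∣n⇒∣m+n p r)
  minus : ∀ {F m} → + 49 ∣ₛ F m → + 49 ∣ₛ (⊝ F) m
  minus {F} {m} p = subst (+ 49 ∣ₛ_) (sym (⊝-at F m)) (Signed.∣m⇒∣-m p)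
  scaled : ∀ c {F} (α : ℕ → ℤ) → (∀ i → F i ≡ α i ℤ.* θ i) → ∀ i → (K c ⊠ F) i ≡ c ℤ.* α i ℤ.* θ i
  scaled c {F} α p i = trans (K-⊠ c F i) (trans (cong (c ℤ.*_) (p i)) (sym (ℤ.*-assoc c (α i) (θ i))))
  term : ∀ {F G} (α β : ℕ → ℤ) → (∀ i → F i ≡ α i ℤ.* θ i) → (∀ j → G j ≡ β j ℤ.* f₁ j) →
         (∀ i j → + 7 ∣ₛ ω i → + 7 ∣ₛ ω j → + 49 ∣ₛ α i ℤ.* β j) → + 49 ∣ₛ (F ⊠ G) (7 * n + 4)
  term α β F≡ G≡ p = ∣-θf₁ α β (7 * n + 4) F≡ G≡ (λ i j x z e ex ez →
    let both = 7∣x²+z² x z (24 * n + 14) (sum-of-squares n i j x z e ex ez) in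
    Signed.∣m⇒∣m*n (+ x) (p i j (7∣ω i x ex (proj₁ both)) (7∣ω j z ez (proj₂ both))))

residue-split : ∀ n r i j → i + j ≡ 7 * n + r → 7 ∣ℕ j → r < 7 → Σ ℕ (λ m → i ≡ 7 * m + r)
residue-split n r i j e (divides t refl) r<7 = n ∸ t , ℕ.+-cancelʳ-≡ (t * 7) _ _ (trans e (begin
  7 * n + r                       ≡⟨ cong (λ s → 7 * s + r) (sym (ℕ.m∸n+n≡m t≤n)) ⟩
  7 * (n ∸ t + t) + r             ≡⟨ e₁ (n ∸ t) t r ⟩
  7 * (n ∸ t) + r + t * 7         ∎))
  where
  open ≡-Reasoning
  e₁ : ∀ s t r → 7 * (s + t) + r ≡ 7 * s + r + t * 7
  e₁ = ℕ-ring.solve-∀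
  t≤n : t ≤ n
  t≤n = ℕ.≤-pred (ℕ.*-cancelˡ-< 7 t (suc n) (ℕ.≤-<-trans (ℕ.≤-reflexive (ℕ.*-comm 7 t))
    (ℕ.≤-<-trans (ℕ.m≤n+m (t * 7) i) (ℕ.<-≤-trans (ℕ.≤-<-trans (ℕ.≤-reflexive e) (ℕ.+-monoʳ-< (7 * n) r<7))
      (ℕ.≤-reflexive (trans (ℕ.+-comm (7 * n) 7) (sym (ℕ.*-suc 7 n))))))))

-- Modulo 7, `κ` is a series in q⁷, so multiplication by it preserves the residue class 4.
7∣f₁θκ : ∀ n → + 7 ∣ₛ ((f₁ ⊠ θ) ⊠ κ) (7 * n + 4)
7∣f₁θκ n = ∣-⊠ (7 * n + 4) go
  where
  go : ∀ i j → i + j ≡ 7 * n + 4 → + 7 ∣ₛ (f₁ ⊠ θ) i ℤ.* κ j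
  go i j e with 7 ∣? j
  ... | no  7∤j = Signed.∣n⇒∣m*n ((f₁ ⊠ θ) i) (∣-κ j 7∤j)
  ... | yes 7∣j with residue-split n 4 i j e 7∣j (s≤s (s≤s (s≤s (s≤s (s≤s z≤n)))))
  ...   | m , refl = Signed.∣m⇒∣m*n (κ j) (7∣f₁θ m)

-- Serves twice: with d = 7 for every n, and with d = 49 where 7 ∤ n.
∣-a₃f₇ : ∀ {d} n → d ∣ₛ + 49 → d ∣ₛ (f₁ ⊠ θ) (7 * n + 4) → d ∣ₛ + 2 ℤ.* (a₃ ⊠ f₇) (7 * n + 4)
∣-a₃f₇ {d} n d∣49 p = subst (d ∣ₛ_) (sym value)
  (Signed.∣m∣n⇒∣m+n (Signed.∣m∣n⇒∣m-n (Signed.∣m∣n⇒∣m-n (Signed.∣n⇒∣m*n (+ 10) p) (Signed.∣-trans d∣49 (49∣bracket n)))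
      (Signed.∣-trans d∣49 (fourteen (7∣f₁θκ n))))
    (Signed.∣m⇒∣m*n (remainder N) d∣49))
  where
  N : ℕ
  N = 7 * n + 4
  fourteen : ∀ {z} → + 7 ∣ₛ z → + 49 ∣ₛ + 14 ℤ.* z
  fourteen p = 49∣* (Signed.divides (+ 2) refl) p
  value : + 2 ℤ.* (a₃ ⊠ f₇) N ≡
    + 10 ℤ.* (f₁ ⊠ θ) N ℤ.- bracket N ℤ.- + 14 ℤ.* ((f₁ ⊠ θ) ⊠ κ) N ℤ.+ + 49 ℤ.* remainder N
  value = trans (sym (K-⊠ (+ 2) (a₃ ⊠ f₇) N)) (trans (at 2a₃f₇ N)
    (trans (⊞-at ((K (+ 10) ⊠ (f₁ ⊠ θ) ⊟ bracket) ⊟ K (+ 14) ⊠ ((f₁ ⊠ θ) ⊠ κ)) (K (+ 49) ⊠ remainder) N)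
      (cong₂ ℤ._+_
        (trans (⊞-at (K (+ 10) ⊠ (f₁ ⊠ θ) ⊟ bracket) (⊝ (K (+ 14) ⊠ ((f₁ ⊠ θ) ⊠ κ))) N) (cong₂ ℤ._+_
          (trans (⊞-at (K (+ 10) ⊠ (f₁ ⊠ θ)) (⊝ bracket) N) (cong₂ ℤ._+_ (K-⊠ (+ 10) (f₁ ⊠ θ) N) (⊝-at bracket N)))
          (trans (⊝-at (K (+ 14) ⊠ ((f₁ ⊠ θ) ⊠ κ)) N) (cong ℤ.-_ (K-⊠ (+ 14) ((f₁ ⊠ θ) ⊠ κ) N)))))
        (K-⊠ (+ 49) remainder N))))

7∣2* : ∀ z → + 7 ∣ₛ + 2 ℤ.* z → + 7 ∣ₛ z
7∣2* z p = Signed.∣m+n∣n⇒∣m (subst (+ 7 ∣ₛ_) (e z) (Signed.∣n⇒∣m*n (+ 4) p)) (Signed.∣m⇒∣m*n z Signed.∣-refl)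
  where
  e : ∀ z → + 4 ℤ.* (+ 2 ℤ.* z) ≡ z ℤ.+ + 7 ℤ.* z
  e = solve-∀

unit-∣ : ∀ {d} F G → F 0 ≡ 1ℤ → (∀ n → d ∣ₛ (F ⊠ G) n) → ∀ n → d ∣ₛ G n
unit-∣ {d} F G F₀ p n = subst (d ∣ₛ_) (sym (at inverse n))
  (∣-⊠ n (λ i j _ → Signed.∣n⇒∣m*n (recip F i) (p j)))
  where
  inverse : G ≈ recip F ⊠ (F ⊠ G)
  inverse = R.trans (R.sym (R.*-identityˡ G)) (R.trans
    (⊠-congʳ (R.sym (R.trans (⊠-at F (recip F)) (pw (recip-inverse {F} F₀)))))
    (S.solve 3 (λ f r g → f :* r :* g := r :* (f :* g)) R.refl F (recip F) G))

-- The section a₃(7n + 4) and its second factor 7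

section₄ : PowerSeries
section₄ n = a₃ (7 * n + 4)

f₇-section : ∀ G r → r < 7 → ∀ n → (f₇ ⊠ G) (7 * n + r) ≡ (f₁ ⊠ (λ m → G (7 * m + r))) n
f₇-section G r r<7 n = trans (at (⊠-congʳ (R.sym (sub-f 7))) (7 * n + r)) (sub-section 7 f₁ G r r<7 n)

section₄-f₁ : ∀ n → (a₃ ⊠ f₇) (7 * n + 4) ≡ (f₁ ⊠ section₄) n
section₄-f₁ n = trans (at (R.*-comm a₃ f₇) (7 * n + 4)) (f₇-section a₃ 4 (s≤s (s≤s (s≤s (s≤s (s≤s z≤n))))) n)

7∣section₄ : ∀ n → + 7 ∣ₛ section₄ n
7∣section₄ = unit-∣ f₁ section₄ refl (λ n → subst (+ 7 ∣ₛ_) (section₄-f₁ n)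
  (7∣2* _ (∣-a₃f₇ n (Signed.divides (+ 7) refl) (7∣f₁θ n))))

opaque
  quotient₄ : PowerSeries
  quotient₄ = proj₁ (divide (+ 7) section₄ 7∣section₄)

  section₄≈ : section₄ ≈ K (+ 7) ⊠ quotient₄
  section₄≈ = proj₂ (divide (+ 7) section₄ 7∣section₄)

7∣f₁quotient₄ : ∀ n → 7 ∤ n → + 7 ∣ₛ (f₁ ⊠ quotient₄) n
7∣f₁quotient₄ n 7∤n = Signed.*-cancelˡ-∣ (+ 7) (subst (+ 49 ∣ₛ_)
  (trans (section₄-f₁ n) (trans (at (R.trans (⊠-congˡ section₄≈)
    (S.solve 3 (λ f k g → f :* (k :* g) := k :* (f :* g)) R.refl f₁ (K (+ 7)) quotient₄)) n) (K-⊠ (+ 7) (f₁ ⊠ quotient₄) n)))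
  (49∣2* _ (∣-a₃f₇ n Signed.∣-refl (49∣f₁θ n 7∤n))))

-- The exponents of f₁⁶ are governed by x² + z² again, through f₁³ = ∑ ± x q^((x² - 1)/8).
7∣J₁² : ∀ m → + 7 ∣ₛ (J₍ 1 ₎ ⊠ J₍ 1 ₎) (7 * m + 5)
7∣J₁² m = ∣-⊠ (7 * m + 5) (λ i j e → ∣-J₁ (J₍ 1 ₎ i) j (λ z ez →
  subst (+ 7 ∣ₛ_) (ℤ.*-comm (+ z) (J₍ 1 ₎ i)) (∣-J₁ (+ z) i (λ x ex →
    Signed.∣n⇒∣m*n (+ z) (∣ℕ⇒∣ₛ (proj₁ (7∣x²+z² x z (8 * m + 6)
      (trans (sym (cong₂ _+_ ex ez)) (trans (e₁ i j) (trans (cong (λ s → 8 * s + 2) e) (e₂ m)))))))))))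
  where
  e₁ : ∀ i j → 8 * i + 1 + (8 * j + 1) ≡ 8 * (i + j) + 2
  e₁ = ℕ-ring.solve-∀
  e₂ : ∀ m → 8 * (7 * m + 5) + 2 ≡ 7 * (8 * m + 6)
  e₂ = ℕ-ring.solve-∀

-- Modulo 7, f₇ is f₁⁶ · f₁. In the convolution at 7m + 5 the factor f₁ times the quotient vanishes
-- unless its index is a multiple of 7; then the index of f₁⁶ = J₁² is 5 modulo 7, where that series
-- vanishes.
7∣f₇quotient₄ : ∀ m → + 7 ∣ₛ (f₇ ⊠ quotient₄) (7 * m + 5)
7∣f₇quotient₄ m = subst (+ 7 ∣ₛ_) (sym value)
  (Signed.∣m∣n⇒∣m-n (∣-⊠ N go) (Signed.∣m⇒∣m*n ((G ⊠ quotient₄) N) Signed.∣-refl))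
  where
  N : ℕ
  N = 7 * m + 5
  G : PowerSeries
  G = proj₁ f₁⁷-mod-7
  split : f₇ ⊠ quotient₄ ≈ (J₍ 1 ₎ ⊠ J₍ 1 ₎) ⊠ (f₁ ⊠ quotient₄) ⊟ K (+ 7) ⊠ (G ⊠ quotient₄)
  -- The multiplier of `jacobi` comes from f₁⁶ - J₁² = (f₁³ - J₁)(f₁³ + J₁).
  split = by-combination (⊝ quotient₄ ⊙ proj₂ f₁⁷-mod-7 & f₁ ⊠ (f₁ ⊠ f₁ ⊠ f₁ ⊟ J₍ 1 ₎) ⊠ quotient₄ ⊙ jacobi)
    (S.solve 5 (λ f f₇ g j k → f₇ :* k :- ((j :* j) :* (f :* k) :- # 7 :* (g :* k)) :=
      (:- k) :* (f :* f :* f :* f :* f :* f :* f :- (f₇ :+ # 7 :* g)) :+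
      f :* (f :* f :* f :- j) :* k :* (f :* f :* f :- :- j)) R.refl f₁ f₇ G J₍ 1 ₎ quotient₄)
  value : (f₇ ⊠ quotient₄) N ≡ ((J₍ 1 ₎ ⊠ J₍ 1 ₎) ⊠ (f₁ ⊠ quotient₄)) N ℤ.- + 7 ℤ.* (G ⊠ quotient₄) N
  value = trans (at split N) (trans (⊞-at _ (⊝ (K (+ 7) ⊠ (G ⊠ quotient₄))) N)
    (cong (ℤ._+_ (((J₍ 1 ₎ ⊠ J₍ 1 ₎) ⊠ (f₁ ⊠ quotient₄)) N))
      (trans (⊝-at (K (+ 7) ⊠ (G ⊠ quotient₄)) N) (cong ℤ.-_ (K-⊠ (+ 7) (G ⊠ quotient₄) N)))))
  go : ∀ i j → i + j ≡ N → + 7 ∣ₛ (J₍ 1 ₎ ⊠ J₍ 1 ₎) i ℤ.* (f₁ ⊠ quotient₄) j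
  go i j e with 7 ∣? j
  ... | no  7∤j = Signed.∣n⇒∣m*n ((J₍ 1 ₎ ⊠ J₍ 1 ₎) i) (7∣f₁quotient₄ j 7∤j)
  ... | yes 7∣j with residue-split m 5 i j e 7∣j (s≤s (s≤s (s≤s (s≤s (s≤s (s≤s z≤n))))))
  ...   | k , refl = Signed.∣m⇒∣m*n ((f₁ ⊠ quotient₄) j) (7∣J₁² k)

7∣quotient₄ : ∀ n → + 7 ∣ₛ quotient₄ (7 * n + 5)
7∣quotient₄ = unit-∣ f₁ (λ n → quotient₄ (7 * n + 5)) refl
  (λ n → subst (+ 7 ∣ₛ_) (f₇-section quotient₄ 5 (s≤s (s≤s (s≤s (s≤s (s≤s (s≤s z≤n)))))) n) (7∣f₇quotient₄ n))

theorem1p2 : (n : ℕ) → + (7 ^ 2) ∣ a 3 (7 ^ 2 * n + 39)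
-- As 39 = 7 · 5 + 4, the class 5 modulo 7 within the section of class 4 is reached: one factor 7
-- comes from the section, the other from its quotient.
theorem1p2 n = Signed.∣⇒∣ᵤ (subst (λ N → + 49 ∣ₛ a₃ N) (sym (e n))
  (subst (+ 49 ∣ₛ_) (sym (trans (at section₄≈ (7 * n + 5)) (K-⊠ (+ 7) quotient₄ (7 * n + 5))))
    (49∣* Signed.∣-refl (7∣quotient₄ n))))
  where
  e : ∀ n → 49 * n + 39 ≡ 7 * (7 * n + 5) + 4
  e = ℕ-ring.solve-∀
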